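{- Unweighted Robust Stable Set is solvable in polynomial time on bipartite graphs.
   Context: Unweighted Robust Stable Set: given a graph $G=(V,E)$, with $\mathcal{F}$ the family of stable sets of $G$, solve $$\max_{S\in\mathcal{F}}\ \min_{f\in V\cup\{\emptyset\}}\ \max_{\substack{e\in (V\setminus(S\cup\{f\}))\cup\{\emptyset\}\\ (S\setminus\{f\})\cup\{e\}\in\mathcal{F}}} |(S\setminus\{f\})\cup\{e\}|,$$ where $f=\emptyset$ means no vertex is deleted and $e=\emptyset$ means no vertex is added. -}

module Defs where

open import Data.Bool.Base using (Bool; true; false; T; if_then_else_)
open import Data.Bool.Properties using (T?)
open import Data.Fin.Base using (Fin)
open import Data.Fin.Properties using (all?)
open import Data.Fin.Subset using (Subset; ⊥; ⁅_⁆; _∈_; _⊆_; ∁; _∪_; _─_; ∣_∣)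
open import Data.Fin.Subset.Properties using (_∈?_; _⊆?_)
open import Data.List.Base using (List; []; _∷_; _++_; [_]; map; concatMap; filter; allFin; length)
open import Data.List.Extrema.Nat using (max; min)
open import Data.Maybe.Base using (Maybe; just; nothing)
open import Data.Nat.Base using (ℕ; zero; suc; _+_; _*_; _∸_; _^_; _≤_; _≡ᵇ_)
open import Data.Product.Base using (∃-syntax; _×_)
open import Data.Vec.Base using (toList)
open import Relation.Binary.PropositionalEquality.Core using (_≡_)
open import Relation.Nullary using (¬_; Dec; ¬?; _×-dec_; _→-dec_)

-- Random access machines in the style of Cook and Reckhow (1973), with registers in ℕ and
-- truncated subtraction.  Every executed instruction costs one time unit.  As sums and
-- differences are the only arithmetic, the longest register gains at most one bit per step, so this
-- cost measure agrees with Turing machine time up to a polynomial.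

data Instr : Set where
  const : (i c : ℕ)   → Instr   -- Xᵢ ← c
  add   : (i j k : ℕ) → Instr   -- Xᵢ ← Xⱼ + Xₖ
  sub   : (i j k : ℕ) → Instr   -- Xᵢ ← Xⱼ ∸ Xₖ
  load  : (i j : ℕ)   → Instr   -- Xᵢ ← X[Xⱼ]
  store : (i j : ℕ)   → Instr   -- X[Xᵢ] ← Xⱼ
  jump  : (m j : ℕ)   → Instr   -- if Xⱼ > 0 go to instruction m
  read  : (i : ℕ)     → Instr   -- Xᵢ ← next input number, 0 if there is none
  print : (i : ℕ)     → Instr   -- append Xᵢ to the output

Program : Set
Program = List Instr

Memory : Set
Memory = ℕ → ℕ

_[_≔_] : Memory → ℕ → ℕ → Memory
(X [ i ≔ v ]) j = if i ≡ᵇ j then v else X j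

record Config : Set where
  constructor ⟨_,_,_,_⟩
  field
    pc     : ℕ
    mem    : Memory
    input  : List ℕ
    output : List ℕ

fetch : Program → ℕ → Maybe Instr
fetch []      _       = nothing
fetch (I ∷ P) zero    = just I
fetch (I ∷ P) (suc n) = fetch P n

exec : Instr → Config → Config
exec (const i c) ⟨ p , X , is , os ⟩ = ⟨ suc p , X [ i ≔ c ] , is , os ⟩
exec (add i j k) ⟨ p , X , is , os ⟩ = ⟨ suc p , X [ i ≔ X j + X k ] , is , os ⟩
exec (sub i j k) ⟨ p , X , is , os ⟩ = ⟨ suc p , X [ i ≔ X j ∸ X k ] , is , os ⟩
exec (load i j)  ⟨ p , X , is , os ⟩ = ⟨ suc p , X [ i ≔ X (X j) ] , is , os ⟩
exec (store i j) ⟨ p , X , is , os ⟩ = ⟨ suc p , X [ X i ≔ X j ] , is , os ⟩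
exec (jump m j)  ⟨ p , X , is , os ⟩ = ⟨ (if X j ≡ᵇ 0 then suc p else m) , X , is , os ⟩
exec (read i) ⟨ p , X , [] , os ⟩     = ⟨ suc p , X [ i ≔ 0 ] , [] , os ⟩
exec (read i) ⟨ p , X , x ∷ is , os ⟩ = ⟨ suc p , X [ i ≔ x ] , is , os ⟩
exec (print i) ⟨ p , X , is , os ⟩    = ⟨ suc p , X , is , os ++ [ X i ] ⟩

-- P ⊢ c ⇓[ t ] os : started in c, program P halts after exactly t steps with output os.
-- A program halts when its program counter points outside of it.
data _⊢_⇓[_]_ (P : Program) : Config → ℕ → List ℕ → Set where
  halt : ∀ {c} → fetch P (Config.pc c) ≡ nothing →
         P ⊢ c ⇓[ 0 ] Config.output c
  step : ∀ {c I t os} → fetch P (Config.pc c) ≡ just I →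
         P ⊢ exec I c ⇓[ t ] os → P ⊢ c ⇓[ suc t ] os

initial : List ℕ → Config
initial is = ⟨ 0 , (λ _ → 0) , is , [] ⟩

record Problem : Set₁ where
  field
    Instance : Set
    encode   : Instance → List ℕ
    Solution : Instance → List ℕ → Set

-- Size is the number of input numbers, which never exceeds the number of input bits.
PolyTimeSolvableOn : (Π : Problem) → (Problem.Instance Π → Set) → Set
PolyTimeSolvableOn Π C =
  ∃[ P ] ∃[ a ] ∃[ d ] ∀ (x : Instance) → C x →
    ∃[ t ] ∃[ os ]
      P ⊢ initial (encode x) ⇓[ t ] os ×
      t ≤ a * length (encode x) ^ d + a ×
      Solution x os
  where open Problem Π

record Graph : Set where
  field
    order  : ℕ
    adj    : Fin order → Fin order → Bool
    sym    : ∀ u v → adj u v ≡ adj v u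
    irrefl : ∀ v → adj v v ≡ false

  VertexSet : Set
  VertexSet = Subset order

module _ (G : Graph) where
  open Graph G

  Stable : VertexSet → Set
  Stable S = ∀ u v → u ∈ S → v ∈ S → ¬ T (adj u v)

  stable? : ∀ S → Dec (Stable S)
  stable? S = all? λ u → all? λ v → (u ∈? S) →-dec ((v ∈? S) →-dec ¬? (T? (adj u v)))

  Bipartite : Set
  Bipartite = ∃[ A ] Stable A × Stable (∁ A)

  -- V ∪ {∅}, with nothing for ∅
  Choice : Set
  Choice = Maybe (Fin order)

  choices : List Choice
  choices = nothing ∷ map just (allFin order)

  -- {x} for a vertex x, and the empty set for x = ∅
  ⟪_⟫ : Choice → VertexSet
  ⟪ nothing ⟫ = ⊥
  ⟪ just v ⟫  = ⁅ v ⁆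

  recovered : VertexSet → Choice → Choice → VertexSet
  recovered S f e = (S ─ ⟪ f ⟫) ∪ ⟪ e ⟫

  Admissible : VertexSet → Choice → Choice → Set
  Admissible S f e = ⟪ e ⟫ ⊆ ∁ (S ∪ ⟪ f ⟫) × Stable (recovered S f e)

  admissible? : ∀ S f e → Dec (Admissible S f e)
  admissible? S f e = (⟪ e ⟫ ⊆? ∁ (S ∪ ⟪ f ⟫)) ×-dec stable? (recovered S f e)

  -- The default 0 of max is harmless: if S is stable, then e = ∅ is admissible.
  recoveryValue : VertexSet → Choice → ℕ
  recoveryValue S f =
    max 0 (map (λ e → ∣ recovered S f e ∣) (filter (admissible? S f) choices))

  -- The default of min is the value at f = ∅, which is one of the values minimised over.
  robustValue : VertexSet → ℕ
  robustValue S = min (recoveryValue S nothing) (map (recoveryValue S) choices)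

  Optimal : VertexSet → Set
  Optimal S = Stable S × (∀ S′ → Stable S′ → robustValue S′ ≤ robustValue S)

bit : Bool → ℕ
bit b = if b then 1 else 0

-- The number of vertices followed by the rows of the adjacency matrix.
encodeGraph : Graph → List ℕ
encodeGraph G = order ∷ concatMap (λ u → map (λ v → bit (adj u v)) (allFin order)) (allFin order)
  where open Graph G

-- A solution is the optimal value followed by the characteristic vector of a set attaining it.
UnweightedRobustStableSet : Problem
UnweightedRobustStableSet = record
  { Instance = Graph
  ; encode   = encodeGraph
  ; Solution = λ G os → ∃[ S ] Optimal G S × os ≡ robustValue G S ∷ map bit (toList S)
  }

{-# OPTIONS --safe #-}
module Submission where

open import Defs
open import Data.Bool.Base using (Bool; true; false; T; not; _∧_; if_then_else_)
open import Data.Bool.Properties using (T?; T-∧)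
open import Data.Empty using (⊥-elim)
open import Data.Fin.Base using (Fin; zero; suc; toℕ; fromℕ<)
import Data.Fin.Properties as Fin
open import Data.Fin.Properties using (toℕ-fromℕ<; toℕ<n; toℕ-injective; pigeonhole)
open import Data.Fin.Subset using (Subset; Empty; inside; outside; ⊥; ⁅_⁆; _∈_; _∉_; _⊆_; ∁; _∪_; _─_; _-_; ∣_∣)
open import Data.Fin.Subset.Properties
open import Data.List.Base using (List; []; _∷_; _++_; length; map; filter; concatMap; allFin; take; drop)
import Data.List.Base as List
open import Data.List.Extrema.Nat using (max≤v⁺; v≤max⁺; v≤min⁺; min≤v⁺; argmax-sel)
open import Data.List.Membership.Propositional using () renaming (_∈_ to _∈ˡ_)
open import Data.List.Membership.Propositional.Properties using (∈-map⁺; ∈-map⁻; ∈-filter⁺; ∈-filter⁻; ∈-allFin)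
open import Data.List.Properties using (length-map; length-tabulate; length-++; ++-assoc; ++-identityʳ)
import Data.List.Relation.Unary.All as All
import Data.List.Relation.Unary.Any as Any
open import Data.Maybe.Base using (just; nothing)
open import Data.Nat.Base
open import Data.Nat.DivMod using (_%_; _/_; [m+kn]%n≡m%n; m<n⇒m%n≡m; +-distrib-/-∣ˡ; m*n/n≡m; m<n⇒m/n≡0)
open import Data.Nat.Divisibility using (n∣m*n)
open import Data.Nat.ListAction using (sum)
open import Data.Nat.ListAction.Properties using (sum-++)
open import Data.Nat.Properties
open import Data.Nat.Tactic.RingSolver using (solve-∀)
open import Data.Product.Base using (∃-syntax; Σ-syntax; _×_; _,_; proj₁; proj₂)
open import Data.Sum.Base using (_⊎_; inj₁; inj₂)
open import Data.Unit.Base using (tt)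
open import Data.Vec.Base using (Vec; []; _∷_; here; there; lookup; tabulate; toList)
open import Data.Vec.Properties using (lookup∘tabulate; []=⇒lookup; lookup⇒[]=)
open import Function.Base using (_∘_; _$_; id)
open import Function.Bundles using (Equivalence)
open import Relation.Binary.PropositionalEquality hiding ([_])
open import Relation.Nullary using (¬_; yes; no; _×-dec_; _⊎-dec_)
open import Relation.Nullary.Decidable using (decidable-stable)

-- A deletion and a recovery can at best restore the size of a largest stable set, whose size is α,
-- and they never lose more than one vertex; hence the optimum is α or α − 1.  It is α exactly
-- if G arises from another graph by attaching one leaf to each vertex: a robust set S of size α
-- needs for every f in S a vertex outside S whose only neighbour in S is f, and as α ≥ n / 2 in
-- a bipartite graph, these vertices are all vertices outside S, so that S consists of leaves.  This can
-- be tested directly, and otherwise every maximum stable set is optimal.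
--
-- To find a maximum stable set, the graph is 2-coloured and an auction matches the vertices of colour 1
-- (the bidders) with those of colour 2 (the objects): an unmatched bidder takes a cheapest neighbour of
-- price < n, raising that price by one.  Let k ≤ n be a level that is not a price.  The bidders all of
-- whose neighbours cost more than k, and the objects that cost less than k, form a stable set, and the
-- matching maps the other vertices injectively into it along edges, so it is maximum.
--
-- Commands whose only loops run through the vertices compile to random access machine programs
-- of polynomial running time, and the algorithm is such a command.

-- The absence of unbounded loops shapes the algorithm. Augmenting paths would have to be stored and
-- followed over varying lengths, whereas a step of the auction is one search over pairs of vertices
-- and three array writes, and the sum of the differences between n and the prices bounds the number
-- of steps by n * n beforehand. The prices also carry the certificate of maximality: an owned
-- object costs at most one more than any neighbour of its owner, so a level that is no price cannot
-- lie below the former and above the latter. The test for the value α needs no candidate for the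
-- robust set. If such a set exists, the vertices pair off into a leaf and its neighbour, and
-- choosing one leaf from each pair, by colour if both are leaves, again gives a robust set. This
-- choice can be read off the graph.

infixl 6 _⊕_ _⊖_
infix  4 _:=_
infixr 3 _；_

-- A loop language over the vertices

data Array : Set where
  adjacent colour owner partner price chosen leaf pendant dominated : Array

-- The number n of vertices is fixed during a run, and every loop runs through the vertices.
-- In the scope of d loops, idx refers to the vertices of these loops by de Bruijn indices.
data Exp (d : ℕ) : Set where
  lit     : ℕ → Exp d
  size    : Exp d
  idx row : Fin d → Exp d
  var     : ℕ → Exp d
  get     : Array → Exp d → Exp d
  _⊕_ _⊖_ : Exp d → Exp d → Exp d

data Cmd (d : ℕ) : Set where
  skip  : Cmd d
  _:=_  : ℕ → Exp d → Cmd d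
  put   : Array → Exp d → Exp d → Cmd d
  input : Array → Exp d → Cmd d
  print : Exp d → Cmd d
  _；_  : Cmd d → Cmd d → Cmd d
  ifpos : Exp d → Cmd d → Cmd d → Cmd d
  for   : Cmd (suc d) → Cmd d

code : Array → ℕ
code adjacent  = 1
code colour    = 2
code owner     = 3
code partner   = 4
code price     = 5
code chosen    = 6
code leaf      = 7
code pendant   = 8
code dominated = 9

record State : Set where
  constructor state
  field
    vars : ℕ → ℕ
    arr  : Array → ℕ → ℕ
    ins  : List ℕ
    outs : List ℕ
open State

-- The test on the names precedes the abstraction over the index, so that writing to one array
-- leaves every other one definitionally unchanged as a function.
writeArr : (Array → ℕ → ℕ) → Array → ℕ → ℕ → Array → ℕ → ℕ
writeArr A a i x b = if code a ≡ᵇ code b then A a [ i ≔ x ] else A b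

takeInput : Array → ℕ → State → State
takeInput a i (state V A []       os) = state V (writeArr A a i 0) [] os
takeInput a i (state V A (x ∷ is) os) = state V (writeArr A a i x) is os

-- The number `k` counts finished iterations, so that invariants indexed by it are proved by plain
-- induction.
upTo : ∀ {n} (f : Fin n → State → State) k → k ≤ n → State → State
upTo f zero    _   σ = σ
upTo f (suc k) k<n σ = f (fromℕ< k<n) (upTo f k (<⇒≤ k<n) σ)

Env : ℕ → ℕ → Set
Env n d = Vec (Fin n) d

choose : ℕ → State → State → State
choose zero    σ τ = τ
choose (suc _) σ τ = σ

module _ {n : ℕ} where

  ⟦_⟧ᵉ : ∀ {d} → Exp d → Env n d → State → ℕ
  ⟦ lit c ⟧ᵉ   ρ σ = c
  ⟦ size ⟧ᵉ    ρ σ = n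
  ⟦ idx i ⟧ᵉ   ρ σ = toℕ (lookup ρ i)
  ⟦ row i ⟧ᵉ   ρ σ = toℕ (lookup ρ i) * n
  ⟦ var x ⟧ᵉ   ρ σ = vars σ x
  ⟦ get a e ⟧ᵉ ρ σ = arr σ a (⟦ e ⟧ᵉ ρ σ)
  ⟦ e ⊕ f ⟧ᵉ   ρ σ = ⟦ e ⟧ᵉ ρ σ + ⟦ f ⟧ᵉ ρ σ
  ⟦ e ⊖ f ⟧ᵉ   ρ σ = ⟦ e ⟧ᵉ ρ σ ∸ ⟦ f ⟧ᵉ ρ σ

  ⟦_⟧ : ∀ {d} → Cmd d → Env n d → State → State
  ⟦ skip ⟧        ρ σ = σ
  ⟦ x := e ⟧      ρ σ = record σ { vars = vars σ [ x ≔ ⟦ e ⟧ᵉ ρ σ ] }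
  ⟦ put a e f ⟧   ρ σ = record σ { arr = writeArr (arr σ) a (⟦ e ⟧ᵉ ρ σ) (⟦ f ⟧ᵉ ρ σ) }
  ⟦ input a e ⟧   ρ σ = takeInput a (⟦ e ⟧ᵉ ρ σ) σ
  ⟦ print e ⟧     ρ σ = record σ { outs = outs σ ++ (⟦ e ⟧ᵉ ρ σ ∷ []) }
  ⟦ c ； d ⟧      ρ σ = ⟦ d ⟧ ρ (⟦ c ⟧ ρ σ)
  ⟦ ifpos e c d ⟧ ρ σ = choose (⟦ e ⟧ᵉ ρ σ) (⟦ c ⟧ ρ σ) (⟦ d ⟧ ρ σ)
  ⟦ for c ⟧       ρ σ = upTo (λ i → ⟦ c ⟧ (i ∷ ρ)) n ≤-refl σ

-- Memory layout

data Cell : Set where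
  tmp : ℕ → Cell
  scl : ℕ → Cell
  at  : Array → ℕ → Cell

-- This is `16 * i + k`, written as the four doublings that `address` performs, because the machine
-- cannot multiply. The tags `k` run from 0 to 10, and 16 is the least power of two with room for
-- them.
slot : ℕ → ℕ → ℕ
slot k i = (i + i) + (i + i) + ((i + i) + (i + i)) + ((i + i) + (i + i) + ((i + i) + (i + i))) + k

opaque
  -- Opaque, so that addresses stay symbolic: apart from `slot-code`, only the injectivity of the
  -- layout is used later.
  ⌜_⌝ : Cell → ℕ
  ⌜ tmp t ⌝  = slot 0 t
  ⌜ at a i ⌝ = slot (code a) i
  ⌜ scl x ⌝  = slot 10 x

  slot-code : ∀ a i → slot (code a) i ≡ ⌜ at a i ⌝
  slot-code a i = refl

-- Decodes a tag and an offset. Having a left inverse, the layout is injective, and the eleven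
-- regions need not be compared pairwise.
cell : ℕ → ℕ → Cell
cell 0 = tmp
cell 1 = at adjacent
cell 2 = at colour
cell 3 = at owner
cell 4 = at partner
cell 5 = at price
cell 6 = at chosen
cell 7 = at leaf
cell 8 = at pendant
cell 9 = at dominated
cell _ = scl

slot≡ : ∀ i k → (i + i) + (i + i) + ((i + i) + (i + i)) + ((i + i) + (i + i) + ((i + i) + (i + i))) + k
              ≡ k + i * 16
slot≡ = solve-∀

cell-slot : ∀ k i → k < 16 → cell (slot k i % 16) (slot k i / 16) ≡ cell k i
cell-slot k i k<16 = cong₂ cell
  (trans (cong (_% 16) (slot≡ i k)) (trans ([m+kn]%n≡m%n k i 16) (m<n⇒m%n≡m k<16)))
  (begin
    slot k i / 16            ≡⟨ cong (_/ 16) (trans (slot≡ i k) (+-comm k (i * 16))) ⟩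
    (i * 16 + k) / 16        ≡⟨ +-distrib-/-∣ˡ k (n∣m*n i) ⟩
    i * 16 / 16 + k / 16     ≡⟨ cong₂ _+_ (m*n/n≡m i 16) (m<n⇒m/n≡0 k<16) ⟩
    i + 0                    ≡⟨ +-identityʳ i ⟩
    i                        ∎)
  where open ≡-Reasoning

opaque
  unfolding ⌜_⌝

  cell-⌜⌝ : ∀ c → cell (⌜ c ⌝ % 16) (⌜ c ⌝ / 16) ≡ c
  cell-⌜⌝ (tmp t)          = cell-slot 0 t (≤ᵇ⇒≤ _ _ tt)
  cell-⌜⌝ (scl x)          = cell-slot 10 x (≤ᵇ⇒≤ _ _ tt)
  cell-⌜⌝ (at adjacent i)  = cell-slot 1 i (≤ᵇ⇒≤ _ _ tt)
  cell-⌜⌝ (at colour i)    = cell-slot 2 i (≤ᵇ⇒≤ _ _ tt)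
  cell-⌜⌝ (at owner i)     = cell-slot 3 i (≤ᵇ⇒≤ _ _ tt)
  cell-⌜⌝ (at partner i)   = cell-slot 4 i (≤ᵇ⇒≤ _ _ tt)
  cell-⌜⌝ (at price i)     = cell-slot 5 i (≤ᵇ⇒≤ _ _ tt)
  cell-⌜⌝ (at chosen i)    = cell-slot 6 i (≤ᵇ⇒≤ _ _ tt)
  cell-⌜⌝ (at leaf i)      = cell-slot 7 i (≤ᵇ⇒≤ _ _ tt)
  cell-⌜⌝ (at pendant i)   = cell-slot 8 i (≤ᵇ⇒≤ _ _ tt)
  cell-⌜⌝ (at dominated i) = cell-slot 9 i (≤ᵇ⇒≤ _ _ tt)

⌜⌝-injective : ∀ {c c′} → ⌜ c ⌝ ≡ ⌜ c′ ⌝ → c ≡ c′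
⌜⌝-injective {c} {c′} eq =
  trans (sym (cell-⌜⌝ c)) (trans (cong (λ a → cell (a % 16) (a / 16)) eq) (cell-⌜⌝ c′))

≡ᵇ-refl : ∀ i → (i ≡ᵇ i) ≡ true
≡ᵇ-refl zero    = refl
≡ᵇ-refl (suc i) = ≡ᵇ-refl i

≢⇒≡ᵇ-false : ∀ {i j} → i ≢ j → (i ≡ᵇ j) ≡ false
≢⇒≡ᵇ-false {zero}  {zero}  i≢j = ⊥-elim (i≢j refl)
≢⇒≡ᵇ-false {zero}  {suc j} i≢j = refl
≢⇒≡ᵇ-false {suc i} {zero}  i≢j = refl
≢⇒≡ᵇ-false {suc i} {suc j} i≢j = ≢⇒≡ᵇ-false {i} {j} (i≢j ∘ cong suc)

updated : ∀ X i v → (X [ i ≔ v ]) i ≡ v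
updated X i v rewrite ≡ᵇ-refl i = refl

unaffected : ∀ X {i j} v → j ≢ i → (X [ i ≔ v ]) j ≡ X j
unaffected X {i} {j} v j≢i rewrite ≢⇒≡ᵇ-false {i} {j} (j≢i ∘ sym) = refl

-- Compilation

reset : ℕ → Instr
reset t = const ⌜ tmp t ⌝ 0

address : ℕ → ℕ → Program
address k t =
  add ⌜ tmp t ⌝ ⌜ tmp t ⌝ ⌜ tmp t ⌝ ∷
  add ⌜ tmp t ⌝ ⌜ tmp t ⌝ ⌜ tmp t ⌝ ∷
  add ⌜ tmp t ⌝ ⌜ tmp t ⌝ ⌜ tmp t ⌝ ∷
  add ⌜ tmp t ⌝ ⌜ tmp t ⌝ ⌜ tmp t ⌝ ∷
  const ⌜ tmp (suc t) ⌝ k ∷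
  add ⌜ tmp t ⌝ ⌜ tmp t ⌝ ⌜ tmp (suc t) ⌝ ∷ []

-- There is no move instruction. As the target is cleared first, it has to differ from the source.
copy : ℕ → ℕ → Program
copy i j = const i 0 ∷ add i i j ∷ []

-- Register tmp 0 holds n.  A loop in the scope of d others keeps the index i of the current
-- vertex and the number i * n in the registers tmp (base d) and tmp (suc (base d)).
base : ℕ → ℕ
base zero    = 1
base (suc d) = suc (suc (base d))

register : ∀ {d} → Fin d → ℕ
register {suc d} zero    = base d
register {suc d} (suc i) = register i

compileᵉ : ∀ {d} → Exp d → ℕ → Program
compileᵉ (lit c)   t = const ⌜ tmp t ⌝ c ∷ []
compileᵉ size      t = copy ⌜ tmp t ⌝ ⌜ tmp 0 ⌝
compileᵉ (idx i)   t = copy ⌜ tmp t ⌝ ⌜ tmp (register i) ⌝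
compileᵉ (row i)   t = copy ⌜ tmp t ⌝ ⌜ tmp (suc (register i)) ⌝
compileᵉ (var x)   t = copy ⌜ tmp t ⌝ ⌜ scl x ⌝
compileᵉ (get a e) t = compileᵉ e t ++ address (code a) t ++ load ⌜ tmp t ⌝ ⌜ tmp t ⌝ ∷ []
compileᵉ (e ⊕ f)   t =
  compileᵉ e t ++ compileᵉ f (suc t) ++ add ⌜ tmp t ⌝ ⌜ tmp t ⌝ ⌜ tmp (suc t) ⌝ ∷ []
compileᵉ (e ⊖ f)   t =
  compileᵉ e t ++ compileᵉ f (suc t) ++ sub ⌜ tmp t ⌝ ⌜ tmp t ⌝ ⌜ tmp (suc t) ⌝ ∷ []

-- The second argument is the position of the code, as jumps are absolute.
compile : ∀ {d} → Cmd d → ℕ → Program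
compile skip p = []
compile {d} (x := e) p = compileᵉ e (base d) ++ copy ⌜ scl x ⌝ ⌜ tmp (base d) ⌝
compile {d} (put a e f) p =
  compileᵉ f t ++ compileᵉ e (suc t) ++ address (code a) (suc t) ++ store ⌜ tmp (suc t) ⌝ ⌜ tmp t ⌝ ∷ []
  where t = base d
compile {d} (input a e) p =
  compileᵉ e (suc t) ++ address (code a) (suc t) ++ read ⌜ tmp t ⌝ ∷ store ⌜ tmp (suc t) ⌝ ⌜ tmp t ⌝ ∷ []
  where t = base d
compile {d} (print e) p = compileᵉ e (base d) ++ Instr.print ⌜ tmp (base d) ⌝ ∷ []
compile (c ； d) p = compile c p ++ compile d (p + length (compile c p))
compile {d} (ifpos e c c′) p =
  compileᵉ e t ++ jump pos ⌜ tmp t ⌝ ∷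
  -- An unconditional jump is a conditional one on a register just set to 1.
  compile c′ neg ++ const ⌜ tmp t ⌝ 1 ∷ jump (pos + length (compile c pos)) ⌜ tmp t ⌝ ∷
  compile c pos
  where
  t    = base d
  neg = suc (p + length (compileᵉ e t))
  pos = suc (suc (neg + length (compile c′ neg)))
compile {d} (for c) p =
  reset t ∷ reset (suc t) ∷
  sub ⌜ tmp s ⌝ ⌜ tmp 0 ⌝ ⌜ tmp t ⌝ ∷ jump body ⌜ tmp s ⌝ ∷
  const ⌜ tmp s ⌝ 1 ∷ jump (4 + (body + length (compile c body))) ⌜ tmp s ⌝ ∷
  compile c body ++
  -- The row offset is maintained by adding n in each iteration, which replaces a multiplication.
  add ⌜ tmp (suc t) ⌝ ⌜ tmp (suc t) ⌝ ⌜ tmp 0 ⌝ ∷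
  -- The 1 in `tmp s` serves twice, as the increment of the index and as the condition of the jump
  -- back.
  const ⌜ tmp s ⌝ 1 ∷ add ⌜ tmp t ⌝ ⌜ tmp t ⌝ ⌜ tmp s ⌝ ∷
  jump (suc (suc p)) ⌜ tmp s ⌝ ∷ []
  where
  t    = base d
  s    = suc (suc t)
  body = 6 + p

-- Runs of bounded length

-- Here `b` is only an upper bound on the number of steps, so that both branches of a conditional
-- fit the same cost.
data _⊢_⟶[_]_ (P : Program) : Config → ℕ → Config → Set where
  done : ∀ {c b} → P ⊢ c ⟶[ b ] c
  step : ∀ {c c′ I b} → fetch P (Config.pc c) ≡ just I →
         P ⊢ exec I c ⟶[ b ] c′ → P ⊢ c ⟶[ suc b ] c′

module _ {P : Program} where

  relax : ∀ {c c′ b b′} → b ≤ b′ → P ⊢ c ⟶[ b ] c′ → P ⊢ c ⟶[ b′ ] c′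
  relax _         done       = done
  relax (s≤s b≤b′) (step f r) = step f (relax b≤b′ r)

  infixr 5 _◅◅_
  _◅◅_ : ∀ {c c′ c″ b b′} → P ⊢ c ⟶[ b ] c′ → P ⊢ c′ ⟶[ b′ ] c″ → P ⊢ c ⟶[ b + b′ ] c″
  _◅◅_ {b = b} {b′} done r = relax (m≤n+m b′ b) r
  step f r ◅◅ r′ = step f (r ◅◅ r′)

  terminates : ∀ {c c′ b} → P ⊢ c ⟶[ b ] c′ → fetch P (Config.pc c′) ≡ nothing →
               ∃[ t ] P ⊢ c ⇓[ t ] Config.output c′ × t ≤ b
  terminates done       h = 0 , halt h , z≤n
  terminates (step f r) h with t , r′ , t≤b ← terminates r h = suc t , step f r′ , s≤s t≤b

  -- Code p Is q : the instructions Is occupy the positions of P from p up to, excluding, q.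
  data Code : ℕ → Program → ℕ → Set where
    []  : ∀ {p} → Code p [] p
    _∷_ : ∀ {p I Is q} → fetch P p ≡ just I → Code (suc p) Is q → Code p (I ∷ Is) q

  split : ∀ {p q} Is {Js} → Code p (Is ++ Js) q → Code p Is (p + length Is) × Code (p + length Is) Js q
  split {p} [] c rewrite +-identityʳ p = [] , c
  split {p} (I ∷ Is) (f ∷ c) with c₁ , c₂ ← split Is c rewrite +-suc p (length Is) = f ∷ c₁ , c₂

-- Positions are absolute, so the induction needs an arbitrary preceding program `Js`, into which it
-- shifts one instruction at a time.
whole : ∀ Is Js → Code {Js ++ Is} (length Js) Is (length Js + length Is)
whole [] Js rewrite +-identityʳ (length Js) = []
whole (I ∷ Is) Js = fetched Js ∷ subst₂ (λ P (p , q) → Code {P} p Is q) (assoc Js)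
    (cong₂ _,_ (len Js) (trans (cong (_+ length Is) (len Js)) (sym (+-suc (length Js) (length Is)))))
    (whole Is (Js ++ (I ∷ [])))
  where
  fetched : ∀ Js → fetch (Js ++ I ∷ Is) (length Js) ≡ just I
  fetched []       = refl
  fetched (J ∷ Js) = fetched Js
  assoc : ∀ Js → (Js ++ (I ∷ [])) ++ Is ≡ Js ++ I ∷ Is
  assoc []       = refl
  assoc (J ∷ Js) = cong (J ∷_) (assoc Js)
  len : ∀ Js → length (Js ++ (I ∷ [])) ≡ suc (length Js)
  len []       = refl
  len (J ∷ Js) = cong suc (len Js)

fetch-length : ∀ P → fetch P (length P) ≡ nothing
fetch-length []      = refl
fetch-length (I ∷ P) = fetch-length P

-- Correctness of the compiler

costᵉ : ∀ {d} → Exp d → ℕ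
costᵉ (get a e) = costᵉ e + 7
costᵉ (e ⊕ f)   = costᵉ e + (costᵉ f + 1)
costᵉ (e ⊖ f)   = costᵉ e + (costᵉ f + 1)
costᵉ _         = 2

cost : ∀ {d} → ℕ → Cmd d → ℕ
cost n skip           = 0
cost n (x := e)        = costᵉ e + 2
cost n (put a e f)    = costᵉ f + (costᵉ e + 7)
cost n (input a e)    = costᵉ e + 8
cost n (print e)      = costᵉ e + 1
cost n (c ； d)       = cost n c + cost n d
cost n (ifpos e c c′) = costᵉ e + (1 + (cost n c + (cost n c′ + 2)))
cost n (for c)        = 2 + (n * (6 + cost n c) + 4)

-- The frame condition of compiled expressions: the registers `tmp s` from `t` on act as a stack
-- that may be overwritten, while loop registers, variables and arrays survive.
record Agree (t : ℕ) (X Y : Memory) : Set where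
  constructor agree
  field
    agrees : ∀ c → (∀ s → t ≤ s → c ≢ tmp s) → Y ⌜ c ⌝ ≡ X ⌜ c ⌝
open Agree

base≤ : ∀ {d} (i : Fin d) → suc (register i) < base d
base≤ {suc d} zero    = ≤-refl
base≤ {suc d} (suc i) = m≤n⇒m≤1+n (m≤n⇒m≤1+n (base≤ i))

base>0 : ∀ d → 0 < base d
base>0 zero    = s≤s z≤n
base>0 (suc d) = s≤s z≤n

record Represents {n d : ℕ} (ρ : Env n d) (σ : State) (X : Memory) : Set where
  constructor repr
  field
    size≡ : X ⌜ tmp 0 ⌝ ≡ n
    idx≡  : ∀ i → X ⌜ tmp (register i) ⌝ ≡ toℕ (lookup ρ i)
    row≡  : ∀ i → X ⌜ tmp (suc (register i)) ⌝ ≡ toℕ (lookup ρ i) * n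
    vars≡ : ∀ x → X ⌜ scl x ⌝ ≡ vars σ x
    arr≡  : ∀ a i → X ⌜ at a i ⌝ ≡ arr σ a i
open Represents

tmp-injective : ∀ {s t} → tmp s ≡ tmp t → s ≡ t
tmp-injective refl = refl

below : ∀ {s t} → s < t → ∀ u → t ≤ u → tmp s ≢ tmp u
below s<t u t≤u eq = <⇒≢ (<-≤-trans s<t t≤u) (tmp-injective eq)

represents-agree : ∀ {n d t} {ρ : Env n d} {σ X Y} → base d ≤ t → Agree t X Y →
                   Represents ρ σ X → Represents ρ σ Y
represents-agree {d = d} b≤t ag r = record
  { size≡ = trans (agrees ag (tmp 0) (below (<-≤-trans (base>0 d) b≤t))) (size≡ r)
  ; idx≡  = λ i → trans (agrees ag _ (below (<-≤-trans (<-trans (n<1+n _) (base≤ i)) b≤t))) (idx≡ r i)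
  ; row≡  = λ i → trans (agrees ag _ (below (<-≤-trans (base≤ i) b≤t))) (row≡ r i)
  ; vars≡ = λ x → trans (agrees ag _ (λ _ _ ())) (vars≡ r x)
  ; arr≡  = λ a i → trans (agrees ag _ (λ _ _ ())) (arr≡ r a i)
  }

agree-trans : ∀ {t X Y Z} → Agree t X Y → Agree t Y Z → Agree t X Z
agree-trans a b = agree λ c h → trans (agrees b c h) (agrees a c h)

agree-weaken : ∀ {t u X Y} → t ≤ u → Agree u X Y → Agree t X Y
agree-weaken t≤u a = agree λ c h → agrees a c (λ s u≤s → h s (≤-trans t≤u u≤s))

agree-update : ∀ {t s} X v → t ≤ s → Agree t X (X [ ⌜ tmp s ⌝ ≔ v ])
agree-update X v t≤s = agree λ c h → unaffected X v (λ eq → h _ t≤s (⌜⌝-injective eq))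

module _ {P : Program} where

  Runs : ℕ → Memory → ℕ → Memory → List ℕ → List ℕ → ℕ → Set
  Runs p X q Y is os b = P ⊢ ⟨ p , X , is , os ⟩ ⟶[ b ] ⟨ q , Y , is , os ⟩

  copy-correct : ∀ {p q X is os} i j → Code {P} p (copy i j) q → j ≢ i →
    ∃[ Y ] Runs p X q Y is os 2 × Y i ≡ X j × (∀ k → k ≢ i → Y k ≡ X k)
  copy-correct {X = X} i j (f₁ ∷ f₂ ∷ []) j≢i =
    _ , step f₁ (step f₂ done) ,
    trans (updated (X [ i ≔ 0 ]) i _) (cong₂ _+_ (updated X i 0) (unaffected X 0 j≢i)) ,
    λ k k≢i → trans (unaffected (X [ i ≔ 0 ]) _ k≢i) (unaffected X 0 k≢i)

  address-correct : ∀ {p q X is os k v} t → Code {P} p (address k t) q → X ⌜ tmp t ⌝ ≡ v →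
    ∃[ Y ] Runs p X q Y is os 6 × Y ⌜ tmp t ⌝ ≡ slot k v × Agree t X Y
  address-correct {p} {q} {X} {k = k} {v} t (f₁ ∷ f₂ ∷ f₃ ∷ f₄ ∷ f₅ ∷ f₆ ∷ []) X≡v =
    X₆ , step f₁ (step f₂ (step f₃ (step f₄ (step f₅ (step f₆ done))))) , val ,
    agree-trans ag₁ (agree-trans ag₂ (agree-trans ag₃ (agree-trans ag₄ (agree-trans ag₅ ag₆))))
    where
    a = ⌜ tmp t ⌝
    b = ⌜ tmp (suc t) ⌝
    X₁ = X [ a ≔ X a + X a ]
    X₂ = X₁ [ a ≔ X₁ a + X₁ a ]
    X₃ = X₂ [ a ≔ X₂ a + X₂ a ]
    X₄ = X₃ [ a ≔ X₃ a + X₃ a ]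
    X₅ = X₄ [ b ≔ k ]
    X₆ = X₅ [ a ≔ X₅ a + X₅ b ]
    ag₁ = agree-update {t} {t} X (X a + X a) ≤-refl
    ag₂ = agree-update {t} {t} X₁ (X₁ a + X₁ a) ≤-refl
    ag₃ = agree-update {t} {t} X₂ (X₂ a + X₂ a) ≤-refl
    ag₄ = agree-update {t} {t} X₃ (X₃ a + X₃ a) ≤-refl
    ag₅ = agree-update {t} {suc t} X₄ k (n≤1+n t)
    ag₆ = agree-update {t} {t} X₅ (X₅ a + X₅ b) ≤-refl
    double : ∀ {Z w} → Z a ≡ w → (Z [ a ≔ Z a + Z a ]) a ≡ w + w
    double {Z} eq = trans (updated Z a _) (cong₂ _+_ eq eq)
    val : X₆ a ≡ slot k v
    val = trans (updated X₅ a _) (cong₂ _+_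
      (trans (unaffected X₄ k λ eq → 1+n≢n (sym (tmp-injective (⌜⌝-injective {tmp t} {tmp (suc t)} eq))))
             (double {X₃} (double {X₂} (double {X₁} (double {X} X≡v)))))
      (updated X₄ b k))

  exp-correct : ∀ {n d} {ρ : Env n d} {σ p q X is os} (e : Exp d) {t} →
    Code {P} p (compileᵉ e t) q → base d ≤ t → Represents ρ σ X →
    ∃[ Y ] Runs p X q Y is os (costᵉ e) × Y ⌜ tmp t ⌝ ≡ ⟦ e ⟧ᵉ ρ σ × Agree t X Y

  copy-exp : ∀ {t p q X is os v} c → Code {P} p (copy ⌜ tmp t ⌝ ⌜ c ⌝) q → c ≢ tmp t → X ⌜ c ⌝ ≡ v →
    ∃[ Y ] Runs p X q Y is os 2 × Y ⌜ tmp t ⌝ ≡ v × Agree t X Y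
  copy-exp c κ c≢t eq with Y , r , val , rest ← copy-correct _ ⌜ c ⌝ κ (c≢t ∘ ⌜⌝-injective) =
    Y , r , trans val eq , agree λ c′ h → rest _ (λ eq′ → h _ ≤-refl (⌜⌝-injective eq′))

  binary-correct : ∀ {n d} {ρ : Env n d} {σ p q X is os} (e f : Exp d) {t}
    (_∙_ : ℕ → ℕ → ℕ) (op : ℕ → ℕ → ℕ → Instr) →
    (∀ i j k {p X is os} → exec (op i j k) ⟨ p , X , is , os ⟩ ≡ ⟨ suc p , X [ i ≔ X j ∙ X k ] , is , os ⟩) →
    Code {P} p (compileᵉ e t ++ compileᵉ f (suc t) ++ op ⌜ tmp t ⌝ ⌜ tmp t ⌝ ⌜ tmp (suc t) ⌝ ∷ []) q →
    base d ≤ t → Represents ρ σ X →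
    ∃[ Y ] Runs p X q Y is os (costᵉ e + (costᵉ f + 1)) × Y ⌜ tmp t ⌝ ≡ ⟦ e ⟧ᵉ ρ σ ∙ ⟦ f ⟧ᵉ ρ σ × Agree t X Y
  binary-correct e f {t} _∙_ op op≡ κ b≤t r
    with κₑ , κ′ ← split (compileᵉ e t) κ
    with κ-f , (f₁ ∷ []) ← split (compileᵉ f (suc t)) κ′
    with Y , runₑ , valₑ , agₑ ← exp-correct e κₑ b≤t r
    with Z , run-f , val-f , ag-f ← exp-correct f κ-f (m≤n⇒m≤1+n b≤t) (represents-agree b≤t agₑ r)
    = Z [ ⌜ tmp t ⌝ ≔ Z ⌜ tmp t ⌝ ∙ Z ⌜ tmp (suc t) ⌝ ] ,
      runₑ ◅◅ run-f ◅◅ step f₁ (subst (_⊢_⟶[_]_ P _ 0) (op≡ _ _ _) done) ,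
      trans (updated Z ⌜ tmp t ⌝ _) (cong₂ _∙_ (trans (agrees ag-f _ (below ≤-refl)) valₑ) val-f) ,
      agree-trans agₑ (agree-trans (agree-weaken (n≤1+n t) ag-f) (agree-update Z _ ≤-refl))

  exp-correct {X = X} (lit c) {t} (f ∷ []) b≤t r =
    _ , step f done , updated X ⌜ tmp t ⌝ c , agree-update X c ≤-refl
  exp-correct {d = d} size κ b≤t r =
    copy-exp (tmp 0) κ (below (<-≤-trans (base>0 d) b≤t) _ ≤-refl) (size≡ r)
  exp-correct (idx i) κ b≤t r =
    copy-exp (tmp (register i)) κ (below (<-≤-trans (<-trans (n<1+n _) (base≤ i)) b≤t) _ ≤-refl) (idx≡ r i)
  exp-correct (row i) κ b≤t r =
    copy-exp (tmp (suc (register i))) κ (below (<-≤-trans (base≤ i) b≤t) _ ≤-refl) (row≡ r i)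
  exp-correct (var x) κ b≤t r = copy-exp (scl x) κ (λ ()) (vars≡ r x)
  exp-correct {ρ = ρ} {σ} (get a e) {t} κ b≤t r
    with κₑ , κ′ ← split (compileᵉ e t) κ
    with κₐ , (f ∷ []) ← split (address (code a) t) κ′
    with Y , runₑ , valₑ , agₑ ← exp-correct e κₑ b≤t r
    with Z , runₐ , valₐ , agₐ ← address-correct t κₐ valₑ
    = Z [ ⌜ tmp t ⌝ ≔ Z (Z ⌜ tmp t ⌝) ] , runₑ ◅◅ runₐ ◅◅ step f done ,
      trans (updated Z ⌜ tmp t ⌝ _) (trans (cong Z (trans valₐ (slot-code a _)))
        (arr≡ (represents-agree {Y = Z} b≤t (agree-trans agₑ agₐ) r) a (⟦ e ⟧ᵉ ρ σ))) ,
      agree-trans agₑ (agree-trans agₐ (agree-update Z _ ≤-refl))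
  exp-correct (e ⊕ f) κ b≤t r = binary-correct e f _+_ add (λ _ _ _ → refl) κ b≤t r
  exp-correct (e ⊖ f) κ b≤t r = binary-correct e f _∸_ sub (λ _ _ _ → refl) κ b≤t r

decode : ∀ a → cell (code a) 0 ≡ at a 0
decode adjacent  = refl
decode colour    = refl
decode owner     = refl
decode partner   = refl
decode price     = refl
decode chosen    = refl
decode leaf      = refl
decode pendant   = refl
decode dominated = refl

code-injective : ∀ {a b} → code a ≡ code b → a ≡ b
code-injective {a} {b} eq
  with refl ← trans (sym (decode a)) (trans (cong (λ k → cell k 0) eq) (decode b)) = refl

represents-var : ∀ {n d} {ρ : Env n d} {σ X Y x v} → Represents ρ σ X → Y ⌜ scl x ⌝ ≡ v →
  (∀ c → c ≢ scl x → Y ⌜ c ⌝ ≡ X ⌜ c ⌝) → Represents ρ (record σ { vars = vars σ [ x ≔ v ] }) Y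
represents-var {σ = σ} {X} {Y} {x} {v} r val rest = record
  { size≡ = trans (rest _ λ ()) (size≡ r)
  ; idx≡  = λ i → trans (rest _ λ ()) (idx≡ r i)
  ; row≡  = λ i → trans (rest _ λ ()) (row≡ r i)
  ; vars≡ = vars′
  ; arr≡  = λ a i → trans (rest _ λ ()) (arr≡ r a i)
  }
  where
  vars′ : ∀ y → Y ⌜ scl y ⌝ ≡ (vars σ [ x ≔ v ]) y
  vars′ y with y ≟ x
  ... | yes refl = trans val (sym (updated (vars σ) x v))
  ... | no y≢x   = trans (rest (scl y) (λ { refl → y≢x refl })) (trans (vars≡ r y) (sym (unaffected (vars σ) v y≢x)))

represents-put : ∀ {n d} {ρ : Env n d} {σ X} a i v → Represents ρ σ X →
  Represents ρ (record σ { arr = writeArr (arr σ) a i v }) (X [ ⌜ at a i ⌝ ≔ v ])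
represents-put {σ = σ} {X} a i v r = record
  { size≡ = trans (rest _ λ ()) (size≡ r)
  ; idx≡  = λ k → trans (rest _ λ ()) (idx≡ r k)
  ; row≡  = λ k → trans (rest _ λ ()) (row≡ r k)
  ; vars≡ = λ x → trans (rest _ λ ()) (vars≡ r x)
  ; arr≡  = arr′
  }
  where
  rest : ∀ c → c ≢ at a i → (X [ ⌜ at a i ⌝ ≔ v ]) ⌜ c ⌝ ≡ X ⌜ c ⌝
  rest c c≢ = unaffected X v (c≢ ∘ ⌜⌝-injective)
  arr′ : ∀ b j → (X [ ⌜ at a i ⌝ ≔ v ]) ⌜ at b j ⌝ ≡ writeArr (arr σ) a i v b j
  arr′ b j with code a ≡ᵇ code b in eq
  ... | false = trans (rest _ λ { refl → subst T eq (≡⇒≡ᵇ (code b) _ refl) }) (arr≡ r b j)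
  ... | true with refl ← code-injective {a} {b} (≡ᵇ⇒≡ (code a) _ (subst T (sym eq) tt)) with j ≟ i
  ...   | yes refl = trans (updated X _ v) (sym (updated (arr σ a) i v))
  ...   | no j≢i   = trans (rest _ λ { refl → j≢i refl }) (trans (arr≡ r a j) (sym (unaffected (arr σ a) v j≢i)))

represents-io : ∀ {n d} {ρ : Env n d} {V A is os is′ os′ X} →
  Represents ρ (state V A is os) X → Represents ρ (state V A is′ os′) X
represents-io r = repr (size≡ r) (idx≡ r) (row≡ r) (vars≡ r) (arr≡ r)

represents-input : ∀ {n d} {ρ : Env n d} {V A is os is′ os′ X a i} → Represents ρ (state V A is os) X →
  ∀ v → X ⌜ tmp (suc (base d)) ⌝ ≡ ⌜ at a i ⌝ → let Y = X [ ⌜ tmp (base d) ⌝ ≔ v ] in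
  Represents ρ (state V (writeArr A a i v) is′ os′) (Y [ Y ⌜ tmp (suc (base d)) ⌝ ≔ Y ⌜ tmp (base d) ⌝ ])
represents-input {d = d} {ρ} {X = X} {a} {i} r v eq =
  subst₂ (λ j w → Represents ρ _ (X [ ⌜ tmp (base d) ⌝ ≔ v ] [ j ≔ w ]))
    (sym (trans (unaffected X v λ eq → 1+n≢n (tmp-injective (⌜⌝-injective eq))) eq))
    (sym (updated X ⌜ tmp (base d) ⌝ v))
    (represents-put a i v (represents-agree ≤-refl (agree-update X v ≤-refl) (represents-io r)))

module _ {P : Program} where

  jump-taken : ∀ {p X is os m j v b c} → fetch P p ≡ just (jump m j) → X j ≡ suc v →
    P ⊢ ⟨ m , X , is , os ⟩ ⟶[ b ] c → P ⊢ ⟨ p , X , is , os ⟩ ⟶[ suc b ] c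
  jump-taken {p} {X} {is} {os} {m} {c = c} f eq r =
    step f (subst (λ x → P ⊢ ⟨ if x ≡ᵇ 0 then suc p else m , X , is , os ⟩ ⟶[ _ ] c) (sym eq) r)

  jump-ignored : ∀ {p X is os m j b c} → fetch P p ≡ just (jump m j) → X j ≡ 0 →
    P ⊢ ⟨ suc p , X , is , os ⟩ ⟶[ b ] c → P ⊢ ⟨ p , X , is , os ⟩ ⟶[ suc b ] c
  jump-ignored {p} {X} {is} {os} {m} {c = c} f eq r =
    step f (subst (λ x → P ⊢ ⟨ if x ≡ᵇ 0 then suc p else m , X , is , os ⟩ ⟶[ _ ] c) (sym eq) r)

  Executes : ∀ {n d} → Cmd d → Env n d → ℕ → ℕ → Set
  Executes {n} c ρ p q = ∀ {σ X} → Represents ρ σ X →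
    ∃[ Y ] P ⊢ ⟨ p , X , ins σ , outs σ ⟩ ⟶[ cost n c ] ⟨ q , Y , ins (⟦ c ⟧ ρ σ) , outs (⟦ c ⟧ ρ σ) ⟩ ×
           Represents ρ (⟦ c ⟧ ρ σ) Y

  cmd-correct : ∀ {n d} (c : Cmd d) {ρ : Env n d} {p q} → Code {P} p (compile c p) q → Executes c ρ p q

  choose-correct : ∀ {n d} e (c c′ : Cmd d) {ρ : Env n d} {p q} → Code {P} p (compile (ifpos e c c′) p) q →
    Executes (ifpos e c c′) ρ p q
  choose-correct {n} {d} e c c′ {ρ} {p} κ {σ} r
    with κₑ , (f₁ ∷ κ₁) ← split (compileᵉ e (base d)) κ
    with κ′ , (f₂ ∷ f₃ ∷ κ″) ← split (compile c′ (suc (p + length (compileᵉ e (base d))))) κ₁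
    with Y , runₑ , valₑ , agₑ ← exp-correct e κₑ ≤-refl r
    with ⟦ e ⟧ᵉ ρ σ
  ... | suc v with Z , run , r′ ← cmd-correct c κ″ (represents-agree ≤-refl agₑ r) =
    Z , runₑ ◅◅ jump-taken f₁ valₑ (relax (m≤m+n (cost n c) _) run) , r′
  ... | zero with Z , run , r′ ← cmd-correct c′ κ′ (represents-agree ≤-refl agₑ r) =
    Z [ ⌜ tmp (base d) ⌝ ≔ 1 ] ,
    runₑ ◅◅ jump-ignored f₁ valₑ (relax (m≤n+m _ (cost n c)) (run ◅◅ step f₂ (jump-taken f₃ (updated Z ⌜ tmp (base d) ⌝ 1)
      (subst (λ x → P ⊢ _ ⟶[ 0 ] ⟨ x , _ , _ , _ ⟩) (sym (end κ″)) done)))) ,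
    represents-agree ≤-refl (agree-update Z 1 ≤-refl) r′
    where
    end : ∀ {p q Is} → Code {P} p Is q → q ≡ p + length Is
    end {p} []      = sym (+-identityʳ p)
    end {p} (_ ∷ κ) = trans (end κ) (sym (+-suc p _))

  for-correct : ∀ {n d} (c : Cmd (suc d)) {ρ : Env n d} {p q} → Code {P} p (compile (for c) p) q →
    Executes (for c) ρ p q
  for-correct {n} {d} c {ρ} {p} κ₀@(f₁ ∷ f₂ ∷ f₃ ∷ f₄ ∷ f₅ ∷ f₆ ∷ κ) {σ} {X} r
    with κ′ , (g₁ ∷ g₂ ∷ g₃ ∷ g₄ ∷ []) ← split (compile c (6 + p)) κ = exit (prefix n ≤-refl)
    where
    t = base d
    s = suc (suc t)
    τ : ∀ k → k ≤ n → State
    τ k k≤n = upTo (λ i → ⟦ c ⟧ (i ∷ ρ)) k k≤n σ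
    distinct : ∀ {i j} → i ≢ j → ⌜ tmp i ⌝ ≢ ⌜ tmp j ⌝
    distinct i≢j eq = i≢j (tmp-injective (⌜⌝-injective eq))
    t≢1+t : t ≢ suc t
    t≢1+t eq = 1+n≢n (sym eq)
    t≢s : t ≢ s
    t≢s = <⇒≢ (m≤n⇒m≤1+n ≤-refl)

    -- The memory at the loop head when k iterations are over.
    record Head (k : ℕ) (k≤n : k ≤ n) : Set where
      constructor head
      pattern
      field
        {Y}    : Memory
        run    : P ⊢ ⟨ p , X , ins σ , outs σ ⟩ ⟶[ 2 + k * (6 + cost n c) ]
                     ⟨ 2 + p , Y , ins (τ k k≤n) , outs (τ k k≤n) ⟩
        index  : Y ⌜ tmp t ⌝ ≡ k
        offset : Y ⌜ tmp (suc t) ⌝ ≡ k * n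
        memory : Represents ρ (τ k k≤n) Y

    prefix : ∀ k k≤n → Head k k≤n
    prefix zero k≤n = record
      { run    = step f₁ (step f₂ done)
      ; index  = trans (unaffected (X [ ⌜ tmp t ⌝ ≔ 0 ]) 0 (distinct t≢1+t)) (updated X ⌜ tmp t ⌝ 0)
      ; offset = updated (X [ ⌜ tmp t ⌝ ≔ 0 ]) ⌜ tmp (suc t) ⌝ 0
      ; memory = represents-agree ≤-refl
          (agree-trans (agree-update X 0 ≤-refl) (agree-update _ 0 (n≤1+n t))) r
      }
    prefix (suc k) k<n
      with head {Y} run index offset memory ← prefix k (<⇒≤ k<n)
      = record
      -- One iteration takes two steps for the test, the body, and four closing steps, hence
      -- `6 + cost n c`.
      { run    = relax (≤-reflexive eq) (run ◅◅ step f₃ (jump-taken f₄ test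
                   (runᶜ ◅◅ step g₁ (step g₂ (step g₃ (jump-taken {v = 0} g₄ one done))))))
      ; index  = trans (updated Z₂ ⌜ tmp t ⌝ _) (trans (cong₂ _+_
                   (trans (unaffected Z₁ 1 (distinct t≢s)) (trans (unaffected Z _ (distinct t≢1+t))
                     (trans (idx≡ memoryᶜ zero) toℕi))) (updated Z₁ ⌜ tmp s ⌝ 1)) (+-comm k 1))
      ; offset = trans (unaffected Z₂ _ (distinct (t≢1+t ∘ sym))) (trans (unaffected Z₁ 1 (distinct (<⇒≢ ≤-refl)))
                   (trans (updated Z ⌜ tmp (suc t) ⌝ _) (trans (cong₂ _+_
                     (trans (row≡ memoryᶜ zero) (cong (_* n) toℕi)) (size≡ memoryᶜ))
                     (+-comm (k * n) n))))
      ; memory = represents-agree ≤-refl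
          (agree-trans (agree-update Z _ (n≤1+n t))
          (agree-trans (agree-update Z₁ 1 (m≤n+m t 2)) (agree-update Z₂ _ ≤-refl)))
          (repr (size≡ memoryᶜ) (λ i → idx≡ memoryᶜ (suc i)) (λ i → row≡ memoryᶜ (suc i)) (vars≡ memoryᶜ) (arr≡ memoryᶜ))
      }
      where
      i = fromℕ< k<n
      toℕi = toℕ-fromℕ< k<n
      Y′ = Y [ ⌜ tmp s ⌝ ≔ Y ⌜ tmp 0 ⌝ ∸ Y ⌜ tmp t ⌝ ]
      test : Y′ ⌜ tmp s ⌝ ≡ suc (n ∸ suc k)
      test = trans (updated Y ⌜ tmp s ⌝ _) (trans (cong₂ _∸_ (size≡ memory) index) (+-∸-assoc 1 k<n))
      inner : Represents (i ∷ ρ) (τ k (<⇒≤ k<n)) Y′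
      inner = represents-agree ≤-refl (agree-update Y _ ≤-refl) (repr (size≡ memory)
        (λ { zero → trans index (sym toℕi) ; (suc j) → idx≡ memory j })
        (λ { zero → trans offset (cong (_* n) (sym toℕi)) ; (suc j) → row≡ memory j })
        (vars≡ memory) (arr≡ memory))
      bodyᶜ = cmd-correct c κ′ inner
      Z = proj₁ bodyᶜ
      runᶜ = proj₁ (proj₂ bodyᶜ)
      memoryᶜ = proj₂ (proj₂ bodyᶜ)
      Z₁ = Z [ ⌜ tmp (suc t) ⌝ ≔ Z ⌜ tmp (suc t) ⌝ + Z ⌜ tmp 0 ⌝ ]
      Z₂ = Z₁ [ ⌜ tmp s ⌝ ≔ 1 ]
      one = trans (unaffected Z₂ _ (distinct (t≢s ∘ sym))) (updated Z₁ ⌜ tmp s ⌝ 1)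
      arith : ∀ a c → 2 + a + (2 + (c + 4)) ≡ 2 + (6 + c + a)
      arith = solve-∀
      eq = arith (k * (6 + cost n c)) (cost n c)

    exit : Head n ≤-refl → _
    exit (head {Y} run index offset memory) =
      Y″ , run ◅◅ step f₃ (jump-ignored f₄ test (step f₅ (jump-taken {v = 0} f₆ (updated Y′ ⌜ tmp s ⌝ 1) done))) ,
      represents-agree ≤-refl (agree-trans (agree-update Y _ (m≤n+m t 2)) (agree-update Y′ 1 (m≤n+m t 2))) memory
      where
      Y′ = Y [ ⌜ tmp s ⌝ ≔ Y ⌜ tmp 0 ⌝ ∸ Y ⌜ tmp t ⌝ ]
      Y″ = Y′ [ ⌜ tmp s ⌝ ≔ 1 ]
      test : Y′ ⌜ tmp s ⌝ ≡ 0
      test = trans (updated Y ⌜ tmp s ⌝ _) (trans (cong₂ _∸_ (size≡ memory) index) (n∸n≡0 n))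

  cmd-correct skip [] r = _ , done , r
  cmd-correct {d = d} (x := e) κ r
    with κₑ , κ′ ← split (compileᵉ e (base d)) κ
    with Y , runₑ , valₑ , agₑ ← exp-correct e κₑ ≤-refl r
    with Z , run , val , rest ← copy-correct ⌜ scl x ⌝ _ κ′ ((λ ()) ∘ ⌜⌝-injective {tmp (base d)} {scl x})
    = Z , runₑ ◅◅ run , represents-var (represents-agree ≤-refl agₑ r) (trans val valₑ)
      (λ c c≢ → rest _ (c≢ ∘ ⌜⌝-injective))
  cmd-correct {d = d} (put a e f) {ρ} κ {σ} r
    with κ-f , κ₁ ← split (compileᵉ f (base d)) κ
    with κₑ , κ₂ ← split (compileᵉ e (suc (base d))) κ₁
    with κₐ , (f₁ ∷ []) ← split (address (code a) (suc (base d))) κ₂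
    with X₁ , run-f , val-f , ag-f ← exp-correct f κ-f ≤-refl r
    with X₂ , runₑ , valₑ , agₑ ← exp-correct e κₑ (n≤1+n _) (represents-agree ≤-refl ag-f r)
    with X₃ , runₐ , valₐ , agₐ ← address-correct (suc (base d)) κₐ valₑ
    = _ , run-f ◅◅ runₑ ◅◅ runₐ ◅◅ step f₁ done ,
      subst₂ (λ i v → Represents ρ _ (X₃ [ i ≔ v ])) (sym (trans valₐ (slot-code a _)))
        (sym (trans (agrees agₐ _ (below ≤-refl)) (trans (agrees agₑ _ (below ≤-refl)) val-f)))
        (represents-put a (⟦ e ⟧ᵉ ρ σ) (⟦ f ⟧ᵉ ρ σ)
          (represents-agree (n≤1+n _) (agree-trans agₑ agₐ) (represents-agree ≤-refl ag-f r)))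
  cmd-correct {d = d} (input a e) {ρ} κ {state V A is os} r
    with κₑ , κ₂ ← split (compileᵉ e (suc (base d))) κ
    with κₐ , (f₁ ∷ f₂ ∷ []) ← split (address (code a) (suc (base d))) κ₂
    with X₂ , runₑ , valₑ , agₑ ← exp-correct {is = is} {os} e κₑ (n≤1+n _) r
    with X₃ , runₐ , valₐ , agₐ ← address-correct {is = is} {os} (suc (base d)) κₐ valₑ
    with is | represents-agree (n≤1+n _) (agree-trans agₑ agₐ) r
  ... | []      | r′ = _ , runₑ ◅◅ runₐ ◅◅ step f₁ (step f₂ done) ,
    represents-input r′ 0 (trans valₐ (slot-code a (⟦ e ⟧ᵉ ρ (state V A [] os))))
  ... | x ∷ is′ | r′ = _ , runₑ ◅◅ runₐ ◅◅ step f₁ (step f₂ done) ,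
    represents-input r′ x (trans valₐ (slot-code a (⟦ e ⟧ᵉ ρ (state V A (x ∷ is′) os))))
  cmd-correct {d = d} (print e) κ {σ} r
    with κₑ , (f ∷ []) ← split (compileᵉ e (base d)) κ
    with Y , runₑ , valₑ , agₑ ← exp-correct e κₑ ≤-refl r
    = Y , runₑ ◅◅ step f (subst (λ v → P ⊢ _ ⟶[ 0 ] ⟨ _ , Y , _ , outs σ ++ (v ∷ []) ⟩) valₑ done) ,
      represents-io (represents-agree ≤-refl agₑ r)
  cmd-correct (c ； c′) {p = p} κ r
    with κ₁ , κ₂ ← split (compile c p) κ
    with Y , run , r₁ ← cmd-correct c κ₁ r
    with Z , run′ , r₂ ← cmd-correct c′ κ₂ r₁
    = Z , run ◅◅ run′ , r₂
  cmd-correct (ifpos e c c′) κ = choose-correct e c c′ κ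
  cmd-correct (for c) κ = for-correct c κ

-- Polynomial bounds on the running time

degree : ∀ {d} → Cmd d → ℕ
degree (c ； c′)       = degree c + degree c′
degree (ifpos _ c c′) = degree c + degree c′
degree (for c)        = suc (degree c)
degree _              = 0

-- The 12 for a loop collects 6 steps outside its iterations and 6 steps in each. Primitive commands
-- cost the same for every number of vertices, so 0 stands for that number. Degrees are added where
-- a maximum would do, which is harmless because powers of `s` grow with the exponent for positive
-- `s`.
factor : ∀ {d} → Cmd d → ℕ
factor (c ； c′)       = factor c + factor c′
factor (ifpos e c c′) = (costᵉ e + 3) + (factor c + factor c′)
factor (for c)        = 12 + factor c
factor c              = cost 0 c

module _ {n s : ℕ} (n≤s : n ≤ s) (1≤s : 1 ≤ s) where

  private instance
    s≢0 : NonZero s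
    s≢0 = >-nonZero 1≤s

  power≥1 : ∀ d → 1 ≤ s ^ d
  power≥1 d = m^n>0 s d

  constant≤ : ∀ k d → k ≤ k * s ^ d
  constant≤ k d = ≤-trans (≤-reflexive (sym (*-identityʳ k))) (*-monoʳ-≤ k (power≥1 d))

  raise : ∀ {x} k {d d′} → d ≤ d′ → x ≤ k * s ^ d → x ≤ k * s ^ d′
  raise k d≤d′ x≤ = ≤-trans x≤ (*-monoʳ-≤ k (^-monoʳ-≤ s d≤d′))

  sum≤ : ∀ {x y} k l d → x ≤ k * s ^ d → y ≤ l * s ^ d → x + y ≤ (k + l) * s ^ d
  sum≤ k l d x≤ y≤ = ≤-trans (+-mono-≤ x≤ y≤) (≤-reflexive (sym (*-distribʳ-+ (s ^ d) k l)))

  cost≤ : ∀ {d} (c : Cmd d) → cost n c ≤ factor c * s ^ degree c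

  both≤ : ∀ {d} (c c′ : Cmd d) →
    cost n c + cost n c′ ≤ (factor c + factor c′) * s ^ (degree c + degree c′)
  both≤ c c′ = sum≤ (factor c) (factor c′) (degree c + degree c′)
    (raise (factor c) (m≤m+n (degree c) (degree c′)) (cost≤ c)) (raise (factor c′) (m≤n+m (degree c′) (degree c)) (cost≤ c′))

  cost≤ skip           = z≤n
  cost≤ c@(_ := _)     = constant≤ (cost n c) 0
  cost≤ c@(put _ _ _)  = constant≤ (cost n c) 0
  cost≤ c@(input _ _)  = constant≤ (cost n c) 0
  cost≤ c@(print _)    = constant≤ (cost n c) 0
  cost≤ (c ； c′)       = both≤ c c′
  cost≤ (ifpos e c c′) = ≤-trans (≤-reflexive (rearrange (costᵉ e) (cost n c) (cost n c′)))
    (sum≤ (costᵉ e + 3) (factor c + factor c′) (degree c + degree c′)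
      (constant≤ (costᵉ e + 3) (degree c + degree c′)) (both≤ c c′))
    where
    rearrange : ∀ a b c → a + (1 + (b + (c + 2))) ≡ a + 3 + (b + c)
    rearrange = solve-∀
  cost≤ (for c) = begin
    2 + (n * (6 + cost n c) + 4)             ≡⟨ +-suc 1 _ ⟨
    1 + suc (n * (6 + cost n c) + 4)         ≡⟨ rearrange (n * (6 + cost n c)) ⟩
    6 + n * (6 + cost n c)                   ≤⟨ +-mono-≤ (constant≤ 6 (suc (degree c))) (*-mono-≤ n≤s
                                                  (sum≤ 6 (factor c) (degree c) (constant≤ 6 (degree c)) (cost≤ c))) ⟩
    6 * (s * p) + s * ((6 + factor c) * p)   ≡⟨ collect (factor c) s p ⟩
    (12 + factor c) * (s * p)                ∎
    where
    open ≤-Reasoning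
    p = s ^ degree c
    rearrange : ∀ x → 1 + suc (x + 4) ≡ 6 + x
    rearrange = solve-∀
    collect : ∀ f s p → 6 * (s * p) + s * ((6 + f) * p) ≡ (12 + f) * (s * p)
    collect = solve-∀

start : List ℕ → State
start is = state (λ _ → 0) (λ _ _ → 0) is []

-- The first input number is the order of the graph and goes to `tmp 0`, where loops expect it. This
-- instruction occupies position 0, so the command is compiled for position 1.
machine : Cmd 0 → Program
machine c = read ⌜ tmp 0 ⌝ ∷ compile c 1

machine-correct : ∀ (c : Cmd 0) n is {s} → n ≤ s → 1 ≤ s →
  ∃[ t ] machine c ⊢ initial (n ∷ is) ⇓[ t ] outs (⟦_⟧ {n} c [] (start is)) ×
         t ≤ suc (factor c) * s ^ degree c + suc (factor c)
machine-correct c n is {s} n≤s 1≤s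
  with f ∷ κ ← whole (machine c) []
  with Y , run , _ ← cmd-correct c {ρ = []} κ {start is} (repr (updated (λ _ → 0) ⌜ tmp 0 ⌝ n) (λ ()) (λ ())
         (λ x → unaffected (λ _ → 0) n ((λ ()) ∘ ⌜⌝-injective {scl x} {tmp 0}))
         (λ a i → unaffected (λ _ → 0) n ((λ ()) ∘ ⌜⌝-injective {at a i} {tmp 0})))
  with t , halts , t≤ ← terminates (step f run) (fetch-length (machine c))
  = t , halts , (begin
    t                                                 ≤⟨ t≤ ⟩
    1 + cost n c                                      ≤⟨ s≤s (cost≤ n≤s 1≤s c) ⟩
    1 + factor c * s ^ degree c                       ≤⟨ +-mono-≤ (s≤s (z≤n {factor c})) (*-monoˡ-≤ (s ^ degree c) (n≤1+n (factor c))) ⟩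
    suc (factor c) + suc (factor c) * s ^ degree c    ≡⟨ +-comm (suc (factor c)) _ ⟩
    suc (factor c) * s ^ degree c + suc (factor c)    ∎)
  where open ≤-Reasoning

-- Cardinalities of finite sets

∃¹ : ∀ {A : Set} → (A → Set) → Set
∃¹ P = ∃[ x ] P x × (∀ {y} → P y → y ≡ x)

-- Induction on `P`: when its first vertex belongs to it, the image of that vertex is removed from
-- `Q`, and injectivity keeps the other images inside what remains.
∣∣-injection : ∀ {m n} (P : Subset m) (Q : Subset n) (f : Fin m → Fin n) → (∀ {x} → x ∈ P → f x ∈ Q) →
  (∀ {x y} → x ∈ P → y ∈ P → f x ≡ f y → x ≡ y) → ∣ P ∣ ≤ ∣ Q ∣
∣∣-injection []            Q f into inj = z≤n
∣∣-injection (outside ∷ P) Q f into inj = ∣∣-injection P Q (f ∘ suc) (into ∘ there)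
  (λ x∈ y∈ eq → Fin.suc-injective (inj (there x∈) (there y∈) eq))
∣∣-injection (inside ∷ P)  Q f into inj = ≤-<-trans
  (∣∣-injection P (Q - f zero) (f ∘ suc)
    (λ x∈ → x∈p∧x≢y⇒x∈p-y (into (there x∈)) (λ eq → Fin.0≢1+n (sym (inj (there x∈) here eq))))
    (λ x∈ y∈ eq → Fin.suc-injective (inj (there x∈) (there y∈) eq)))
  (x∈p⇒∣p-x∣<∣p∣ (into here))

⊆⇒∣∣≤ : ∀ {n} (P Q : Subset n) → P ⊆ Q → ∣ P ∣ ≤ ∣ Q ∣
⊆⇒∣∣≤ P Q = p⊆q⇒∣p∣≤∣q∣

∣∪⁅⁆∣≤ : ∀ {n} (P : Subset n) x → ∣ P ∪ ⁅ x ⁆ ∣ ≤ suc ∣ P ∣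
∣∪⁅⁆∣≤ (outside ∷ P) zero    = s≤s (≤-reflexive (cong ∣_∣ (∪-identityʳ P)))
∣∪⁅⁆∣≤ (inside ∷ P)  zero    = s≤s (m≤n⇒m≤1+n (≤-reflexive (cong ∣_∣ (∪-identityʳ P))))
∣∪⁅⁆∣≤ (outside ∷ P) (suc x) = ∣∪⁅⁆∣≤ P x
∣∪⁅⁆∣≤ (inside ∷ P)  (suc x) = s≤s (∣∪⁅⁆∣≤ P x)

∣∣<∣∪⁅⁆∣ : ∀ {n} {P : Subset n} {x} → x ∉ P → ∣ P ∣ < ∣ P ∪ ⁅ x ⁆ ∣
∣∣<∣∪⁅⁆∣ {P = P} {x} x∉ = p⊂q⇒∣p∣<∣q∣ (p⊆p∪q ⁅ x ⁆ , x , q⊆p∪q P ⁅ x ⁆ (x∈⁅x⁆ x) , x∉)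

∣∣≤∣─⁅⁆∣ : ∀ {n} (P : Subset n) x → ∣ P ∣ ≤ suc ∣ P ─ ⁅ x ⁆ ∣
∣∣≤∣─⁅⁆∣ P x = ≤-trans (⊆⇒∣∣≤ P ((P ─ ⁅ x ⁆) ∪ ⁅ x ⁆) covered) (∣∪⁅⁆∣≤ (P ─ ⁅ x ⁆) x)
  where
  covered : P ⊆ (P ─ ⁅ x ⁆) ∪ ⁅ x ⁆
  covered {y} y∈ with y Fin.≟ x
  ... | yes refl = q⊆p∪q (P ─ ⁅ x ⁆) ⁅ x ⁆ (x∈⁅x⁆ x)
  ... | no y≢x   = p⊆p∪q ⁅ x ⁆ (x∈p∧x≢y⇒x∈p-y y∈ y≢x)

∈─⁅⁆⇒≢ : ∀ {n} (P : Subset n) {x y} → y ∈ P ─ ⁅ x ⁆ → y ≢ x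
∈─⁅⁆⇒≢ P {x} y∈ refl = x∉p-x′ P y∈
  where
  x∉p-x′ : ∀ {n} (P : Subset n) {x} → x ∉ P ─ ⁅ x ⁆
  x∉p-x′ (s ∷ P) {zero}  ()
  x∉p-x′ (s ∷ P) {suc x} (there x∈) = x∉p-x′ P x∈

∣empty∣ : ∀ {n} (P : Subset n) → Empty P → ∣ P ∣ ≡ 0
∣empty∣ {n} P empty = trans (cong ∣_∣ (Empty-unique empty)) (∣⊥∣≡0 n)

-- Robust values of stable sets

module Graphs (G : Graph) where
  open Graph G hiding (sym) renaming (order to n)

  Vertex : Set
  Vertex = Fin n

  _~_ : Vertex → Vertex → Set
  u ~ v = T (adj u v)

  ~-sym : ∀ {u v} → u ~ v → v ~ u
  ~-sym {u} {v} = subst T (Graph.sym G u v)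

  ~-irrefl : ∀ {v} → ¬ v ~ v
  ~-irrefl {v} = subst T (irrefl v)

  -- Recovery values

  Maximum : VertexSet → Set
  Maximum S = Stable G S × (∀ {S′} → Stable G S′ → ∣ S′ ∣ ≤ ∣ S ∣)

  subset-stable : ∀ S S′ → S′ ⊆ S → Stable G S → Stable G S′
  subset-stable S S′ S′⊆S st u v u∈ v∈ = st u v (S′⊆S u∈) (S′⊆S v∈)

  ∪⊥ : ∀ S f → recovered G S f nothing ⊆ S
  ∪⊥ S f x∈ with x∈p∪q⁻ (S ─ ⟪_⟫ G f) ⊥ x∈
  ... | inj₁ x∈S─f = p─q⊆p S (⟪_⟫ G f) x∈S─f
  ... | inj₂ x∈⊥   = ⊥-elim (∉⊥ x∈⊥)

  choice∈ : ∀ e → e ∈ˡ choices G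
  choice∈ nothing  = Any.here refl
  choice∈ (just v) = Any.there (∈-map⁺ just (∈-allFin v))

  nothing-admissible : ∀ S f → Stable G S → Admissible G S f nothing
  nothing-admissible S f st = (λ x∈ → ⊥-elim (∉⊥ x∈)) , subset-stable S (recovered G S f nothing) (∪⊥ S f) st

  recovered≤ : ∀ S f e → Admissible G S f e → ∣ recovered G S f e ∣ ≤ recoveryValue G S f
  recovered≤ S f e ad = v≤max⁺ 0 _ (inj₂ (Any.map ≤-reflexive
    (∈-map⁺ (λ e → ∣ recovered G S f e ∣) (∈-filter⁺ (admissible? G S f) (choice∈ e) ad))))

  recoveryValue≤ : ∀ S f {b} → (∀ e → Admissible G S f e → ∣ recovered G S f e ∣ ≤ b) → recoveryValue G S f ≤ b
  recoveryValue≤ S f {b} h = max≤v⁺ z≤n (All.tabulate bound)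
    where
    bound : ∀ {x} → x ∈ˡ map (λ e → ∣ recovered G S f e ∣) (filter (admissible? G S f) (choices G)) → x ≤ b
    bound x∈ with e , e∈ , refl ← ∈-map⁻ (λ e → ∣ recovered G S f e ∣) x∈ =
      h e (proj₂ (∈-filter⁻ (admissible? G S f) {xs = choices G} e∈))

  -- Positivity of `b` rules out that the maximum is merely the default 0, which need not come from
  -- a choice.
  recovery-attained : ∀ S f {b} → 0 < b → b ≤ recoveryValue G S f →
    ∃[ e ] Admissible G S f e × b ≤ ∣ recovered G S f e ∣
  recovery-attained S f 0<b b≤
    with argmax-sel id 0 (map (λ e → ∣ recovered G S f e ∣) (filter (admissible? G S f) (choices G)))
  ... | inj₁ eq = ⊥-elim (<⇒≱ 0<b (≤-trans b≤ (≤-reflexive eq)))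
  ... | inj₂ ∈ with e , e∈ , eq ← ∈-map⁻ (λ e → ∣ recovered G S f e ∣) ∈ =
    e , proj₂ (∈-filter⁻ (admissible? G S f) {xs = choices G} e∈) , ≤-trans b≤ (≤-reflexive eq)

  robustValue≤ : ∀ S f → robustValue G S ≤ recoveryValue G S f
  robustValue≤ S f = min≤v⁺ (recoveryValue G S nothing) _ (inj₂ (Any.map (≤-reflexive ∘ sym)
    (∈-map⁺ (recoveryValue G S) (choice∈ f))))

  ≤robustValue : ∀ {S b} → (∀ f → b ≤ recoveryValue G S f) → b ≤ robustValue G S
  ≤robustValue {S} {b} h = v≤min⁺ (h nothing) (All.tabulate bound)
    where
    bound : ∀ {x} → x ∈ˡ map (recoveryValue G S) (choices G) → b ≤ x
    bound x∈ with f , _ , eq ← ∈-map⁻ (recoveryValue G S) {xs = choices G} x∈ = subst (b ≤_) (sym eq) (h f)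

  -- Already the deletion of nothing caps the value, since an admissible recovery is a stable set.
  robustValue≤maximum : ∀ {S} → Maximum S → ∀ S′ → robustValue G S′ ≤ ∣ S ∣
  robustValue≤maximum (_ , largest) S′ =
    ≤-trans (robustValue≤ S′ nothing) (recoveryValue≤ S′ nothing (λ e ad → largest {recovered G S′ nothing e} (proj₂ ad)))

  ∣∣≤recovered : ∀ S f → ∣ S ∣ ≤ suc ∣ recovered G S f nothing ∣
  ∣∣≤recovered S nothing  = m≤n⇒m≤1+n (⊆⇒∣∣≤ S (recovered G S nothing nothing) (λ x∈ → p⊆p∪q ⊥ (x∈p∧x∉q⇒x∈p─q x∈ ∉⊥)))
  ∣∣≤recovered S (just f) = ≤-trans (∣∣≤∣─⁅⁆∣ S f) (s≤s (∣p∣≤∣p∪q∣ (S ─ ⁅ f ⁆) ⊥))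

  -- After a deletion, adding nothing is admissible and costs at most the deleted vertex.
  ∸1≤robustValue : ∀ {S} → Stable G S → ∣ S ∣ ∸ 1 ≤ robustValue G S
  ∸1≤robustValue {S} st = ≤robustValue λ f →
    ≤-trans (∸-monoˡ-≤ 1 (∣∣≤recovered S f)) (recovered≤ S f nothing (nothing-admissible S f st))

  -- Maximum stable sets

  -- A matching of the complement of `S` into `S`. This is the certificate behind König's theorem
  -- and needs no reference to augmenting paths.
  record Saturating (S : VertexSet) : Set where
    field
      mate      : Vertex → Vertex
      mate∈     : ∀ {v} → v ∉ S → mate v ∈ S
      mate~     : ∀ {v} → v ∉ S → v ~ mate v
      injective : ∀ {v w} → v ∉ S → w ∉ S → mate v ≡ mate w → v ≡ w

  module _ {S : VertexSet} (sat : Saturating S) where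
    open Saturating sat

    -- Vertices of `S′` in `S` are kept and the others are sent to their mates. A collision between
    -- the two kinds would be an edge within `S′`.
    saturating⇒largest : ∀ {S′} → Stable G S′ → ∣ S′ ∣ ≤ ∣ S ∣
    saturating⇒largest {S′} st = ∣∣-injection S′ S into into∈ into-injective
      where
      into : Vertex → Vertex
      into v with v ∈? S
      ... | yes _ = v
      ... | no _  = mate v
      into∈ : ∀ {v} → v ∈ S′ → into v ∈ S
      into∈ {v} _ with v ∈? S
      ... | yes v∈ = v∈
      ... | no v∉  = mate∈ v∉
      into-injective : ∀ {v w} → v ∈ S′ → w ∈ S′ → into v ≡ into w → v ≡ w
      into-injective {v} {w} v∈ w∈ eq with v ∈? S | w ∈? S
      ... | yes _ | yes _ = eq
      ... | yes _ | no w∉ = ⊥-elim (st w v w∈ v∈ (subst (w ~_) (sym eq) (mate~ w∉)))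
      ... | no v∉ | yes _ = ⊥-elim (st v w v∈ w∈ (subst (v ~_) eq (mate~ v∉)))
      ... | no v∉ | no w∉ = injective v∉ w∉ eq

    saturating⇒half : ∣ ∁ S ∣ ≤ ∣ S ∣
    saturating⇒half = ∣∣-injection (∁ S) S mate (mate∈ ∘ x∈∁p⇒x∉p)
      (λ v∈ w∈ → injective (x∈∁p⇒x∉p v∈) (x∈∁p⇒x∉p w∈))

  -- Two-coloured graphs

  Leaf : Vertex → Set
  Leaf v = ∃¹ (v ~_)

  record Colouring (col : Vertex → ℕ) : Set where
    field
      values : ∀ v → col v ≡ 1 ⊎ col v ≡ 2
      proper : ∀ {u v} → u ~ v → col u ≢ col v

  module Coloured {col : Vertex → ℕ} (colouring : Colouring col) where
    open Colouring colouring

    colour-of-neighbour : ∀ {u v} → u ~ v → col u ≢ 1 → col v ≡ 1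
    colour-of-neighbour {u} {v} u~v u≢1 with values u | values v
    ... | inj₁ u≡1 | _        = ⊥-elim (u≢1 u≡1)
    ... | inj₂ _   | inj₁ v≡1 = v≡1
    ... | inj₂ u≡2 | inj₂ v≡2 = ⊥-elim (proper u~v (trans u≡2 (sym v≡2)))

    -- The leaves, except that of two adjacent ones only the one of colour 1 is kept.
    Pendant : Vertex → Set
    Pendant v = Leaf v × (∀ w → v ~ w → Leaf w → col v ≡ 1)

    -- If the pendant vertices dominate uniquely, then G arises by attaching a leaf to each vertex of another graph.
    module _ {R : VertexSet} (R⇒ : ∀ {v} → v ∈ R → Pendant v) (⇒R : ∀ {v} → Pendant v → v ∈ R) where

      Corona : Set
      Corona = ∀ v → v ∉ R → ∃¹ (λ w → v ~ w × w ∈ R)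

      -- Two adjacent pendant vertices would both be leaves, and the tie-break would give both of
      -- them colour 1.
      pendant-stable : Stable G R
      pendant-stable u v u∈ v∈ u~v with leaf-u , u-one ← R⇒ u∈ | leaf-v , v-one ← R⇒ v∈ =
        proper u~v (trans (u-one v u~v leaf-v) (sym (v-one u (~-sym u~v) leaf-u)))

      module _ (corona : Corona) where

        -- Mates are distinct because a pendant vertex, being a leaf, has a single neighbour.
        pendant-saturating : Saturating R
        pendant-saturating = record
          { mate = mate ; mate∈ = mate∈ ; mate~ = mate~
          ; injective = λ {v} {w} v∉ w∉ eq → let _ , _ , unique = proj₁ (R⇒ (mate∈ v∉)) in
              trans (unique (~-sym (mate~ v∉)))
                    (sym (unique (~-sym (subst (w ~_) (sym eq) (mate~ w∉)))))
          }
          where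
          mate : Vertex → Vertex
          mate v with v ∈? R
          ... | yes _ = v
          ... | no v∉ = proj₁ (corona v v∉)
          mate∈ : ∀ {v} → v ∉ R → mate v ∈ R
          mate∈ {v} v∉ with v ∈? R
          ... | yes v∈ = v∈
          ... | no v∉′ = proj₂ (proj₁ (proj₂ (corona v v∉′)))
          mate~ : ∀ {v} → v ∉ R → v ~ mate v
          mate~ {v} v∉ with v ∈? R
          ... | yes v∈ = ⊥-elim (v∉ v∈)
          ... | no v∉′ = proj₁ (proj₁ (proj₂ (corona v v∉′)))

        pendant-maximum : Maximum R
        pendant-maximum = pendant-stable , saturating⇒largest pendant-saturating

        -- A deleted vertex f is replaced by its only neighbour.
        pendant-recovery : ∀ f → ∣ R ∣ ≤ recoveryValue G R f
        pendant-recovery nothing = ≤-trans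
          (⊆⇒∣∣≤ R (recovered G R nothing nothing) (λ x∈ → p⊆p∪q ⊥ (x∈p∧x∉q⇒x∈p─q x∈ ∉⊥)))
          (recovered≤ R nothing nothing (nothing-admissible R nothing pendant-stable))
        pendant-recovery (just f) with f ∈? R
        ... | no f∉ = ≤-trans
          (⊆⇒∣∣≤ R (recovered G R (just f) nothing) (λ x∈ → p⊆p∪q ⊥ (x∈p∧x≢y⇒x∈p-y x∈ (λ { refl → f∉ x∈ }))))
          (recovered≤ R (just f) nothing (nothing-admissible R (just f) pendant-stable))
        ... | yes f∈ with e , f~e , _ ← proj₁ (R⇒ f∈) = ≤-trans
          (≤-trans (∣∣≤∣─⁅⁆∣ R f) (∣∣<∣∪⁅⁆∣ (λ e∈ → e∉ (p─q⊆p R ⁅ f ⁆ e∈))))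
          (recovered≤ R (just f) (just e) (fresh , stable))
          where
          e∉ : e ∉ R
          e∉ e∈ = pendant-stable f e f∈ e∈ f~e
          fresh : ⁅ e ⁆ ⊆ ∁ (R ∪ ⁅ f ⁆)
          fresh x∈ with refl ← x∈⁅y⁆⇒x≡y e x∈ = x∉p⇒x∈∁p λ e∈ → outside-of e∈
            where
            outside-of : e ∉ R ∪ ⁅ f ⁆
            outside-of e∈ with x∈p∪q⁻ R ⁅ f ⁆ e∈
            ... | inj₁ e∈R = e∉ e∈R
            ... | inj₂ e∈f with refl ← x∈⁅y⁆⇒x≡y f e∈f = ~-irrefl f~e
          private-neighbour : ∀ {x} → x ∈ R ─ ⁅ f ⁆ → ¬ e ~ x
          private-neighbour {x} x∈ e~x with _ , _ , unique ← corona e e∉ =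
            ∈─⁅⁆⇒≢ R x∈ (trans (unique (e~x , p─q⊆p R ⁅ f ⁆ x∈)) (sym (unique (~-sym f~e , f∈))))
          stable : Stable G ((R ─ ⁅ f ⁆) ∪ ⁅ e ⁆)
          stable u v u∈ v∈ u~v with x∈p∪q⁻ (R ─ ⁅ f ⁆) ⁅ e ⁆ u∈ | x∈p∪q⁻ (R ─ ⁅ f ⁆) ⁅ e ⁆ v∈
          ... | inj₁ u∈R | inj₁ v∈R = pendant-stable u v (p─q⊆p R ⁅ f ⁆ u∈R) (p─q⊆p R ⁅ f ⁆ v∈R) u~v
          ... | inj₁ u∈R | inj₂ v∈e with refl ← x∈⁅y⁆⇒x≡y e v∈e = private-neighbour u∈R (~-sym u~v)
          ... | inj₂ u∈e | inj₁ v∈R with refl ← x∈⁅y⁆⇒x≡y e u∈e = private-neighbour v∈R u~v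
          ... | inj₂ u∈e | inj₂ v∈e with refl ← x∈⁅y⁆⇒x≡y e u∈e | refl ← x∈⁅y⁆⇒x≡y e v∈e = ~-irrefl u~v

        corona-robustValue : robustValue G R ≡ ∣ R ∣
        corona-robustValue = ≤-antisym (robustValue≤maximum pendant-maximum R) (≤robustValue pendant-recovery)

        corona-optimal : Optimal G R
        corona-optimal = pendant-stable , λ S′ _ →
          ≤-trans (robustValue≤maximum pendant-maximum S′) (≤-reflexive (sym corona-robustValue))

      Exchangeable : VertexSet → Set
      Exchangeable S = ∀ {f} → f ∈ S → ∃[ e ] e ∉ S × Stable G ((S ─ ⁅ f ⁆) ∪ ⁅ e ⁆)

      -- The exchange partners inject S into its complement, which is no larger than S; hence all
      -- vertices outside S are exchange partners and all vertices in S are leaves.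
      module _ {S : VertexSet} (maximum : Maximum S) (half : ∣ ∁ S ∣ ≤ ∣ S ∣) (exchange : Exchangeable S) where

        private
          stable  = proj₁ maximum
          largest = proj₂ maximum

        -- Stability after the exchange leaves `f` as the only possible neighbour of `e` in `S`.
        -- Were it no neighbour either, `e` could be added to `S`, against maximality.
        partner-spec : ∀ {f} → f ∈ S → ∃[ e ] e ∉ S × e ~ f × (∀ {g} → g ∈ S → e ~ g → g ≡ f)
        partner-spec {f} f∈ with e , e∉ , st ← exchange f∈ = e , e∉ , e~f , unique
          where
          unique : ∀ {g} → g ∈ S → e ~ g → g ≡ f
          unique {g} g∈ e~g with g Fin.≟ f
          ... | yes g≡f = g≡f
          ... | no g≢f  = ⊥-elim (st e g (q⊆p∪q (S ─ ⁅ f ⁆) ⁅ e ⁆ (x∈⁅x⁆ e)) (p⊆p∪q ⁅ e ⁆ (x∈p∧x≢y⇒x∈p-y g∈ g≢f)) e~g)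
          e~f : e ~ f
          e~f with adj e f in eq
          ... | true  = _
          ... | false = <⇒≱ (∣∣<∣∪⁅⁆∣ e∉) (largest extended)
            where
            none : ∀ {g} → g ∈ S → ¬ e ~ g
            none g∈ e~g with refl ← unique g∈ e~g = subst T eq e~g
            extended : Stable G (S ∪ ⁅ e ⁆)
            extended u v u∈ v∈ u~v with x∈p∪q⁻ S ⁅ e ⁆ u∈ | x∈p∪q⁻ S ⁅ e ⁆ v∈
            ... | inj₁ u∈S | inj₁ v∈S = stable u v u∈S v∈S u~v
            ... | inj₁ u∈S | inj₂ v∈e with refl ← x∈⁅y⁆⇒x≡y e v∈e = none u∈S (~-sym u~v)
            ... | inj₂ u∈e | inj₁ v∈S with refl ← x∈⁅y⁆⇒x≡y e u∈e = none v∈S u~v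
            ... | inj₂ u∈e | inj₂ v∈e with refl ← x∈⁅y⁆⇒x≡y e u∈e | refl ← x∈⁅y⁆⇒x≡y e v∈e = ~-irrefl u~v

        private
          φ : Vertex → Vertex
          φ f with f ∈? S
          ... | yes f∈ = proj₁ (partner-spec f∈)
          ... | no _   = f
          φ∉ : ∀ {f} → f ∈ S → φ f ∉ S
          φ∉ {f} f∈ with f ∈? S
          ... | yes f∈′ = proj₁ (proj₂ (partner-spec f∈′))
          ... | no f∉   = ⊥-elim (f∉ f∈)
          φ~ : ∀ {f} → f ∈ S → φ f ~ f
          φ~ {f} f∈ with f ∈? S
          ... | yes f∈′ = proj₁ (proj₂ (proj₂ (partner-spec f∈′)))
          ... | no f∉   = ⊥-elim (f∉ f∈)
          φ-private : ∀ {f g} → f ∈ S → g ∈ S → φ f ~ g → g ≡ f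
          φ-private {f} f∈ with f ∈? S
          ... | yes f∈′ = proj₂ (proj₂ (proj₂ (partner-spec f∈′)))
          ... | no f∉   = ⊥-elim (f∉ f∈)

          φ-injective : ∀ {f g} → f ∈ S → g ∈ S → φ f ≡ φ g → f ≡ g
          φ-injective f∈ g∈ eq = φ-private g∈ f∈ (subst (_~ _) eq (φ~ f∈))

          -- If `e` were missed, `φ` would inject `S` into the complement without `e`, which by
          -- `half` has fewer vertices than `S`.
          φ-surjective : ∀ {e} → e ∉ S → ∃[ f ] f ∈ S × e ≡ φ f
          φ-surjective {e} e∉ with Fin.any? (λ f → f ∈? S ×-dec (e Fin.≟ φ f))
          ... | yes found = found
          ... | no none = ⊥-elim (<⇒≱ (≤-<-trans
            (∣∣-injection S (∁ S - e) φ (λ f∈ → x∈p∧x≢y⇒x∈p-y (x∉p⇒x∈∁p (φ∉ f∈)) (λ eq → none (_ , f∈ , sym eq))) φ-injective)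
            (x∈p⇒∣p-x∣<∣p∣ (x∉p⇒x∈∁p e∉))) half)

          -- By stability `e` lies outside `S`, so it is the partner of some `g` in `S`. Its only
          -- neighbour in `S` is then `g`, so that `g` is `f`.
          neighbour : ∀ {f e} → f ∈ S → f ~ e → e ≡ φ f
          neighbour {f} {e} f∈ f~e with φ-surjective {e} (λ e∈ → stable f e f∈ e∈ f~e)
          ... | g , g∈ , refl with refl ← φ-private g∈ f∈ (~-sym f~e) = refl

          S⇒leaf : ∀ {f} → f ∈ S → Leaf f
          S⇒leaf {f} f∈ = φ f , ~-sym (φ~ f∈) , neighbour f∈

          -- Of f and its partner exactly one is pendant.
          φ∈R : ∀ {f} → f ∈ S → f ∉ R → φ f ∈ R
          φ∈R {f} f∈ f∉ with φ f ∈? R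
          ... | yes e∈ = e∈
          ... | no e∉ = ⊥-elim (f∉ (⇒R (S⇒leaf f∈ , λ w f~w leaf-w → one w f~w leaf-w)))
            where
            one : ∀ w → f ~ w → Leaf w → col f ≡ 1
            one w f~w leaf-w with col f ≟ 1
            ... | yes f≡1 = f≡1
            ... | no f≢1 with refl ← neighbour f∈ f~w =
              ⊥-elim (e∉ (⇒R (leaf-w , λ _ _ _ → colour-of-neighbour f~w f≢1)))

          φ∉⇒∈R : ∀ {f} → f ∈ S → φ f ∉ R → f ∈ R
          φ∉⇒∈R {f} f∈ e∉ with f ∈? R
          ... | yes f∈R = f∈R
          ... | no f∉R  = ⊥-elim (e∉ (φ∈R f∈ f∉R))

        -- Each vertex of `S` and its partner form a pair containing a pendant vertex, which
        -- dominates the other one. A second pendant neighbour of `φ f` would be a leaf outside `S`,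
        -- hence a partner `φ g` with `g` as its only neighbour; then `φ f` would be `g` and lie in
        -- `S`.
        exchangeable⇒corona : Corona
        exchangeable⇒corona v v∉ with v ∈? S
        ... | yes v∈ = φ v , (~-sym (φ~ v∈) , φ∈R v∈ v∉) , λ (v~w , _) → neighbour v∈ v~w
        ... | no v∉S with f , f∈ , refl ← φ-surjective v∉S = f , (φ~ f∈ , φ∉⇒∈R f∈ v∉) , unique
          where
          unique : ∀ {w} → φ f ~ w × w ∈ R → w ≡ f
          unique {w} (e~w , w∈R) with w ∈? S
          ... | yes w∈ = φ-private f∈ w∈ e~w
          ... | no w∉ with g , g∈ , refl ← φ-surjective w∉
                      with (x , _ , only) , _ ← R⇒ w∈R =
            ⊥-elim (v∉S (subst (_∈ S) (trans (only (φ~ g∈)) (sym (only (~-sym e~w)))) g∈))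

      module _ {S : VertexSet} (stable : Stable G S) (saturating : Saturating S) where

        private
          largest : ∀ {S′} → Stable G S′ → ∣ S′ ∣ ≤ ∣ S ∣
          largest = saturating⇒largest saturating

        -- Only `S` carries a certificate. A stable set at least as large inherits from it
        -- maximality and the bound on the complement.
        exchangeable⇒corona′ : ∀ {S′} → Stable G S′ → ∣ S ∣ ≤ ∣ S′ ∣ → Exchangeable S′ → Corona
        exchangeable⇒corona′ {S′} st S≤S′ = exchangeable⇒corona (st , λ st″ → ≤-trans (largest st″) S≤S′) (begin
          ∣ ∁ S′ ∣     ≡⟨ ∣∁p∣≡n∸∣p∣ S′ ⟩
          n ∸ ∣ S′ ∣   ≤⟨ ∸-monoʳ-≤ n S≤S′ ⟩
          n ∸ ∣ S ∣    ≡⟨ ∣∁p∣≡n∸∣p∣ S ⟨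
          ∣ ∁ S ∣      ≤⟨ saturating⇒half saturating ⟩
          ∣ S ∣        ≤⟨ S≤S′ ⟩
          ∣ S′ ∣       ∎)
          where open ≤-Reasoning

        singleton-stable : ∀ v → Stable G ⁅ v ⁆
        singleton-stable v x y x∈ y∈ x~y with refl ← x∈⁅y⁆⇒x≡y v x∈ | refl ← x∈⁅y⁆⇒x≡y v y∈ = ~-irrefl x~y

        nonempty : Vertex → 0 < ∣ S ∣
        nonempty v = ≤-trans (≤-reflexive (sym (∣⁅x⁆∣≡1 v))) (largest (singleton-stable v))

        Replacement : VertexSet → Vertex → Set
        Replacement S′ f = ∃[ e ] Admissible G S′ (just f) e × ∣ S ∣ ≤ ∣ recovered G S′ (just f) e ∣

        replacement : ∀ S′ → ∣ S ∣ ≤ robustValue G S′ → ∀ f → Replacement S′ f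
        replacement S′ S≤ f = recovery-attained S′ (just f) (nonempty f) (≤-trans S≤ (robustValue≤ S′ (just f)))

        replaceable⇒large : ∀ {S′ f} → f ∈ S′ → Replacement S′ f → ∣ S ∣ ≤ ∣ S′ ∣
        replaceable⇒large {S′} {f} f∈ (nothing , _ , le) =
          ≤-trans le (⊆⇒∣∣≤ (recovered G S′ (just f) nothing) S′ (∪⊥ S′ (just f)))
        replaceable⇒large {S′} {f} f∈ (just e , _ , le) =
          ≤-trans le (≤-trans (∣∪⁅⁆∣≤ (S′ ─ ⁅ f ⁆) e) (x∈p⇒∣p-x∣<∣p∣ f∈))

        -- A recovery that adds nothing after deleting `f` is smaller than `S′`, hence than a
        -- largest stable set; so it has to add a vertex.
        replaceable⇒exchangeable : ∀ {S′} → Stable G S′ → (∀ f → Replacement S′ f) → Exchangeable S′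
        replaceable⇒exchangeable {S′} st repl {f} f∈ = from (repl f)
          where
          open ≤-Reasoning
          drop⊥ : recovered G S′ (just f) nothing ⊆ S′ ─ ⁅ f ⁆
          drop⊥ x∈ with x∈p∪q⁻ (S′ ─ ⁅ f ⁆) ⊥ x∈
          ... | inj₁ x∈′ = x∈′
          ... | inj₂ x∈⊥ = ⊥-elim (∉⊥ x∈⊥)
          from : Replacement S′ f → ∃[ e ] e ∉ S′ × Stable G ((S′ ─ ⁅ f ⁆) ∪ ⁅ e ⁆)
          from (just e , (fresh , st′) , _) = e , (λ e∈ → x∈∁p⇒x∉p (fresh (x∈⁅x⁆ e)) (p⊆p∪q ⁅ f ⁆ e∈)) , st′
          from (nothing , _ , le) = ⊥-elim (<⇒≱ (x∈p⇒∣p-x∣<∣p∣ f∈) (begin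
            ∣ S′ ∣                              ≤⟨ largest st ⟩
            ∣ S ∣                               ≤⟨ le ⟩
            ∣ recovered G S′ (just f) nothing ∣ ≤⟨ ⊆⇒∣∣≤ (recovered G S′ (just f) nothing) (S′ ─ ⁅ f ⁆) drop⊥ ⟩
            ∣ S′ ─ ⁅ f ⁆ ∣                      ∎))

        -- The empty set can have robust value 1, but then every singleton has it, too.
        empty⇒exchangeable : ∀ {S′ v} → Empty S′ → Replacement S′ v → ∣ S ∣ ≤ ∣ ⁅ v ⁆ ∣ × Exchangeable ⁅ v ⁆
        empty⇒exchangeable {S′} {v} empty (nothing , _ , le) = ⊥-elim (<⇒≱ (nonempty v) (begin
          ∣ S ∣                               ≤⟨ le ⟩
          ∣ recovered G S′ (just v) nothing ∣ ≤⟨ ⊆⇒∣∣≤ (recovered G S′ (just v) nothing) S′ (∪⊥ S′ (just v)) ⟩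
          ∣ S′ ∣                              ≡⟨ ∣empty∣ S′ empty ⟩
          0                                   ∎))
          where open ≤-Reasoning
        empty⇒exchangeable {S′} {v} empty (just e , (fresh , _) , le) = S≤1 , λ {g} g∈ →
          subst (λ g → ∃[ e ] e ∉ ⁅ v ⁆ × Stable G ((⁅ v ⁆ ─ ⁅ g ⁆) ∪ ⁅ e ⁆)) (sym (x∈⁅y⁆⇒x≡y v g∈))
            (e , (λ e∈ → x∈∁p⇒x∉p (fresh (x∈⁅x⁆ e)) (q⊆p∪q S′ ⁅ v ⁆ e∈)) ,
             subset-stable ⁅ e ⁆ ((⁅ v ⁆ ─ ⁅ v ⁆) ∪ ⁅ e ⁆) only-e (singleton-stable e))
          where
          S≤1 : ∣ S ∣ ≤ ∣ ⁅ v ⁆ ∣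
          S≤1 = begin
            ∣ S ∣                        ≤⟨ le ⟩
            ∣ (S′ ─ ⁅ v ⁆) ∪ ⁅ e ⁆ ∣     ≤⟨ ∣∪⁅⁆∣≤ (S′ ─ ⁅ v ⁆) e ⟩
            suc ∣ S′ ─ ⁅ v ⁆ ∣           ≤⟨ s≤s (∣p─q∣≤∣p∣ S′ ⁅ v ⁆) ⟩
            suc ∣ S′ ∣                   ≡⟨ cong suc (∣empty∣ S′ empty) ⟩
            1                            ≡⟨ ∣⁅x⁆∣≡1 v ⟨
            ∣ ⁅ v ⁆ ∣                    ∎
            where open ≤-Reasoning
          only-e : (⁅ v ⁆ ─ ⁅ v ⁆) ∪ ⁅ e ⁆ ⊆ ⁅ e ⁆
          only-e x∈ with x∈p∪q⁻ (⁅ v ⁆ ─ ⁅ v ⁆) ⁅ e ⁆ x∈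
          ... | inj₁ x∈v = ⊥-elim (∈─⁅⁆⇒≢ ⁅ v ⁆ x∈v (x∈⁅y⁆⇒x≡y v (p─q⊆p ⁅ v ⁆ ⁅ v ⁆ x∈v)))
          ... | inj₂ x∈e = x∈e

        replaceable⇒corona : ∀ {S′} → Stable G S′ → (∀ f → Replacement S′ f) → Corona
        replaceable⇒corona {S′} st repl v v∉ with nonempty? S′
        ... | yes (f , f∈) =
          exchangeable⇒corona′ st (replaceable⇒large f∈ (repl f)) (replaceable⇒exchangeable st repl) v v∉
        ... | no empty with S≤1 , exchange ← empty⇒exchangeable empty (repl v) =
          exchangeable⇒corona′ (singleton-stable v) S≤1 exchange v v∉

        robust⇒corona : ∀ {S′} → Stable G S′ → ∣ S ∣ ≤ robustValue G S′ → Corona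
        robust⇒corona {S′} st S≤ = replaceable⇒corona st (replacement S′ S≤)

        module _ (¬corona : ¬ Corona) where

          robustValue≤∸1 : ∀ {S′} → Stable G S′ → robustValue G S′ ≤ ∣ S ∣ ∸ 1
          robustValue≤∸1 {S′} st = ∸-monoˡ-≤ 1 (≰⇒> {∣ S ∣} {robustValue G S′} (¬corona ∘ robust⇒corona st))

          maximum-robustValue : robustValue G S ≡ ∣ S ∣ ∸ 1
          maximum-robustValue = ≤-antisym (robustValue≤∸1 stable) (∸1≤robustValue stable)

          maximum-optimal : Optimal G S
          maximum-optimal = stable , λ S′ st → ≤-trans (robustValue≤∸1 st) (≤-reflexive (sym maximum-robustValue))

-- Truth values

Truth : ℕ → Set → Set
Truth x P = (x ≢ 0 → P) × (P → x ≢ 0)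

-- Conditions may be any number, but stored results are printed as bits and summed up, so they have
-- to be 0 or 1. A flag also decides `P`.
Flag : ℕ → Set → Set
Flag x P = (x ≡ 1 × P) ⊎ (x ≡ 0 × ¬ P)

truth-map : ∀ {x P Q} → (P → Q) → (Q → P) → Truth x P → Truth x Q
truth-map f g (t , u) = f ∘ t , u ∘ g

flag⇒truth : ∀ {x P} → Flag x P → Truth x P
flag⇒truth (inj₁ (refl , p))  = (λ _ → p) , (λ _ ())
flag⇒truth (inj₂ (refl , ¬p)) = (λ x≢0 → ⊥-elim (x≢0 refl)) , λ p → ⊥-elim (¬p p)

truth-self : ∀ x → Truth x (x ≢ 0)
truth-self x = (λ p → p) , (λ p → p)

truth-zero : ∀ x → Truth (1 ∸ x) (x ≡ 0)
truth-zero zero    = (λ _ → refl) , (λ _ ())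
truth-zero (suc x) = (λ h → ⊥-elim (h (0∸n≡0 x))) , λ ()

truth-not : ∀ {x P} → Truth x P → Truth (1 ∸ x) (¬ P)
truth-not {zero}  (_ , u) = (λ _ p → u p refl) , (λ _ ())
truth-not {suc x} (t , _) = (λ h → ⊥-elim (h (0∸n≡0 x))) , λ ¬p → ⊥-elim (¬p (t λ ()))

truth-< : ∀ x y → Truth (y ∸ x) (x < y)
truth-< x y = (λ h → ≰⇒> λ y≤x → h (m≤n⇒m∸n≡0 y≤x)) , λ x<y h → <⇒≱ x<y (m∸n≡0⇒m≤n h)

truth-or : ∀ {x y P Q} → Truth x P → Truth y Q → Truth (x + y) (P ⊎ Q)
truth-or {zero}  (_ , u) (t′ , u′) = inj₂ ∘ t′ , λ { (inj₁ p) → ⊥-elim (u p refl) ; (inj₂ q) → u′ q }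
truth-or {suc x} (t , _) _         = (λ _ → inj₁ (t λ ())) , λ _ ()

-- De Morgan's law replaces the product of the two numbers: subtraction from 1 negates, and addition
-- is disjunction.
truth-and : ∀ {x y P Q} → Truth x P → Truth y Q → Truth (1 ∸ ((1 ∸ x) + (1 ∸ y))) (P × Q)
truth-and {zero}  {y}     (_ , u) _ = (λ h → ⊥-elim (h (0∸n≡0 (1 ∸ y)))) , λ (p , _) → ⊥-elim (u p refl)
truth-and {suc x} {zero}  _ (_ , u) = (λ h → ⊥-elim (h (cong (λ z → 1 ∸ (z + 1)) (0∸n≡0 x)))) , λ (_ , q) → ⊥-elim (u q refl)
truth-and {suc x} {suc y} (t , _) (t′ , _) =
  (λ _ → t (λ ()) , t′ (λ ())) , λ _ h → 0≢1+n (trans (sym h) (cong₂ (λ a b → 1 ∸ (a + b)) (0∸n≡0 x) (0∸n≡0 y)))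

truth-≢ : ∀ x y → Truth ((x ∸ y) + (y ∸ x)) (x ≢ y)
truth-≢ x y = (λ { h refl → h (cong₂ _+_ (n∸n≡0 x) (n∸n≡0 x)) }) ,
  λ x≢y h → x≢y (≤-antisym (m∸n≡0⇒m≤n (m+n≡0⇒m≡0 _ h)) (m∸n≡0⇒m≤n (m+n≡0⇒n≡0 (x ∸ y) h)))

infixr 5 _⊗_

_⊗_ : ∀ {d} → Exp d → Exp d → Exp d
e ⊗ f = lit 1 ⊖ ((lit 1 ⊖ e) ⊕ (lit 1 ⊖ f))

-- One of the two truncated differences is always 0, so their sum is the absolute difference, which
-- is positive for different numbers.
distance : ∀ {d} → Exp d → Exp d → Exp d
distance e f = (e ⊖ f) ⊕ (f ⊖ e)

-- Rules for commands

choose-elim : (Φ : State → Set) → ∀ x {σ τ} → (x ≢ 0 → Φ σ) → (x ≡ 0 → Φ τ) → Φ (choose x σ τ)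
choose-elim Φ zero    _ f = f refl
choose-elim Φ (suc _) t _ = t λ ()

-- A Boolean test, so that for a concrete command the premise of `frame` holds by computation and is
-- proved by `tt`.
untouched : ∀ {d} → Array → Cmd d → Bool
untouched a (put b _ _)    = not (code b ≡ᵇ code a)
untouched a (input b _)    = not (code b ≡ᵇ code a)
untouched a (c ； c′)       = untouched a c ∧ untouched a c′
untouched a (ifpos _ c c′) = untouched a c ∧ untouched a c′
untouched a (for c)        = untouched a c
untouched a _              = true

quiet : ∀ {d} → Cmd d → Bool
quiet (print _)      = false
quiet (c ； c′)       = quiet c ∧ quiet c′
quiet (ifpos _ c c′) = quiet c ∧ quiet c′
quiet (for c)        = quiet c
quiet _              = true

module _ {n : ℕ} where

  for-rule : ∀ {d} {c : Cmd (suc d)} {ρ : Env n d} (I : ℕ → State → Set) →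
    (∀ i τ → I (toℕ i) τ → I (suc (toℕ i)) (⟦ c ⟧ (i ∷ ρ) τ)) → ∀ {σ} → I 0 σ → I n (⟦ for c ⟧ ρ σ)
  for-rule {c = c} {ρ} I visit {σ} init = prefix n ≤-refl
    where
    prefix : ∀ k (k≤n : k ≤ n) → I k (upTo (λ i → ⟦ c ⟧ (i ∷ ρ)) k k≤n σ)
    prefix zero    _   = init
    prefix (suc k) k<n = subst (λ m → I (suc m) (⟦ c ⟧ (fromℕ< k<n ∷ ρ) τ)) (toℕ-fromℕ< k<n)
      (visit (fromℕ< k<n) τ (subst (λ m → I m τ) (sym (toℕ-fromℕ< k<n)) (prefix k (<⇒≤ k<n))))
      where τ = upTo (λ i → ⟦ c ⟧ (i ∷ ρ)) k (<⇒≤ k<n) σ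

  -- For loops whose visit to `i` settles the property of `i`, while visits to other vertices leave
  -- that property alone.
  for-each : ∀ {d} {c : Cmd (suc d)} {ρ : Env n d} (K : State → Set) (Q : Fin n → State → Set) →
    (∀ i τ → K τ → K (⟦ c ⟧ (i ∷ ρ) τ) × Q i (⟦ c ⟧ (i ∷ ρ) τ) ×
                   (∀ {j} → j ≢ i → Q j τ → Q j (⟦ c ⟧ (i ∷ ρ) τ))) →
    ∀ {σ} → K σ → K (⟦ for c ⟧ ρ σ) × (∀ j → Q j (⟦ for c ⟧ ρ σ))
  for-each {c = c} {ρ} K Q visit init =
    let k , q = for-rule {c = c} {ρ} (λ m τ → K τ × (∀ j → toℕ j < m → Q j τ)) next (init , λ _ ())
    in k , λ j → q j (toℕ<n j)
    where
    next : ∀ i τ → K τ × (∀ j → toℕ j < toℕ i → Q j τ) →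
           K (⟦ c ⟧ (i ∷ ρ) τ) × (∀ j → toℕ j < suc (toℕ i) → Q j (⟦ c ⟧ (i ∷ ρ) τ))
    next i τ (k , q) with k′ , qi , keep ← visit i τ k = k′ , λ j j<1+i → case j j<1+i
      where
      case : ∀ j → toℕ j < suc (toℕ i) → Q j (⟦ c ⟧ (i ∷ ρ) τ)
      case j j<1+i with j Fin.≟ i
      ... | yes refl = qi
      ... | no j≢i   = keep j≢i (q j (≤∧≢⇒< (s≤s⁻¹ j<1+i) (j≢i ∘ toℕ-injective)))

  -- Here a property once established survives every visit, as an upper bound on a running minimum
  -- does.
  for-pairs : ∀ {d} {c : Cmd (suc (suc d))} {ρ : Env n d} (K : State → Set) (Q : Fin n → Fin n → State → Set) →
    (∀ u v τ → K τ → K (⟦ c ⟧ (v ∷ u ∷ ρ) τ) × Q u v (⟦ c ⟧ (v ∷ u ∷ ρ) τ) ×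
                     (∀ {u′ v′} → Q u′ v′ τ → Q u′ v′ (⟦ c ⟧ (v ∷ u ∷ ρ) τ))) →
    ∀ {σ} → K σ → K (⟦ for (for c) ⟧ ρ σ) × (∀ u v → Q u v (⟦ for (for c) ⟧ ρ σ))
  for-pairs {c = c} {ρ} K Q visit = for-each {c = for c} {ρ} K (λ u τ → ∀ v → Q u v τ) λ u τ k →
    let k′ , q = for-each {c = c} {u ∷ ρ} K (Q u)
                   (λ v τ k → let k′ , q , keep = visit u v τ k in k′ , q , λ _ → keep) k
    in k′ , q , λ {u′} _ q′ v → proj₁ (for-rule {c = c} {u ∷ ρ} (λ _ τ → Q u′ v τ × K τ)
         (λ v τ (q , k) → let k′ , _ , keep = visit u v τ k in keep q , k′) (q′ v , k))

  frame : ∀ {d} a (c : Cmd d) {ρ : Env n d} {σ} → T (untouched a c) → arr (⟦ c ⟧ ρ σ) a ≡ arr σ a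
  frame a skip t = refl
  frame a (x := e) t = refl
  frame a (put b e f) t with code b ≡ᵇ code a
  ... | false = refl
  frame a (input b e) {ρ} {state V A is os} t with is
  frame a (input b e) {ρ} {state V A is os} t | [] with code b ≡ᵇ code a
  ... | false = refl
  frame a (input b e) {ρ} {state V A is os} t | _ ∷ _ with code b ≡ᵇ code a
  ... | false = refl
  frame a (print e) t = refl
  frame a (c ； c′) t = let t₁ , t₂ = Equivalence.to T-∧ t in trans (frame a c′ t₂) (frame a c t₁)
  frame a (ifpos e c c′) {ρ} {σ} t = let t₁ , t₂ = Equivalence.to T-∧ t in
    choose-elim (λ τ → arr τ a ≡ arr σ a) (⟦ e ⟧ᵉ ρ σ) (λ _ → frame a c t₁) (λ _ → frame a c′ t₂)
  frame a (for c) {ρ} {σ} t =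
    for-rule {c = c} {ρ} (λ _ τ → arr τ a ≡ arr σ a) (λ i τ eq → trans (frame a c t) eq) refl

  quiet-outs : ∀ {d} (c : Cmd d) {ρ : Env n d} {σ} → T (quiet c) → outs (⟦ c ⟧ ρ σ) ≡ outs σ
  quiet-outs skip t = refl
  quiet-outs (x := e) t = refl
  quiet-outs (put b e f) t = refl
  quiet-outs (input b e) {ρ} {state V A [] os} t = refl
  quiet-outs (input b e) {ρ} {state V A (_ ∷ _) os} t = refl
  quiet-outs (c ； c′) t = let t₁ , t₂ = Equivalence.to T-∧ t in trans (quiet-outs c′ t₂) (quiet-outs c t₁)
  quiet-outs (ifpos e c c′) {ρ} {σ} t = let t₁ , t₂ = Equivalence.to T-∧ t in
    choose-elim (λ τ → outs τ ≡ outs σ) (⟦ e ⟧ᵉ ρ σ) (λ _ → quiet-outs c t₁) (λ _ → quiet-outs c′ t₂)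
  quiet-outs (for c) {ρ} {σ} t =
    for-rule {c = c} {ρ} (λ _ τ → outs τ ≡ outs σ) (λ i τ eq → trans (quiet-outs c t) eq) refl

-- Searching

best first second other level total : ℕ
best   = 0
first  = 1
second = 2
other  = 3
level  = 4
total  = 5

when : ∀ {d} → Exp d → Cmd d → Cmd d
when e c = ifpos e c skip

update : ∀ {d} → Exp (2 + d) → Cmd (2 + d)
update key = best := key ； first := idx (suc zero) ； second := idx zero

argmin : ∀ {d} → Exp d → Exp (2 + d) → Exp (2 + d) → Cmd d
argmin bound guard key = best := bound ； for (for (when (guard ⊗ (var best ⊖ key)) (update key)))

-- Variables below `k` are scratch: `argmin` overwrites 0 to 2 and `unique` also 3, so `level`,
-- which is variable 4, survives all searches.
Keeps : ℕ → Memory → Memory → Set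
Keeps k V V′ = ∀ x → V′ (k + x) ≡ V (k + x)

infixl 8 _⟨_⟩
_⟨_⟩ : State → Memory → State
σ ⟨ V ⟩ = record σ { vars = V }

module _ {n d : ℕ} {ρ : Env n d} where

  Argmin : Memory → ℕ → (Fin n → Fin n → Set) → (Fin n → Fin n → ℕ) → Set
  Argmin V b C weight =
    (V best ≡ b × (∀ {u v} → C u v → b ≤ weight u v)) ⊎
    (∃[ u ] ∃[ v ] C u v × V first ≡ toℕ u × V second ≡ toℕ v × V best ≡ weight u v × weight u v < b ×
                   (∀ {u′ v′} → C u′ v′ → weight u v ≤ weight u′ v′))

  -- Guard and key are evaluated while `best`, `first` and `second` change, so they are specified in
  -- all memories that agree from variable 3 on.
  argmin-rule : ∀ {bound guard key} σ {C weight} →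
    (∀ {u v V} → Keeps 3 (vars σ) V → Truth (⟦ guard ⟧ᵉ (v ∷ u ∷ ρ) (σ ⟨ V ⟩)) (C u v) ×
                                      ⟦ key ⟧ᵉ (v ∷ u ∷ ρ) (σ ⟨ V ⟩) ≡ weight u v) →
    ∃[ V ] ⟦ argmin bound guard key ⟧ ρ σ ≡ σ ⟨ V ⟩ × Keeps 3 (vars σ) V ×
           Argmin V (⟦ bound ⟧ᵉ ρ σ) C weight
  argmin-rule {bound} {guard} {key} σ {C} {weight} spec =
    let (V , eq , keeps , found) , minimal =
          for-pairs {c = body} {ρ} K Q visit {σ ⟨ vars σ [ best ≔ b ] ⟩} (_ , refl , (λ _ → refl) , inj₁ refl)
    in V , eq , keeps , result eq minimal found
    where
    b = ⟦ bound ⟧ᵉ ρ σ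
    body = when (guard ⊗ (var best ⊖ key)) (update key)
    Found : Memory → Set
    Found V = ∃[ u ] ∃[ v ] C u v × V first ≡ toℕ u × V second ≡ toℕ v × V best ≡ weight u v × weight u v < b
    K : State → Set
    K τ = ∃[ V ] τ ≡ σ ⟨ V ⟩ × Keeps 3 (vars σ) V × (V best ≡ b ⊎ Found V)
    Q : Fin n → Fin n → State → Set
    Q u v τ = C u v → vars τ best ≤ weight u v
    best≤ : ∀ {V} → V best ≡ b ⊎ Found V → V best ≤ b
    best≤ (inj₁ eq) = ≤-reflexive eq
    best≤ (inj₂ (_ , _ , _ , _ , _ , eq , lt)) = ≤-trans (≤-reflexive eq) (<⇒≤ lt)
    visit : ∀ u v τ → K τ → K (⟦ body ⟧ (v ∷ u ∷ ρ) τ) × Q u v (⟦ body ⟧ (v ∷ u ∷ ρ) τ) ×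
           (∀ {u′ v′} → Q u′ v′ τ → Q u′ v′ (⟦ body ⟧ (v ∷ u ∷ ρ) τ))
    visit u v _ (V , refl , keeps , found) =
      choose-elim (λ υ → K υ × Q u v υ × (∀ {u′ v′} → Q u′ v′ (σ ⟨ V ⟩) → Q u′ v′ υ)) test
        (λ t → let c , lt = proj₁ truth t in
          (_ , refl , keeps , inj₂ (u , v , c , refl , refl , weighs , <-≤-trans lt (best≤ {V} found))) ,
          (λ _ → ≤-reflexive weighs) ,
          λ q c′ → ≤-trans (≤-reflexive weighs) (≤-trans (<⇒≤ lt) (q c′)))
        (λ f → (V , refl , keeps , found) , (λ c → ≮⇒≥ λ lt → proj₂ truth (c , lt) f) , λ q → q)
      where
      test = ⟦ guard ⊗ (var best ⊖ key) ⟧ᵉ (v ∷ u ∷ ρ) (σ ⟨ V ⟩)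
      weighs = proj₂ (spec {u} {v} {V} keeps)
      truth : Truth test (C u v × weight u v < V best)
      truth = truth-and (proj₁ (spec keeps)) (subst (λ w → Truth (V best ∸ ⟦ key ⟧ᵉ (v ∷ u ∷ ρ) (σ ⟨ V ⟩)) (w < V best)) weighs
                (truth-< (⟦ key ⟧ᵉ (v ∷ u ∷ ρ) (σ ⟨ V ⟩)) (V best)))
    result : ∀ {V τ} → τ ≡ σ ⟨ V ⟩ → (∀ u v → Q u v τ) → V best ≡ b ⊎ Found V → Argmin V b C weight
    result refl minimal (inj₁ eq) = inj₁ (eq , λ {u} {v} c → subst (_≤ weight u v) eq (minimal u v c))
    result refl minimal (inj₂ (u , v , c , f , s , eq , lt)) = inj₂ (u , v , c , f , s , eq , lt ,
      λ {u′} {v′} c′ → subst (_≤ weight u′ v′) eq (minimal u′ v′ c′))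

-- All keys are 0 and the bound is 1, so `best` ends as 0 if some pair satisfies the guard and as 1
-- if none does. A search thus tests a universal statement whose violations the guard describes.
find : ∀ {d} → Exp (2 + d) → Cmd d
find guard = argmin (lit 1) guard (lit 0)

-- The second search looks for a witness other than the first one, and its failure leaves the
-- desired 1. If already the first search fails, its 1 has to be replaced by 0.
unique : ∀ {d} → Exp (2 + d) → Cmd d
unique guard = find guard ；
  ifpos (var best) (best := lit 0) (other := var second ； find (guard ⊗ distance (idx zero) (var other)))

-- The command c leaves its result in best.
fill : ∀ {d} → Array → Cmd (suc d) → Cmd d
fill a c = for (c ； put a (idx zero) (var best))

writeArr-same : ∀ A a i x → writeArr A a i x a ≡ A a [ i ≔ x ]
writeArr-same A a i x rewrite ≡ᵇ-refl (code a) = refl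

writeArr-other : ∀ A {a b} i x → b ≢ a → writeArr A a i x b ≡ A b
writeArr-other A {a} {b} i x b≢a rewrite ≢⇒≡ᵇ-false {code a} {code b} (λ eq → b≢a (sym (code-injective eq))) = refl

record Same (a : Array) (σ τ : State) : Set where
  constructor same
  field
    arr-same  : ∀ {b} → b ≢ a → arr τ b ≡ arr σ b
    vars-same : Keeps 4 (vars σ) (vars τ)
    outs-same : outs τ ≡ outs σ
open Same

module _ {n d : ℕ} {ρ : Env n d} where

  find-rule : ∀ {guard} σ {C : Fin n → Fin n → Set} →
    (∀ {u v V} → Keeps 3 (vars σ) V → Truth (⟦ guard ⟧ᵉ (v ∷ u ∷ ρ) (σ ⟨ V ⟩)) (C u v)) →
    ∃[ V ] ⟦ find guard ⟧ ρ σ ≡ σ ⟨ V ⟩ × Keeps 3 (vars σ) V ×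
           ((V best ≡ 1 × (∀ {u v} → ¬ C u v)) ⊎
            (V best ≡ 0 × ∃[ u ] ∃[ v ] C u v × V first ≡ toℕ u × V second ≡ toℕ v))
  find-rule {guard} σ {C} spec with argmin-rule {ρ = ρ} {lit 1} {guard} {lit 0} σ {C} {λ _ _ → 0} (λ k → spec k , refl)
  ... | V , eq , keeps , inj₁ (b≡1 , none) = V , eq , keeps , inj₁ (b≡1 , λ c → 1+n≰n (none c))
  ... | V , eq , keeps , inj₂ (u , v , c , f , s , b≡0 , _) = V , eq , keeps , inj₂ (b≡0 , u , v , c , f , s)

  exists-rule : ∀ {guard} σ {D : Fin n → Set} →
    (∀ {u v V} → Keeps 4 (vars σ) V → Truth (⟦ guard ⟧ᵉ (v ∷ u ∷ ρ) (σ ⟨ V ⟩)) (D v)) →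
    ∃[ V ] ⟦ find guard ⟧ ρ σ ≡ σ ⟨ V ⟩ × Keeps 4 (vars σ) V × Flag (V best) (∀ v → ¬ D v)
  exists-rule {guard} σ {D} spec with find-rule {guard} σ {λ _ → D} (λ {u} {v} {V} k → spec {u} {v} {V} (λ x → k (suc x)))
  ... | V , eq , keeps , inj₁ (b≡1 , none) = V , eq , keeps ∘ suc , inj₁ (b≡1 , λ v → none {v} {v})
  ... | V , eq , keeps , inj₂ (b≡0 , _ , v , p , _) = V , eq , keeps ∘ suc , inj₂ (b≡0 , λ none → none v p)

  unique-rule : ∀ {guard} σ {D : Fin n → Set} →
    (∀ {u v V} → Keeps 4 (vars σ) V → Truth (⟦ guard ⟧ᵉ (v ∷ u ∷ ρ) (σ ⟨ V ⟩)) (D v)) →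
    ∃[ V ] ⟦ unique guard ⟧ ρ σ ≡ σ ⟨ V ⟩ × Keeps 4 (vars σ) V × Flag (V best) (∃¹ D)
  unique-rule {guard} σ {D} spec
    with V , eq , keeps , result ← find-rule {guard} σ {λ _ → D} (λ {u} {v} {V} k → spec {u} {v} {V} (λ x → k (suc x)))
    = subst Φ (sym eq) (choose-elim Goal (V best) (absent result) (present result))
    where
    second-try = other := var second ； find (guard ⊗ distance (idx zero) (var other))
    Goal : State → Set
    Goal τ = ∃[ V ] τ ≡ σ ⟨ V ⟩ × Keeps 4 (vars σ) V × Flag (V best) (∃¹ D)
    Φ : State → Set
    Φ υ = Goal (⟦ ifpos (var best) (best := lit 0) second-try ⟧ ρ υ)
    Result = (V best ≡ 1 × (∀ {u v : Fin n} → ¬ D v)) ⊎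
             (V best ≡ 0 × ∃[ u ] ∃[ v ] D v × V first ≡ toℕ u × V second ≡ toℕ v)
    absent : Result → V best ≢ 0 → Goal (σ ⟨ V [ best ≔ 0 ] ⟩)
    absent (inj₁ (_ , none)) _ = _ , refl , keeps ∘ suc , inj₂ (refl , λ (v , p , _) → none {v} p)
    absent (inj₂ (b≡0 , _)) b≢0 = ⊥-elim (b≢0 b≡0)
    present : Result → V best ≡ 0 → Goal (⟦ second-try ⟧ ρ (σ ⟨ V ⟩))
    present (inj₁ (b≡1 , _)) b≡0 = ⊥-elim (0≢1+n (trans (sym b≡0) b≡1))
    present (inj₂ (_ , _ , v , p , _ , s)) _
      with find-rule {guard ⊗ distance (idx zero) (var other)} (σ ⟨ V [ other ≔ V second ] ⟩) {λ _ w → D w × w ≢ v}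
             (λ {u} {w} {V′} k → truth-and (spec {u} {w} {V′} (λ x → trans (k (suc x)) (keeps (suc x))))
                (truth-map (λ w≢v eq → w≢v (trans (cong toℕ eq) (sym (trans (k 0) s))))
                  (λ w≢v eq → w≢v (toℕ-injective (trans eq (trans (k 0) s))))
                  (truth-≢ (toℕ w) (V′ other))))
    ... | V′ , eq , k , inj₁ (b≡1 , none) = V′ , eq , (λ x → trans (k (suc x)) (keeps (suc x))) ,
      inj₁ (b≡1 , v , p , λ {w} q → only w q)
      where
      only : ∀ w → D w → w ≡ v
      only w q with w Fin.≟ v
      ... | yes w≡v = w≡v
      ... | no w≢v  = ⊥-elim (none {w} {w} (q , w≢v))
    ... | V′ , eq , k , inj₂ (b≡0 , _ , w , (q , w≢v) , _) = V′ , eq , (λ x → trans (k (suc x)) (keeps (suc x))) ,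
      inj₂ (b≡0 , λ (_ , _ , only) → w≢v (trans (only q) (sym (only p))))

  -- While the array is filled, the other arrays and the variables from 4 on keep their initial
  -- values, so `c` can be specified in terms of the initial state throughout.
  fill-rule : ∀ {a c} {P : Fin n → Set} σ →
    (∀ i τ → Same a σ τ → ∃[ V ] ⟦ c ⟧ (i ∷ ρ) τ ≡ τ ⟨ V ⟩ × Keeps 4 (vars τ) V × Flag (V best) (P i)) →
    Same a σ (⟦ fill a c ⟧ ρ σ) × (∀ j → Flag (arr (⟦ fill a c ⟧ ρ σ) a (toℕ j)) (P j))
  fill-rule {a} {c} {P} σ compute =
    for-each {c = c ； put a (idx zero) (var best)} {ρ} (Same a σ) Q visit {σ} (same (λ _ → refl) (λ _ → refl) refl)
    where
    Q : Fin n → State → Set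
    Q j τ = Flag (arr τ a (toℕ j)) (P j)
    visit : ∀ i τ → Same a σ τ → let τ′ = ⟦ put a (idx zero) (var best) ⟧ (i ∷ ρ) (⟦ c ⟧ (i ∷ ρ) τ) in
            Same a σ τ′ × Q i τ′ × (∀ {j} → j ≢ i → Q j τ → Q j τ′)
    visit i τ k with V , eq , keeps , flag ← compute i τ k rewrite eq =
      same (λ b≢a → trans (writeArr-other (arr τ) (toℕ i) (V best) b≢a) (arr-same k b≢a))
           (λ x → trans (keeps x) (vars-same k x)) (outs-same k) ,
      subst (λ x → Flag x (P i)) (sym (trans (cong (_$ toℕ i) (writeArr-same (arr τ) a (toℕ i) (V best)))
        (updated (arr τ a) (toℕ i) (V best)))) flag ,
      λ {j} j≢i → subst (λ x → Flag x (P j))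
        (sym (trans (cong (_$ toℕ j) (writeArr-same (arr τ) a (toℕ i) (V best)))
          (unaffected (arr τ a) (V best) (j≢i ∘ toℕ-injective))))

-- Sums over vertices

Σᶠ : ∀ {n} → (Fin n → ℕ) → ℕ
Σᶠ {zero}  f = 0
Σᶠ {suc n} f = f zero + Σᶠ (f ∘ suc)

Σᶠ-mono : ∀ {n} {f g : Fin n → ℕ} → (∀ i → f i ≤ g i) → Σᶠ f ≤ Σᶠ g
Σᶠ-mono {zero}  f≤g = z≤n
Σᶠ-mono {suc n} f≤g = +-mono-≤ (f≤g zero) (Σᶠ-mono (f≤g ∘ suc))

Σᶠ-strict : ∀ {n} {f g : Fin n → ℕ} → (∀ i → f i ≤ g i) → ∀ i → f i < g i → Σᶠ f < Σᶠ g
Σᶠ-strict f≤g zero    lt = +-mono-<-≤ lt (Σᶠ-mono (f≤g ∘ suc))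
Σᶠ-strict f≤g (suc i) lt = +-mono-≤-< (f≤g zero) (Σᶠ-strict (f≤g ∘ suc) i lt)

Σᶠ-bound : ∀ {n} (f : Fin n → ℕ) b → (∀ i → f i ≤ b) → Σᶠ f ≤ n * b
Σᶠ-bound {zero}  f b f≤b = z≤n
Σᶠ-bound {suc n} f b f≤b = +-mono-≤ (f≤b zero) (Σᶠ-bound (f ∘ suc) b (f≤b ∘ suc))

term≤Σᶠ : ∀ {n} (f : Fin n → ℕ) i → f i ≤ Σᶠ f
term≤Σᶠ f zero    = m≤m+n _ _
term≤Σᶠ f (suc i) = ≤-trans (term≤Σᶠ (f ∘ suc) i) (m≤n+m _ (f zero))

-- A fixed number of rounds takes the place of a while loop. A round that decreases `μ` must start
-- in an unfinished state; hence a finished state stays finished, and surplus rounds do no harm.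
module Rounds (Inv Done : State → Set) (μ : State → ℕ) (b : ℕ) where

  Progress : State → State → Set
  Progress τ τ′ = Inv τ′ × (Done τ′ ⊎ (¬ Done τ × μ τ′ < μ τ))

  After : ℕ → State → Set
  After r τ = Inv τ × (Done τ ⊎ μ τ + r ≤ b)

  after-round : ∀ r τ τ′ → (Inv τ → Progress τ τ′) → After r τ → After (suc r) τ′
  after-round r τ τ′ round (inv , rest) with round inv
  ... | inv′ , inj₁ done′ = inv′ , inj₁ done′
  after-round r τ τ′ round (inv , inj₁ done′)  | inv′ , inj₂ (¬done , _) = ⊥-elim (¬done done′)
  after-round r τ τ′ round (inv , inj₂ μ+r≤b) | inv′ , inj₂ (_ , lt) =
    inv′ , inj₂ (≤-trans (≤-reflexive (+-suc _ r)) (≤-trans (+-monoˡ-≤ r lt) μ+r≤b))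

  finished : ∀ {τ} → (μ τ ≡ 0 → Done τ) → After b τ → Inv τ × Done τ
  finished zero⇒done (inv , inj₁ done′) = inv , done′
  finished {τ} zero⇒done (inv , inj₂ μ+b≤b) =
    inv , zero⇒done (n≤0⇒n≡0 (+-cancelʳ-≤ b (μ τ) 0 μ+b≤b))

-- The algorithm

edge : ∀ {d} → Exp (2 + d)
edge = get adjacent (row (suc zero) ⊕ idx zero)

-- The colours are 1 and 2, exchanged by subtraction from 3, and 0 means uncoloured. If no edge
-- leads out of the coloured part, an uncoloured vertex becomes the seed of a new component.
paintRound : ∀ {d} → Cmd d
paintRound =
  find (edge ⊗ get colour (idx (suc zero)) ⊗ (lit 1 ⊖ get colour (idx zero))) ；
  ifpos (var best)
    (find (lit 1 ⊖ get colour (idx zero)) ； ifpos (var best) skip (put colour (var second) (lit 1)))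
    (put colour (var second) (lit 3 ⊖ get colour (var first)))

-- Subtracting the colour from 2 selects colour 1. A displaced owner keeps its stale `partner`
-- entry: a bidder counts as matched only if its partner's `owner` entry points back to it.
auctionRound : ∀ {d} → Cmd d
auctionRound =
  argmin size
    (edge ⊗ (lit 2 ⊖ get colour (idx (suc zero))) ⊗
     distance (get owner (get partner (idx (suc zero)))) (lit 1 ⊕ idx (suc zero)))
    (get price (idx zero)) ；
  when (size ⊖ var best)
    (put owner (var second) (lit 1 ⊕ var first) ；
     put partner (var first) (var second) ；
     put price (var second) (lit 1 ⊕ get price (var second)))

module Phases (G : Graph) where
  open Graph G hiding (sym) renaming (order to n)
  open Graphs G

  Stored : State → Set
  Stored σ = ∀ u v → arr σ adjacent (toℕ u * n + toℕ v) ≡ bit (adj u v)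

  edge-truth : ∀ {σ} → Stored σ → ∀ {u v} → Truth (arr σ adjacent (toℕ u * n + toℕ v)) (u ~ v)
  edge-truth stored {u} {v} rewrite stored u v with adj u v
  ... | true  = (λ _ → tt) , (λ _ ())
  ... | false = (λ 0≢0 → 0≢0 refl) , λ ()

  shade : State → Vertex → ℕ
  shade σ v = arr σ colour (toℕ v)

  -- Colouring

  colour-1 : ∀ {s} → s ≡ 1 ⊎ s ≡ 2 → Truth (2 ∸ s) (s ≡ 1)
  colour-1 (inj₁ refl) = (λ _ → refl) , (λ _ ())
  colour-1 (inj₂ refl) = (λ h → ⊥-elim (h refl)) , (λ ())

  colour-2 : ∀ {s} → s ≡ 1 ⊎ s ≡ 2 → Truth (s ∸ 1) (s ≡ 2)
  colour-2 (inj₁ refl) = (λ h → ⊥-elim (h refl)) , (λ ())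
  colour-2 (inj₂ refl) = (λ _ → refl) , (λ _ ())

  -- The proper colouring `χ` is quantified within the invariant because it may change: a new
  -- component is always seeded with 1, which may contradict the previous `χ`.
  Extendable : State → Set
  Extendable σ = Stored σ × ∃[ χ ] Colouring χ × (∀ v → shade σ v ≡ 0 ⊎ shade σ v ≡ χ v)

  Complete : State → Set
  Complete σ = ∀ v → shade σ v ≢ 0

  uncoloured : State → ℕ
  uncoloured σ = Σᶠ (λ v → 1 ∸ shade σ v)

  open Rounds Extendable Complete uncoloured n using () renaming
    (Progress to PaintProgress; after-round to after-paint; finished to paint-finished)

  -- Shared by the propagation along an edge and the seeding of a component, which differ in the `χ`
  -- that they supply.
  paint : ∀ τ {χ x V i s} → Stored τ → Colouring χ → (∀ v → shade τ v ≡ 0 ⊎ shade τ v ≡ χ v) →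
    shade τ x ≡ 0 → i ≡ toℕ x → s ≡ χ x →
    PaintProgress τ (record τ { vars = V ; arr = writeArr (arr τ) colour i s })
  paint τ {χ} {x} {V} stored colouring extends x≡0 refl refl =
    (stored , χ , colouring , extends′) , inj₂ ((λ complete → complete x x≡0) , Σᶠ-strict fewer x strictly)
    where
    τ′ = record τ { vars = V ; arr = writeArr (arr τ) colour (toℕ x) (χ x) }
    new : shade τ′ x ≡ χ x
    new = updated (arr τ colour) (toℕ x) (χ x)
    old : ∀ {v} → v ≢ x → shade τ′ v ≡ shade τ v
    old v≢x = unaffected (arr τ colour) (χ x) (v≢x ∘ toℕ-injective)
    extends′ : ∀ v → shade τ′ v ≡ 0 ⊎ shade τ′ v ≡ χ v
    extends′ v with v Fin.≟ x
    ... | yes refl = inj₂ new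
    ... | no v≢x   = subst (λ s → s ≡ 0 ⊎ s ≡ χ v) (sym (old v≢x)) (extends v)
    fewer : ∀ v → 1 ∸ shade τ′ v ≤ 1 ∸ shade τ v
    fewer v with v Fin.≟ x
    ... | yes refl = subst (λ s → 1 ∸ shade τ′ x ≤ 1 ∸ s) (sym x≡0) (m∸n≤m 1 (shade τ′ x))
    ... | no v≢x   = ≤-reflexive (cong (1 ∸_) (old v≢x))
    strictly : 1 ∸ shade τ′ x < 1 ∸ shade τ x
    strictly rewrite new | x≡0 with χ x | Colouring.values colouring x
    ... | _ | inj₁ refl = s≤s z≤n
    ... | _ | inj₂ refl = s≤s z≤n

  opposite : ∀ {χ u v} → Colouring χ → u ~ v → 3 ∸ χ u ≡ χ v
  opposite {χ} {u} {v} colouring u~v with values u | values v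
    where open Colouring colouring
  ... | inj₁ u≡1 | inj₁ v≡1 = ⊥-elim (Colouring.proper colouring u~v (trans u≡1 (sym v≡1)))
  ... | inj₁ u≡1 | inj₂ v≡2 = trans (cong (3 ∸_) u≡1) (sym v≡2)
  ... | inj₂ u≡2 | inj₁ v≡1 = trans (cong (3 ∸_) u≡2) (sym v≡1)
  ... | inj₂ u≡2 | inj₂ v≡2 = ⊥-elim (Colouring.proper colouring u~v (trans u≡2 (sym v≡2)))

  exchange : ℕ → ℕ → ℕ
  exchange zero    c = 3 ∸ c
  exchange (suc _) c = c

  -- If no edge leads from a coloured to an uncoloured vertex, the colours of all uncoloured ones can be exchanged.
  swap : ∀ {χ} (s : Vertex → ℕ) → Colouring χ → (∀ v → s v ≡ 0 ⊎ s v ≡ χ v) →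
    (∀ {u v} → u ~ v → s u ≢ 0 → s v ≢ 0) → ∀ {x} → s x ≡ 0 →
    ∃[ χ′ ] Colouring χ′ × (∀ v → s v ≡ 0 ⊎ s v ≡ χ′ v) × χ′ x ≡ 1
  swap {χ} s colouring extends closed {x} x≡0 with Colouring.values colouring x
  ... | inj₁ χx≡1 = χ , colouring , extends , χx≡1
  ... | inj₂ χx≡2 = χ′ , record { values = values′ ; proper = proper′ } , extends′ , χ′x≡1
    where
    open Colouring colouring
    χ′ : Vertex → ℕ
    χ′ v = exchange (s v) (χ v)
    values′ : ∀ v → χ′ v ≡ 1 ⊎ χ′ v ≡ 2
    values′ v with s v
    ... | suc _ = values v
    ... | zero with values v
    ...   | inj₁ eq = inj₂ (cong (3 ∸_) eq)
    ...   | inj₂ eq = inj₁ (cong (3 ∸_) eq)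
    proper′ : ∀ {u v} → u ~ v → χ′ u ≢ χ′ v
    proper′ {u} {v} u~v eq with s u in su | s v in sv
    ... | suc _ | suc _ = proper u~v eq
    ... | suc _ | zero  = closed u~v (λ h → 0≢1+n (trans (sym h) su)) sv
    ... | zero  | suc _ = closed (~-sym u~v) (λ h → 0≢1+n (trans (sym h) sv)) su
    ... | zero  | zero  = proper (~-sym u~v) (trans (sym (opposite colouring u~v)) (trans eq (opposite colouring (~-sym u~v))))
    extends′ : ∀ v → s v ≡ 0 ⊎ s v ≡ χ′ v
    extends′ v with s v | extends v
    ... | zero  | _       = inj₁ refl
    ... | suc _ | inj₂ eq = inj₂ eq
    χ′x≡1 : χ′ x ≡ 1
    χ′x≡1 = trans (cong (λ z → exchange z (χ x)) x≡0) (cong (3 ∸_) χx≡2)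

  paint-progress : ∀ {d} {ρ : Env n d} τ → Extendable τ → PaintProgress τ (⟦ paintRound ⟧ ρ τ)
  paint-progress {ρ = ρ} τ inv@(stored , χ , colouring , extends)
    with find-rule {ρ = ρ} {edge ⊗ get colour (idx (suc zero)) ⊗ (lit 1 ⊖ get colour (idx zero))} τ
           {λ u v → u ~ v × shade τ u ≢ 0 × shade τ v ≡ 0}
           (λ {u} {v} _ → truth-and (edge-truth {τ} stored) (truth-and (truth-self (shade τ u)) (truth-zero (shade τ v))))
  ... | V , eq , _ , inj₂ (b≡0 , u , v , (u~v , u≢0 , v≡0) , f , s) rewrite eq | b≡0 | f =
    paint τ {V = V} stored colouring extends v≡0 s (trans (cong (3 ∸_) (known (extends u))) (opposite colouring u~v))
    where
    known : shade τ u ≡ 0 ⊎ shade τ u ≡ χ u → shade τ u ≡ χ u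
    known (inj₁ u≡0) = ⊥-elim (u≢0 u≡0)
    known (inj₂ eq)  = eq
  ... | V , eq , _ , inj₁ (b≡1 , none) rewrite eq | b≡1
    with find-rule {ρ = ρ} {lit 1 ⊖ get colour (idx zero)} (τ ⟨ V ⟩)
           {λ _ v → shade τ v ≡ 0} (λ {_} {v} _ → truth-zero (shade τ v))
  ...   | V′ , eq′ , _ , inj₁ (b≡1′ , all) rewrite eq′ | b≡1′ = inv , inj₁ (λ v → all {v} {v})
  ...   | V′ , eq′ , _ , inj₂ (b≡0′ , _ , x , x≡0 , _ , s) rewrite eq′ | b≡0′
    with χ′ , colouring′ , extends′ , one ← swap (shade τ) colouring extends (λ u~v u≢0 v≡0 → none (u~v , u≢0 , v≡0)) x≡0 =
    paint τ {V = V′} stored colouring′ extends′ x≡0 s (sym one)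

  zero⇒complete : ∀ {τ} → uncoloured τ ≡ 0 → Complete τ
  zero⇒complete {τ} μ≡0 v v≡0 = 1+n≰n (subst₂ (λ a b → 1 ∸ a ≤ b) v≡0 μ≡0 (term≤Σᶠ (λ v → 1 ∸ shade τ v) v))

  paint-correct : ∀ {d} {ρ : Env n d} {σ} → Extendable σ → let σ′ = ⟦ for paintRound ⟧ ρ σ in Colouring (shade σ′)
  paint-correct {ρ = ρ} {σ} inv
    with (stored , χ , colouring , extends) , complete ← paint-finished {⟦ for paintRound ⟧ ρ σ}
           (zero⇒complete {⟦ for paintRound ⟧ ρ σ})
           (for-rule {c = paintRound} {ρ} (Rounds.After Extendable Complete uncoloured n)
             (λ i τ → after-paint (toℕ i) τ (⟦ paintRound ⟧ (i ∷ ρ) τ) (paint-progress {ρ = i ∷ ρ} τ)) {σ}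
             (inv , inj₂ (≤-trans (≤-reflexive (+-identityʳ _)) (≤-trans (Σᶠ-bound _ 1 (λ v → m∸n≤m 1 (shade σ v)))
                (≤-reflexive (*-identityʳ n))))))
    = record { values = λ v → subst (λ s → s ≡ 1 ⊎ s ≡ 2) (sym (final v)) (values v)
             ; proper = λ {u} {v} u~v eq → proper u~v (trans (sym (final u)) (trans eq (final v))) }
    where
    σ′ = ⟦ for paintRound ⟧ ρ σ
    open Colouring colouring
    final : ∀ v → shade σ′ v ≡ χ v
    final v with extends v
    ... | inj₁ v≡0 = ⊥-elim (complete v v≡0)
    ... | inj₂ eq  = eq

  bipartite⇒colouring : Bipartite G → ∃[ χ ] Colouring χ
  bipartite⇒colouring (A , stable , stable′) = χ , record { values = values ; proper = proper }
    where
    χ : Vertex → ℕ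
    χ v with v ∈? A
    ... | yes _ = 1
    ... | no _  = 2
    values : ∀ v → χ v ≡ 1 ⊎ χ v ≡ 2
    values v with v ∈? A
    ... | yes _ = inj₁ refl
    ... | no _  = inj₂ refl
    proper : ∀ {u v} → u ~ v → χ u ≢ χ v
    proper {u} {v} u~v eq with u ∈? A | v ∈? A
    ... | yes u∈ | yes v∈ = stable u v u∈ v∈ u~v
    ... | no u∉  | no v∉  = stable′ u v (x∉p⇒x∈∁p u∉) (x∉p⇒x∈∁p v∉) u~v

-- The auction

module Auctions (G : Graph) where
  open Graph G hiding (sym) renaming (order to n)
  open Graphs G
  open Phases G

  priceOf : State → Vertex → ℕ
  priceOf σ v = arr σ price (toℕ v)

  -- Owners are stored shifted by one, so that the initial 0 means that an object is unsold.
  Owns : State → Vertex → Vertex → Set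
  Owns σ i j = arr σ owner (toℕ j) ≡ suc (toℕ i)

  -- The field `cheapest` is the complementary slackness condition of auction algorithms with
  -- increment 1. An object once sold only changes hands, which gives `sold`, and `partner<` makes
  -- even stale or initial partner entries denote vertices.
  record Auction (σ : State) : Set where
    field
      stored    : Stored σ
      colouring : Colouring (shade σ)
      partner<  : ∀ (i : Vertex) → Σ[ j ∈ Vertex ] arr σ partner (toℕ i) ≡ toℕ j
      partner≡  : ∀ {i j} → Owns σ i j → arr σ partner (toℕ i) ≡ toℕ j
      owner~    : ∀ {i j} → Owns σ i j → i ~ j
      owner≡1   : ∀ {i j} → Owns σ i j → shade σ i ≡ 1
      sold      : ∀ {j : Vertex} → priceOf σ j ≢ 0 → ∃[ i ] Owns σ i j
      cheapest  : ∀ {i j k} → Owns σ i j → i ~ k → priceOf σ j ≤ suc (priceOf σ k)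

  Bidding : State → Vertex → Vertex → Set
  Bidding σ i j = i ~ j × shade σ i ≡ 1 × arr σ owner (arr σ partner (toℕ i)) ≢ suc (toℕ i)

  Closed : State → Set
  Closed σ = ∀ {i j} → Bidding σ i j → n ≤ priceOf σ j

  -- Each bid raises by one a price below n, so this sum drops; it is at most n * n, the number of
  -- rounds of the double loop.
  affordable : State → ℕ
  affordable σ = Σᶠ (λ v → n ∸ priceOf σ v)

  open Rounds Auction Closed affordable (n * n) using () renaming
    (Progress to BidProgress; After to AfterBids; after-round to after-bid; finished to auction-finished)

  bid : ∀ τ {i j V x y z} → Auction τ → Bidding τ i j → priceOf τ j < n →
    (∀ {i′ j′} → Bidding τ i′ j′ → priceOf τ j ≤ priceOf τ j′) → x ≡ toℕ i → y ≡ toℕ j → z ≡ priceOf τ j →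
    BidProgress τ (record τ { vars = V ; arr =
      writeArr (writeArr (writeArr (arr τ) owner y (suc x)) partner x y) price y (suc z) })
  bid τ {i} {j} {V} auction bidding@(i~j , i≡1 , free) affordable-j least refl refl refl =
    record
      { stored    = stored
      ; colouring = colouring
      ; partner<  = partner<′
      ; partner≡  = partner≡′
      ; owner~    = λ o → from-owns (λ i′ j′ → i′ ~ j′) i~j owner~ o
      ; owner≡1   = λ o → from-owns (λ i′ _ → shade τ i′ ≡ 1) i≡1 owner≡1 o
      ; sold      = sold′
      ; cheapest  = cheapest′
      } ,
    inj₂ ((λ closed → <⇒≱ affordable-j (closed bidding)) , Σᶠ-strict fewer j strictly)
    where
    open Auction auction
    τ′ = record τ { vars = V ; arr =
      writeArr (writeArr (writeArr (arr τ) owner (toℕ j) (suc (toℕ i))) partner (toℕ i) (toℕ j)) price (toℕ j) (suc (priceOf τ j)) }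

    cost-j : priceOf τ′ j ≡ suc (priceOf τ j)
    cost-j = updated (arr τ price) (toℕ j) _
    cost-≢ : ∀ {v} → v ≢ j → priceOf τ′ v ≡ priceOf τ v
    cost-≢ v≢j = unaffected (arr τ price) _ (v≢j ∘ toℕ-injective)
    cost-≤ : ∀ v → priceOf τ v ≤ priceOf τ′ v
    cost-≤ v with v Fin.≟ j
    ... | yes refl = ≤-trans (n≤1+n _) (≤-reflexive (sym cost-j))
    ... | no v≢j   = ≤-reflexive (sym (cost-≢ v≢j))

    -- The new owner i of j owned nothing before, since it would have been its partner.
    owns-nothing : ∀ {k} → ¬ Owns τ i k
    owns-nothing o = free (trans (cong (arr τ owner) (partner≡ o)) o)
    owns-j : ∀ {k} → Owns τ′ k j → k ≡ i
    owns-j o = toℕ-injective (suc-injective (trans (sym o) (updated (arr τ owner) (toℕ j) _)))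
    owns-≢ : ∀ {v k} → v ≢ j → Owns τ′ k v → Owns τ k v
    owns-≢ v≢j o = trans (sym (unaffected (arr τ owner) _ (v≢j ∘ toℕ-injective))) o
    from-owns : (Φ : Vertex → Vertex → Set) → Φ i j → (∀ {k v} → Owns τ k v → Φ k v) → ∀ {k v} → Owns τ′ k v → Φ k v
    from-owns Φ new old {k} {v} o with v Fin.≟ j
    ... | yes refl = subst (λ k → Φ k v) (sym (owns-j o)) new
    ... | no v≢j   = old (owns-≢ v≢j o)

    partner-i : arr τ′ partner (toℕ i) ≡ toℕ j
    partner-i = updated (arr τ partner) (toℕ i) (toℕ j)
    partner-≢ : ∀ {k} → k ≢ i → arr τ′ partner (toℕ k) ≡ arr τ partner (toℕ k)
    partner-≢ k≢i = unaffected (arr τ partner) (toℕ j) (k≢i ∘ toℕ-injective)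
    partner<′ : ∀ k → ∃[ v ] arr τ′ partner (toℕ k) ≡ toℕ v
    partner<′ k with k Fin.≟ i
    ... | yes refl = j , partner-i
    ... | no k≢i with v , eq ← partner< k = v , trans (partner-≢ k≢i) eq
    partner≡′ : ∀ {k v} → Owns τ′ k v → arr τ′ partner (toℕ k) ≡ toℕ v
    partner≡′ o = from-owns (λ k v → arr τ′ partner (toℕ k) ≡ toℕ v) partner-i
      (λ o → trans (partner-≢ λ { refl → owns-nothing o }) (partner≡ o)) o

    sold′ : ∀ {v} → priceOf τ′ v ≢ 0 → ∃[ k ] Owns τ′ k v
    sold′ {v} v≢0 with v Fin.≟ j
    ... | yes refl = i , updated (arr τ owner) (toℕ j) _
    ... | no v≢j with k , o ← sold (λ v≡0 → v≢0 (trans (cost-≢ v≢j) v≡0)) =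
      k , trans (unaffected (arr τ owner) _ (v≢j ∘ toℕ-injective)) o
    -- For the new owner, `least` and the increment give a slack of at most one. For the other
    -- owners, their own price is unchanged and no price falls.
    cheapest′ : ∀ {k v w} → Owns τ′ k v → k ~ w → priceOf τ′ v ≤ suc (priceOf τ′ w)
    cheapest′ {k} {v} {w} o k~w with v Fin.≟ j
    ... | no v≢j = ≤-trans (≤-reflexive (cost-≢ v≢j)) (≤-trans (cheapest (owns-≢ v≢j o) k~w) (s≤s (cost-≤ w)))
    ... | yes refl with refl ← owns-j o =
      ≤-trans (≤-reflexive cost-j) (s≤s (≤-trans (least (k~w , i≡1 , free)) (cost-≤ w)))

    fewer : ∀ v → n ∸ priceOf τ′ v ≤ n ∸ priceOf τ v
    fewer v = ∸-monoʳ-≤ n (cost-≤ v)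
    strictly : n ∸ priceOf τ′ j < n ∸ priceOf τ j
    strictly rewrite cost-j = ∸-monoʳ-< (n<1+n _) affordable-j

  bid-progress : ∀ {d} {ρ : Env n d} τ → Auction τ → BidProgress τ (⟦ auctionRound ⟧ ρ τ)
  bid-progress {d} {ρ} τ auction
    with argmin-rule {ρ = ρ} {size}
           {edge ⊗ (lit 2 ⊖ get colour (idx (suc zero))) ⊗
            distance (get owner (get partner (idx (suc zero)))) (lit 1 ⊕ idx (suc zero))}
           {get price (idx zero)} τ {Bidding τ} {λ _ v → priceOf τ v}
           (λ {u} {v} _ → truth-and (edge-truth {τ} stored) (truth-and (colour-1 (values u))
             (truth-≢ (arr τ owner (arr τ partner (toℕ u))) (suc (toℕ u)))) , refl)
    where
    open Auction auction
    open Colouring colouring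
  ... | V , eq , _ , inj₁ (b≡n , closed) rewrite eq | b≡n | n∸n≡0 n =
    -- The invariant speaks of the arrays only, so its fields carry over to the state with other
    -- variables.
    record { Auction auction } , inj₁ closed
  ... | V , eq , _ , inj₂ (i , j , bidding , f , s , b≡ , lt , least) rewrite eq | b≡ =
    choose-elim (BidProgress τ) (n ∸ priceOf τ j)
      (λ _ → bid τ {V = V} auction bidding lt least f s (cong (arr τ price) s))
      (λ n∸≡0 → ⊥-elim (<⇒≱ lt (m∸n≡0⇒m≤n n∸≡0)))

  zero⇒closed : ∀ {τ} → affordable τ ≡ 0 → Closed τ
  zero⇒closed {τ} μ≡0 {_} {j} _ =
    m∸n≡0⇒m≤n (n≤0⇒n≡0 (subst (n ∸ priceOf τ j ≤_) μ≡0 (term≤Σᶠ (λ v → n ∸ priceOf τ v) j)))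

  auction-correct : ∀ {d} {ρ : Env n d} {σ} → Auction σ →
    let σ′ = ⟦ for (for auctionRound) ⟧ ρ σ in Auction σ′ × Closed σ′
  auction-correct {ρ = ρ} {σ} init = auction-finished {⟦ for (for auctionRound) ⟧ ρ σ}
    (zero⇒closed {⟦ for (for auctionRound) ⟧ ρ σ})
    -- The double loop is flattened: the visit with indices `k` and `l` is round `k * n + l`.
    (for-rule {c = for auctionRound} {ρ} (λ k → AfterBids (k * n))
      (λ k τ after → subst (λ r → AfterBids r (⟦ for auctionRound ⟧ (k ∷ ρ) τ)) (+-comm (toℕ k * n) n)
        (for-rule {c = auctionRound} {k ∷ ρ} (λ l → AfterBids (toℕ k * n + l))
          (λ l υ after → subst (λ r → AfterBids r (⟦ auctionRound ⟧ (l ∷ k ∷ ρ) υ)) (sym (+-suc (toℕ k * n) (toℕ l)))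
             (after-bid (toℕ k * n + toℕ l) υ (⟦ auctionRound ⟧ (l ∷ k ∷ ρ) υ) (bid-progress {ρ = l ∷ k ∷ ρ} υ) after))
          {τ} (subst (λ r → AfterBids r τ) (sym (+-identityʳ (toℕ k * n))) after)))
      {σ} (init , inj₂ (≤-trans (≤-reflexive (+-identityʳ _)) (Σᶠ-bound _ n (λ v → m∸n≤m n (priceOf σ v))))))

-- In the scope of a loop over v and of a search for a pair (u , w), where u is immaterial.
v′ w′ : ∀ {d} → Fin (3 + d)
v′ = suc (suc zero)
w′ = zero

edge′ : ∀ {d} → Exp (3 + d)
edge′ = get adjacent (row v′ ⊕ idx w′)

readGraph : ∀ {d} → Cmd d
readGraph = for (for (input adjacent (row (suc zero) ⊕ idx zero)))

-- The level rises by one whenever some price equals it, as then `best` is 0. Once it is no price,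
-- it no longer moves.
findLevel : ∀ {d} → Cmd d
findLevel = level := lit 0 ；
  for (find (lit 1 ⊖ distance (get price (idx zero)) (var level)) ； level := var level ⊕ (lit 1 ⊖ var best))

-- Describes the violations of membership, because `find` yields 1 if no pair satisfies its guard.
excludes : ∀ {d} → Exp (3 + d)
excludes =
  ((lit 2 ⊖ get colour (idx v′)) ⊗ edge′ ⊗ (lit 1 ⊖ (get price (idx w′) ⊖ var level))) ⊕
  ((get colour (idx v′) ⊖ lit 1) ⊗ (get price (idx v′) ⊖ var level))

selectSet : ∀ {d} → Cmd d
selectSet = fill chosen (find excludes)

selectLeaves : ∀ {d} → Cmd d
selectLeaves = fill leaf (unique edge′)

unpendant : ∀ {d} → Exp (3 + d)
unpendant = (lit 1 ⊖ get leaf (idx v′)) ⊕ (edge′ ⊗ get leaf (idx w′) ⊗ (get colour (idx v′) ⊖ lit 1))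

selectPendant : ∀ {d} → Cmd d
selectPendant = fill pendant (find unpendant)

selectDominated : ∀ {d} → Cmd d
selectDominated = fill dominated (unique (edge′ ⊗ get pendant (idx w′)))

undominated : ∀ {d} → Exp (2 + d)
undominated = (lit 1 ⊖ get pendant (idx zero)) ⊗ (lit 1 ⊖ get dominated (idx zero))

testCorona : ∀ {d} → Cmd d
testCorona = find undominated

emit : ∀ {d} → Array → Cmd d
emit a = total := lit 0 ； for (total := var total ⊕ get a (idx zero)) ；
  -- As `best` holds the outcome of the corona test, this is the size of the set on success and one
  -- less otherwise.
  print (var total ⊖ (lit 1 ⊖ var best)) ； for (print (get a (idx zero)))

output : ∀ {d} → Cmd d
output = ifpos (var best) (emit pendant) (emit chosen)

program : Cmd 0
program = readGraph ； for paintRound ； for (for auctionRound) ； findLevel ； selectSet ；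
  selectLeaves ； selectPendant ； selectDominated ； testCorona ； output

-- Input and output

nth : List ℕ → ℕ → ℕ
nth []       _       = 0
nth (x ∷ xs) zero    = x
nth (x ∷ xs) (suc i) = nth xs i

nth-++ˡ : ∀ xs {ys i} → i < length xs → nth (xs ++ ys) i ≡ nth xs i
nth-++ˡ (x ∷ xs) {i = zero}  _   = refl
nth-++ˡ (x ∷ xs) {i = suc i} lt  = nth-++ˡ xs (s≤s⁻¹ lt)

nth-++ʳ : ∀ xs {ys i} → nth (xs ++ ys) (length xs + i) ≡ nth ys i
nth-++ʳ []       = refl
nth-++ʳ (x ∷ xs) = nth-++ʳ xs

nth-map-tabulate : ∀ {n k} (f : Fin n → ℕ) (g : Fin k → Fin n) v → nth (map f (List.tabulate g)) (toℕ v) ≡ f (g v)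
nth-map-tabulate f g zero    = refl
nth-map-tabulate f g (suc v) = nth-map-tabulate f (g ∘ suc) v

nth-concatMap : ∀ {n k m} (f : Fin n → List ℕ) (g : Fin k → Fin n) → (∀ u → length (f u) ≡ m) →
  ∀ u {j} → j < m → nth (concatMap f (List.tabulate g)) (toℕ u * m + j) ≡ nth (f (g u)) j
nth-concatMap f g len zero j<m = nth-++ˡ (f (g zero)) (<-≤-trans j<m (≤-reflexive (sym (len (g zero)))))
nth-concatMap {m = m} f g len (suc u) {j} j<m = trans
  (cong (nth (concatMap f (List.tabulate g)))
    (trans (+-assoc m (toℕ u * m) j) (cong (_+ (toℕ u * m + j)) (sym (len (g zero))))))
  (trans (nth-++ʳ (f (g zero))) (nth-concatMap f (g ∘ suc) len u j<m))

length-concatMap : ∀ {A : Set} {m} (f : A → List ℕ) → (∀ x → length (f x) ≡ m) → ∀ xs →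
  length (concatMap f xs) ≡ length xs * m
length-concatMap f len []       = refl
length-concatMap f len (x ∷ xs) = trans (length-++ (f x)) (cong₂ _+_ (len x) (length-concatMap f len xs))

drop-nth : ∀ L k → (drop k L ≡ [] × nth L k ≡ 0) ⊎ (drop k L ≡ nth L k ∷ drop (suc k) L)
drop-nth []      zero    = inj₁ (refl , refl)
drop-nth []      (suc k) = inj₁ (refl , refl)
drop-nth (x ∷ L) zero    = inj₂ refl
drop-nth (x ∷ L) (suc k) = drop-nth L k

drop-[] : ∀ (L : List ℕ) k → drop k L ≡ [] → drop (suc k) L ≡ []
drop-[] []      k       _  = refl
drop-[] (x ∷ L) (suc k) eq = drop-[] L k eq

Consumed : List ℕ → ℕ → State → Set
Consumed L k τ = ins τ ≡ drop k L × (∀ j → j < k → arr τ adjacent j ≡ nth L j)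

consume : ∀ {L k} τ → Consumed L k τ → Consumed L (suc k) (takeInput adjacent k τ)
consume {L} {k} (state V A is os) (refl , known) with drop k L | drop-nth L k | drop-[] L k
... | _ | inj₁ (refl , nth≡0) | rest = sym (rest refl) , written
  where
  written : ∀ j → j < suc k → (A adjacent [ k ≔ 0 ]) j ≡ nth L j
  written j j<1+k with j ≟ k
  ... | yes refl = trans (updated (A adjacent) k 0) (sym nth≡0)
  ... | no j≢k   = trans (unaffected (A adjacent) 0 j≢k) (known j (≤∧≢⇒< (s≤s⁻¹ j<1+k) j≢k))
... | _ | inj₂ refl | _ = refl , written
  where
  written : ∀ j → j < suc k → (A adjacent [ k ≔ nth L k ]) j ≡ nth L j
  written j j<1+k with j ≟ k
  ... | yes refl = updated (A adjacent) k (nth L k)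
  ... | no j≢k   = trans (unaffected (A adjacent) (nth L k) j≢k) (known j (≤∧≢⇒< (s≤s⁻¹ j<1+k) j≢k))

readGraph-correct : ∀ {n d} {ρ : Env n d} {σ} → Consumed (ins σ) (n * n) (⟦ readGraph ⟧ ρ σ)
readGraph-correct {n} {ρ = ρ} {σ} = for-rule {c = for body} {ρ} (λ k → Consumed L (k * n))
  (λ u τ c → subst (λ k → Consumed L k (⟦ for body ⟧ (u ∷ ρ) τ)) (+-comm (toℕ u * n) n)
    (for-rule {c = body} {u ∷ ρ} (λ l → Consumed L (toℕ u * n + l))
      (λ v υ c → subst (λ k → Consumed L k (⟦ body ⟧ (v ∷ u ∷ ρ) υ)) (sym (+-suc (toℕ u * n) (toℕ v))) (consume υ c))
      {τ} (subst (λ k → Consumed L k τ) (sym (+-identityʳ (toℕ u * n))) c)))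
  {σ} (refl , λ _ ())
  where
  L = ins σ
  body : ∀ {d} → Cmd (2 + d)
  body = input adjacent (row (suc zero) ⊕ idx zero)

bits : ∀ {n} → Subset n → List ℕ
bits S = map bit (toList S)

take-bits : ∀ {n} (S : Subset n) i → take (suc (toℕ i)) (bits S) ≡ take (toℕ i) (bits S) ++ (bit (lookup S i) ∷ [])
take-bits (b ∷ S) zero    = refl
take-bits (b ∷ S) (suc i) = cong (bit b ∷_) (take-bits S i)

take-all-bits : ∀ {n} (S : Subset n) → take n (bits S) ≡ bits S
take-all-bits []      = refl
take-all-bits (b ∷ S) = cong (bit b ∷_) (take-all-bits S)

sum-bits : ∀ {n} (S : Subset n) → sum (bits S) ≡ ∣ S ∣
sum-bits []          = refl
sum-bits (true ∷ S)  = cong suc (sum-bits S)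
sum-bits (false ∷ S) = sum-bits S

Marks : ∀ {n} → Array → Subset n → State → Set
Marks a S σ = ∀ v → arr σ a (toℕ v) ≡ bit (lookup S v)

emit-correct : ∀ {n d} {ρ : Env n d} {σ a} {S : Subset n} → Marks a S σ →
  outs (⟦ emit a ⟧ ρ σ) ≡ outs σ ++ (∣ S ∣ ∸ (1 ∸ vars σ best)) ∷ bits S
emit-correct {n} {ρ = ρ} {σ} {a} {S} marks =
  trans (proj₁ printed) (trans (cong₂ (λ o t → (o ++ (t ∷ [])) ++ take n (bits S)) outs₁ value)
    (trans (++-assoc (outs σ) _ _) (cong (λ l → outs σ ++ (∣ S ∣ ∸ (1 ∸ vars σ best)) ∷ l) (take-all-bits S))))
  where
  count : ∀ {d} → Cmd (suc d)
  count = total := var total ⊕ get a (idx zero)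
  σ₁ = ⟦ for count ⟧ ρ (σ ⟨ vars σ [ total ≔ 0 ] ⟩)
  σ₂ = ⟦ print (var total ⊖ (lit 1 ⊖ var best)) ⟧ ρ σ₁
  counted : vars σ₁ total ≡ sum (take n (bits S)) × vars σ₁ best ≡ vars σ best × arr σ₁ a ≡ arr σ a × outs σ₁ ≡ outs σ
  counted = for-rule {c = count} {ρ}
    (λ k τ → vars τ total ≡ sum (take k (bits S)) × vars τ best ≡ vars σ best × arr τ a ≡ arr σ a × outs τ ≡ outs σ)
    (λ { i τ (t , b , same-a , o) →
      trans (cong₂ _+_ t (trans (cong (_$ toℕ i) same-a) (trans (marks i) (sym (+-identityʳ _)))))
        (trans (sym (sum-++ (take (toℕ i) (bits S)) _)) (cong sum (sym (take-bits S i)))) ,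
      b , same-a , o })
    {σ ⟨ vars σ [ total ≔ 0 ] ⟩} (refl , refl , refl , refl)
  outs₁ = proj₂ (proj₂ (proj₂ counted))
  value : vars σ₁ total ∸ (1 ∸ vars σ₁ best) ≡ ∣ S ∣ ∸ (1 ∸ vars σ best)
  value = cong₂ (λ t b → t ∸ (1 ∸ b))
    (trans (proj₁ counted) (trans (cong sum (take-all-bits S)) (sum-bits S))) (proj₁ (proj₂ counted))
  printed : outs (⟦ for (print (get a (idx zero))) ⟧ ρ σ₂) ≡ outs σ₂ ++ take n (bits S) ×
            arr (⟦ for (print (get a (idx zero))) ⟧ ρ σ₂) a ≡ arr σ a
  printed = for-rule {c = print (get a (idx zero))} {ρ} (λ k τ → outs τ ≡ outs σ₂ ++ take k (bits S) × arr τ a ≡ arr σ a)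
    (λ { i τ (o , same-a) →
      trans (cong₂ (λ o x → o ++ (x ∷ [])) o (trans (cong (_$ toℕ i) same-a) (marks i)))
        (trans (++-assoc (outs σ₂) _ _) (cong (outs σ₂ ++_) (sym (take-bits S i)))) , same-a })
    {σ₂} (sym (++-identityʳ (outs σ₂)) , proj₁ (proj₂ (proj₂ counted)))

truth-≡ : ∀ x y → Truth (1 ∸ ((x ∸ y) + (y ∸ x))) (x ≡ y)
truth-≡ x y = truth-map (decidable-stable (x ≟ y)) (λ eq x≢y → x≢y eq) (truth-not (truth-≢ x y))

truth-≤ : ∀ x y → Truth (1 ∸ (x ∸ y)) (x ≤ y)
truth-≤ x y = truth-map m∸n≡0⇒m≤n m≤n⇒m∸n≡0 (truth-zero (x ∸ y))

flag-map : ∀ {x P Q} → (P → Q) → (Q → P) → Flag x P → Flag x Q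
flag-map f g (inj₁ (eq , p))  = inj₁ (eq , f p)
flag-map f g (inj₂ (eq , ¬p)) = inj₂ (eq , ¬p ∘ g)

flag-stable : ∀ {x P} → Flag x P → ¬ ¬ P → P
flag-stable (inj₁ (_ , p))  _   = p
flag-stable (inj₂ (_ , ¬p)) ¬¬p = ⊥-elim (¬¬p ¬p)

module _ {n : ℕ} where

  record Marked (a : Array) (P : Fin n → Set) (σ : State) : Set where
    field
      members : Subset n
      marks   : Marks a members σ
      ∈⇒      : ∀ {v} → v ∈ members → P v
      ⇒∈      : ∀ {v} → P v → v ∈ members

  -- Each flag decides its instance of `P`, so the characteristic vector can be read off the array
  -- without a separate decision procedure.
  marked : ∀ {a P σ} → (∀ v → Flag (arr σ a (toℕ v)) (P v)) → Marked a P σ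
  marked {a} {P} {σ} flags = record
    { members = members
    ; marks   = marks
    ; ∈⇒      = λ {v} v∈ → proj₁ (flag⇒truth (flags v)) λ eq →
        0≢1+n (trans (sym eq) (trans (marks v) (cong bit ([]=⇒lookup v∈))))
    ; ⇒∈      = λ {v} p → lookup⇒[]= v members (belongs v p)
    }
    where
    members = tabulate (λ v → 0 <ᵇ arr σ a (toℕ v))
    flag-bit : ∀ {x Q} → Flag x Q → x ≡ bit (0 <ᵇ x)
    flag-bit (inj₁ (refl , _)) = refl
    flag-bit (inj₂ (refl , _)) = refl
    marks : Marks a members σ
    marks v = trans (flag-bit (flags v)) (cong bit (sym (lookup∘tabulate _ v)))
    belongs : ∀ v → P v → lookup members v ≡ true
    belongs v p with lookup members v | marks v
    ... | true  | _  = refl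
    ... | false | eq = ⊥-elim (proj₂ (flag⇒truth (flags v)) p eq)

module Selections (G : Graph) where
  open Graph G hiding (sym) renaming (order to n)
  open Graphs G
  open Phases G
  open Auctions G

  -- The price level

  findLevel-correct : ∀ {d} {ρ : Env n d} σ → let σ′ = ⟦ findLevel ⟧ ρ σ in
    arr σ′ ≡ arr σ × vars σ′ level ≤ n × (∀ j → priceOf σ j ≢ vars σ′ level)
  findLevel-correct {ρ = ρ} σ =
    conclude (⟦ findLevel ⟧ ρ σ)
      (for-rule {c = body} {ρ} I visit {σ ⟨ vars σ [ level ≔ 0 ] ⟩} (refl , z≤n , (λ _ ()) , inj₁ refl))
    where
    body : ∀ {d} → Cmd (suc d)
    body = find (lit 1 ⊖ distance (get price (idx zero)) (var level)) ； level := var level ⊕ (lit 1 ⊖ var best)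
    Taken : ℕ → Set
    Taken l = ∃[ j ] priceOf σ j ≡ l
    -- Either every pass so far has raised the level, or the level is already free.
    I : ℕ → State → Set
    I k τ = arr τ ≡ arr σ × vars τ level ≤ k × (∀ l → l < vars τ level → Taken l) ×
            (vars τ level ≡ k ⊎ (∀ j → priceOf σ j ≢ vars τ level))
    visit : ∀ i τ → I (toℕ i) τ → I (suc (toℕ i)) (⟦ body ⟧ (i ∷ ρ) τ)
    visit i (state V _ is os) (refl , l≤k , taken , end)
      with find-rule {ρ = i ∷ ρ} {lit 1 ⊖ distance (get price (idx zero)) (var level)} (state V (arr σ) is os)
             {λ _ v → priceOf σ v ≡ V level}
             (λ {_} {v} {V′} keeps → subst (λ l → Truth (1 ∸ ((priceOf σ v ∸ V′ level) + (V′ level ∸ priceOf σ v))) (priceOf σ v ≡ l))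
               (keeps 1) (truth-≡ (priceOf σ v) (V′ level)))
    ... | V′ , eq , keeps , inj₁ (b≡1 , none) rewrite eq | b≡1 | keeps 1 | +-identityʳ (V level) =
      refl , m≤n⇒m≤1+n l≤k , taken , inj₂ (λ j → none {j} {j})
    ... | V′ , eq , keeps , inj₂ (b≡0 , _ , v , hit , _) rewrite eq | b≡0 | keeps 1 | +-comm (V level) 1 =
      refl , s≤s l≤k , taken′ , inj₁ (cong suc (full end))
      where
      full : V level ≡ toℕ i ⊎ (∀ j → priceOf σ j ≢ V level) → V level ≡ toℕ i
      full (inj₁ eq′)  = eq′
      full (inj₂ free) = ⊥-elim (free v hit)
      taken′ : ∀ l → l < suc (V level) → Taken l
      taken′ l l<1+L with l ≟ V level
      ... | yes refl = v , hit
      ... | no l≢L   = taken l (≤∧≢⇒< (s≤s⁻¹ l<1+L) l≢L)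
    -- There are n + 1 levels up to n, but only n prices.
    not-all : ¬ (∀ l → l ≤ n → Taken l)
    not-all taken with i , j , i<j , eq ← pigeonhole (n<1+n n)
      (λ (l : Fin (suc n)) → proj₁ (taken (toℕ l) (s≤s⁻¹ (toℕ<n l)))) =
      <⇒≢ i<j (trans (sym (proj₂ (taken (toℕ i) _))) (trans (cong (priceOf σ) eq) (proj₂ (taken (toℕ j) _))))
    conclude : ∀ τ → I n τ → arr τ ≡ arr σ × vars τ level ≤ n × (∀ j → priceOf σ j ≢ vars τ level)
    conclude τ (eq , l≤n , taken , inj₂ free) = eq , l≤n , free
    conclude τ (eq , l≤n , taken , inj₁ l≡n) = eq , l≤n , λ j hit → not-all λ l l≤n′ → all-taken j hit l l≤n′
      where
      all-taken : ∀ j → priceOf σ j ≡ vars τ level → ∀ l → l ≤ n → Taken l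
      all-taken j hit l l≤n′ with l ≟ vars τ level
      ... | yes refl = j , hit
      ... | no l≢L   = taken l (≤∧≢⇒< (subst (l ≤_) (sym l≡n) l≤n′) l≢L)

  -- The maximum stable set

  Excluded : State → Vertex → Vertex → Set
  Excluded σ v w = (shade σ v ≡ 1 × v ~ w × priceOf σ w ≤ vars σ level) ⊎ (shade σ v ≡ 2 × vars σ level < priceOf σ v)

  stored-same : ∀ {a σ τ} → Same a σ τ → adjacent ≢ a → Stored σ → Stored τ
  stored-same τ≈σ ≢a stored u v = trans (cong (_$ _) (arr-same τ≈σ ≢a)) (stored u v)

  selectSet-correct : ∀ {d} {ρ : Env n d} σ → Stored σ → Colouring (shade σ) →
    let σ′ = ⟦ selectSet ⟧ ρ σ in Same chosen σ σ′ × (∀ v → Flag (arr σ′ chosen (toℕ v)) (∀ w → ¬ Excluded σ v w))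
  selectSet-correct {ρ = ρ} σ stored colouring = fill-rule {ρ = ρ} {c = find excludes} σ λ v τ τ≈σ →
    exists-rule {ρ = v ∷ ρ} {excludes} τ {Excluded σ v} λ {u} {w} {V} keeps →
      let colour≡ = cong (_$ toℕ v) (arr-same τ≈σ {colour} λ ())
          price≡  = λ (x : Vertex) → cong (_$ toℕ x) (arr-same τ≈σ {price} λ ())
          level≡  = trans (keeps 0) (vars-same τ≈σ 0)
      in truth-or
        (truth-and (subst (λ s → Truth (2 ∸ s) (shade σ v ≡ 1)) (sym colour≡) (colour-1 (values v)))
          (truth-and (edge-truth {τ} (stored-same τ≈σ (λ ()) stored))
            (subst₂ (λ p l → Truth (1 ∸ (p ∸ l)) (priceOf σ w ≤ vars σ level)) (sym (price≡ w)) (sym level≡)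
              (truth-≤ (priceOf σ w) (vars σ level)))))
        (truth-and (subst (λ s → Truth (s ∸ 1) (shade σ v ≡ 2)) (sym colour≡) (colour-2 (values v)))
          (subst₂ (λ p l → Truth (p ∸ l) (vars σ level < priceOf σ v)) (sym (price≡ v)) (sym level≡)
            (truth-< (vars σ level) (priceOf σ v))))
    where open Colouring colouring

  -- Since no price equals the level, an owner of an object above the level has no neighbour below it,
  -- and a bidder with a neighbour below the level owns such a neighbour.
  module _ {σ} (auction : Auction σ) (closed : Closed σ) (level≤n : vars σ level ≤ n)
           (gap : ∀ j → priceOf σ j ≢ vars σ level) {S : VertexSet}
           (∈⇒ : ∀ {v} → v ∈ S → ∀ w → ¬ Excluded σ v w) (⇒∈ : ∀ {v} → (∀ w → ¬ Excluded σ v w) → v ∈ S) where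

    open Auction auction
    open Colouring colouring

    private
      L = vars σ level

      above : ∀ {j} → L ≤ priceOf σ j → L < priceOf σ j
      above {j} le = ≤∧≢⇒< le (gap j ∘ sym)

      1≢2 : ∀ {v} → shade σ v ≡ 1 → shade σ v ≢ 2
      1≢2 eq eq′ with () ← trans (sym eq) eq′

      -- The slack of one leaves the level itself as the only possible price of `k` that is not
      -- above it, and `gap` forbids that price.
      high⇒neighbours-high : ∀ {i j k} → Owns σ i j → L < priceOf σ j → i ~ k → L < priceOf σ k
      high⇒neighbours-high o high i~k = above (s≤s⁻¹ (≤-trans high (cheapest o i~k)))

      neighbour-2 : ∀ {u v} → u ~ v → shade σ u ≡ 1 → shade σ v ≡ 2
      neighbour-2 {u} {v} u~v u≡1 with values v
      ... | inj₁ v≡1 = ⊥-elim (proper u~v (trans u≡1 (sym v≡1)))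
      ... | inj₂ v≡2 = v≡2

      high-owner∈ : ∀ {i j} → Owns σ i j → L < priceOf σ j → i ∈ S
      high-owner∈ o high = ⇒∈ λ
        { w (inj₁ (_ , i~w , low)) → <⇒≱ (high⇒neighbours-high o high i~w) low
        ; w (inj₂ (i≡2 , _)) → 1≢2 (owner≡1 o) i≡2 }

      -- An unmatched bidder sees only prices of at least n, hence above the level; so one with a
      -- low neighbour is matched.
      owns-partner : ∀ {i w} → shade σ i ≡ 1 → i ~ w → priceOf σ w ≤ L → Owns σ i (proj₁ (partner< i))
      owns-partner {i} {w} i≡1 i~w low with arr σ owner (arr σ partner (toℕ i)) ≟ suc (toℕ i)
      ... | yes owns = trans (cong (arr σ owner) (sym (proj₂ (partner< i)))) owns
      ... | no free  = ⊥-elim (<⇒≱ (above (≤-trans level≤n (closed (i~w , i≡1 , free)))) low)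

      low∈ : ∀ {j} → shade σ j ≡ 2 → ¬ L < priceOf σ j → j ∈ S
      low∈ j≡2 low = ⇒∈ λ { w (inj₁ (j≡1 , _)) → 1≢2 j≡1 j≡2 ; w (inj₂ (_ , high)) → low high }

      -- The matching read in both directions, since excluded vertices occur among bidders and among
      -- objects.
      data Mate (v : Vertex) : Vertex → Set where
        object : ∀ {j} → shade σ v ≡ 1 → Owns σ v j → Mate v j
        bidder : ∀ {i} → shade σ v ≡ 2 → Owns σ i v → Mate v i

      mate~ : ∀ {v w} → Mate v w → v ~ w
      mate~ (object _ o) = owner~ o
      mate~ (bidder _ o) = ~-sym (owner~ o)

      mate-injective : ∀ {v v″ w} → Mate v w → Mate v″ w → v ≡ v″
      mate-injective (object _ o) (object _ o′) = toℕ-injective (suc-injective (trans (sym o) o′))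
      mate-injective (bidder _ o) (bidder _ o′) = toℕ-injective (trans (sym (partner≡ o)) (partner≡ o′))
      -- The common mate would be an owned object, of colour 2, and itself an owner, of colour 1.
      mate-injective (object v≡1 o) (bidder _ o′) = ⊥-elim (1≢2 (owner≡1 o′) (neighbour-2 (owner~ o) v≡1))
      mate-injective (bidder _ o) (object v≡1 o′) = ⊥-elim (1≢2 (owner≡1 o) (neighbour-2 (owner~ o′) v≡1))

      excluded-mate : ∀ {v w} → Excluded σ v w → ∃[ m ] m ∈ S × Mate v m
      excluded-mate {v} (inj₁ (v≡1 , v~w , low)) with owns ← owns-partner v≡1 v~w low =
        _ , low∈ (neighbour-2 (owner~ owns) v≡1) (λ high → <⇒≱ (high⇒neighbours-high owns high v~w) low) , object v≡1 owns
      -- A price above the level is positive, so the object has been sold.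
      excluded-mate {v} (inj₂ (v≡2 , high)) with i , owns ← sold {v} (λ v≡0 → n≮0 (subst (L <_) v≡0 high)) =
        i , high-owner∈ owns high , bidder v≡2 owns

      excluded : ∀ {v} → v ∉ S → ∃[ w ] Excluded σ v w
      excluded {v} v∉ with Fin.any? (λ w →
        ((shade σ v ≟ 1) ×-dec T? (adj v w) ×-dec (priceOf σ w ≤? L)) ⊎-dec ((shade σ v ≟ 2) ×-dec (L <? priceOf σ v)))
      ... | yes found = found
      ... | no none   = ⊥-elim (v∉ (⇒∈ λ w e → none (w , e)))

      mates : ∀ {v} → v ∉ S → ∃[ m ] m ∈ S × Mate v m
      mates v∉ = excluded-mate (proj₂ (excluded v∉))

      mate : Vertex → Vertex
      mate v with v ∈? S
      ... | yes _ = v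
      ... | no v∉ = proj₁ (mates v∉)

      mate-spec : ∀ {v} → v ∉ S → mate v ∈ S × Mate v (mate v)
      mate-spec {v} v∉ with v ∈? S
      ... | yes v∈ = ⊥-elim (v∉ v∈)
      ... | no v∉′ = proj₂ (mates v∉′)

    selected-saturating : Saturating S
    selected-saturating = record
      { mate      = mate
      ; mate∈     = λ v∉ → proj₁ (mate-spec v∉)
      ; mate~     = λ v∉ → mate~ (proj₂ (mate-spec v∉))
      ; injective = λ {v} {w} v∉ w∉ eq →
          mate-injective (subst (Mate v) eq (proj₂ (mate-spec v∉))) (proj₂ (mate-spec w∉))
      }

    selected-stable : Stable G S
    selected-stable u v u∈ v∈ u~v with values u | values v
    ... | inj₁ u≡1 | inj₁ v≡1 = proper u~v (trans u≡1 (sym v≡1))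
    ... | inj₂ u≡2 | inj₂ v≡2 = proper u~v (trans u≡2 (sym v≡2))
    ... | inj₁ u≡1 | inj₂ v≡2 = ∈⇒ v∈ v (inj₂ (v≡2 , ≰⇒> λ low → ∈⇒ u∈ v (inj₁ (u≡1 , u~v , low))))
    ... | inj₂ u≡2 | inj₁ v≡1 = ∈⇒ u∈ u (inj₂ (u≡2 , ≰⇒> λ low → ∈⇒ v∈ u (inj₁ (v≡1 , ~-sym u~v , low))))

-- Opaque, so that comparing the states between two phases of the program does not unfold the phases.
opaque
  run : ∀ {n : ℕ} → Cmd 0 → State → State
  run {n} c σ = ⟦_⟧ {n} c [] σ

  run-elim : ∀ {n : ℕ} (Φ : State → Set) c σ → Φ (⟦_⟧ {n} c [] σ) → Φ (run {n} c σ)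
  run-elim Φ c σ p = p

  run-； : ∀ {n : ℕ} c c′ σ → run {n} (c ； c′) σ ≡ run {n} c′ (run {n} c σ)
  run-； c c′ σ = refl

  machine-run : ∀ (c : Cmd 0) n is {s} → n ≤ s → 1 ≤ s →
    ∃[ t ] machine c ⊢ initial (n ∷ is) ⇓[ t ] outs (run {n} c (start is)) ×
           t ≤ suc (factor c) * s ^ degree c + suc (factor c)
  machine-run = machine-correct

-- Correctness of the whole algorithm

module Correctness (G : Graph) where
  open Graph G hiding (sym) renaming (order to n)
  open Graphs G
  open Phases G
  open Auctions G
  open Selections G

  selectLeaves-correct : ∀ {d} {ρ : Env n d} σ → Stored σ → let σ′ = ⟦ selectLeaves ⟧ ρ σ in
    Same leaf σ σ′ × (∀ v → Flag (arr σ′ leaf (toℕ v)) (Leaf v))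
  selectLeaves-correct {ρ = ρ} σ stored = fill-rule {ρ = ρ} {c = unique edge′} σ λ v τ τ≈σ →
    unique-rule {ρ = v ∷ ρ} {edge′} τ {v ~_} λ _ → edge-truth {τ} (stored-same τ≈σ (λ ()) stored)

  module _ {σ} (colouring : Colouring (shade σ)) where
    open Colouring colouring
    open Coloured colouring

    selectPendant-correct : ∀ {d} {ρ : Env n d} → Stored σ → (∀ v → Flag (arr σ leaf (toℕ v)) (Leaf v)) →
      let σ′ = ⟦ selectPendant ⟧ ρ σ in Same pendant σ σ′ × (∀ v → Flag (arr σ′ pendant (toℕ v)) (Pendant v))
    selectPendant-correct {ρ = ρ} stored leaves = fill-rule {ρ = ρ} {c = find unpendant} σ λ v τ τ≈σ →
      let V , eq , keeps , flag = exists-rule {ρ = v ∷ ρ} {unpendant} τ {Unpendant v}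
            (λ {u} {w} {V} → spec v τ τ≈σ {u} {w} {V})
      in V , eq , keeps , flag-map (to v) (from v) flag
      where
      Unpendant : Vertex → Vertex → Set
      Unpendant v w = ¬ Leaf v ⊎ (v ~ w × Leaf w × shade σ v ≡ 2)
      spec : ∀ v τ → Same pendant σ τ → ∀ {u w V} → Keeps 4 (vars τ) V →
        Truth (⟦ unpendant ⟧ᵉ (w ∷ u ∷ v ∷ ρ) (τ ⟨ V ⟩)) (Unpendant v w)
      spec v τ τ≈σ {w = w} _ = truth-or (truth-not (leaf-truth v))
        (truth-and (edge-truth {τ} (stored-same τ≈σ (λ ()) stored)) (truth-and (leaf-truth w)
          (subst (λ s → Truth (s ∸ 1) (shade σ v ≡ 2)) (sym (cong (_$ toℕ v) (arr-same τ≈σ {colour} λ ())))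
            (colour-2 (values v)))))
        where
        leaf-truth : ∀ x → Truth (arr τ leaf (toℕ x)) (Leaf x)
        leaf-truth x = subst (λ y → Truth y (Leaf x)) (sym (cong (_$ toℕ x) (arr-same τ≈σ {leaf} λ ()))) (flag⇒truth (leaves x))
      to : ∀ v → (∀ w → ¬ Unpendant v w) → Pendant v
      to v none = flag-stable (leaves v) (λ ¬leaf → none v (inj₁ ¬leaf)) , λ w v~w leaf-w → one w v~w leaf-w
        where
        one : ∀ w → v ~ w → Leaf w → shade σ v ≡ 1
        one w v~w leaf-w with values v
        ... | inj₁ v≡1 = v≡1
        ... | inj₂ v≡2 = ⊥-elim (none w (inj₂ (v~w , leaf-w , v≡2)))
      from : ∀ v → Pendant v → ∀ w → ¬ Unpendant v w
      from v (leaf-v , one) w (inj₁ ¬leaf) = ¬leaf leaf-v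
      from v (leaf-v , one) w (inj₂ (v~w , leaf-w , v≡2)) with () ← trans (sym (one w v~w leaf-w)) v≡2

  selectDominated-correct : ∀ {d} {ρ : Env n d} σ {P : Vertex → Set} → Stored σ →
    (∀ v → Flag (arr σ pendant (toℕ v)) (P v)) →
    let σ′ = ⟦ selectDominated ⟧ ρ σ in
    Same dominated σ σ′ × (∀ v → Flag (arr σ′ dominated (toℕ v)) (∃¹ (λ w → v ~ w × P w)))
  selectDominated-correct {ρ = ρ} σ {P} stored flags =
    fill-rule {ρ = ρ} {c = unique (edge′ ⊗ get pendant (idx w′))} σ λ v τ τ≈σ →
      unique-rule {ρ = v ∷ ρ} {edge′ ⊗ get pendant (idx w′)} τ {λ w → v ~ w × P w} λ {_} {w} _ →
        truth-and (edge-truth {τ} (stored-same τ≈σ (λ ()) stored))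
          (subst (λ y → Truth y (P w)) (sym (cong (_$ toℕ w) (arr-same τ≈σ {pendant} λ ()))) (flag⇒truth (flags w)))

  testCorona-correct : ∀ {d} {ρ : Env n d} σ {P Q : Vertex → Set} →
    (∀ v → Flag (arr σ pendant (toℕ v)) (P v)) → (∀ v → Flag (arr σ dominated (toℕ v)) (Q v)) →
    ∃[ V ] ⟦ testCorona ⟧ ρ σ ≡ σ ⟨ V ⟩ × Flag (V best) (∀ v → ¬ P v → Q v)
  testCorona-correct {ρ = ρ} σ {P} {Q} pendants dominateds =
    let V , eq , _ , flag = exists-rule {ρ = ρ} {undominated} σ {λ v → ¬ P v × ¬ Q v} λ {_} {v} _ →
          truth-and (truth-not (flag⇒truth (pendants v))) (truth-not (flag⇒truth (dominateds v)))
    in V , eq , flag-map (λ none v ¬p → flag-stable (dominateds v) (λ ¬q → none v (¬p , ¬q)))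
                         (λ all v (¬p , ¬q) → ¬q (all v ¬p)) flag

  Solved : List ℕ → Set
  Solved = Problem.Solution UnweightedRobustStableSet G

  adjacencies : List ℕ
  adjacencies = concatMap (λ u → map (λ v → bit (adj u v)) (allFin n)) (allFin n)

  row-length : ∀ u → length (map (λ v → bit (adj u v)) (allFin n)) ≡ n
  row-length u = trans (length-map _ (allFin n)) (length-tabulate {n = n} id)

  order≤length : n ≤ length (encodeGraph G)
  order≤length = ≤-trans (n≤1+n² n) (s≤s (≤-reflexive (sym
    (trans (length-concatMap _ row-length (allFin n)) (cong (_* n) (length-tabulate {n = n} id))))))
    where
    n≤1+n² : ∀ n → n ≤ suc (n * n)
    n≤1+n² zero    = z≤n
    n≤1+n² (suc n) = m≤n⇒m≤1+n (m≤m*n (suc n) (suc n))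

  module _ {col} (colouring : Colouring col) where
    open Coloured colouring

    output-correct : ∀ {d} {ρ : Env n d} {σ} {S R : VertexSet}
      (R⇒ : ∀ {v} → v ∈ R → Pendant v) (⇒R : ∀ {v} → Pendant v → v ∈ R) → Marks pendant R σ →
      Stable G S → Saturating S → Marks chosen S σ →
      Flag (vars σ best) (∀ v → ¬ Pendant v → ∃¹ (λ w → v ~ w × Pendant w)) → outs σ ≡ [] →
      Solved (outs (⟦ output ⟧ ρ σ))
    output-correct {ρ = ρ} {σ} {S} {R} R⇒ ⇒R marks-R stable saturating marks-S flag outs≡ = cases flag
      where
      Dominating = ∀ v → ¬ Pendant v → ∃¹ (λ w → v ~ w × Pendant w)
      to-corona : Dominating → Corona R⇒ ⇒R
      to-corona h v v∉ = let w , (v~w , p) , only = h v (v∉ ∘ ⇒R) in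
        w , (v~w , ⇒R p) , λ (v~w′ , w′∈) → only (v~w′ , R⇒ w′∈)
      from-corona : Corona R⇒ ⇒R → Dominating
      from-corona h v ¬p = let w , (v~w , w∈) , only = h v (¬p ∘ R⇒) in
        w , (v~w , R⇒ w∈) , λ (v~w′ , p) → only (v~w′ , ⇒R p)
      printed : ∀ {a} {S : VertexSet} {x} → Marks a S σ → ∣ S ∣ ∸ (1 ∸ vars σ best) ≡ x →
        outs (⟦ emit a ⟧ ρ σ) ≡ x ∷ bits S
      printed {a} {S} marks eq = trans (emit-correct {ρ = ρ} {σ} {a} marks) (cong₂ (λ o x → o ++ x ∷ bits S) outs≡ eq)
      cases : Flag (vars σ best) Dominating → Solved (outs (⟦ output ⟧ ρ σ))
      cases (inj₁ (b≡1 , h)) = choose-elim (λ τ → Solved (outs τ)) (vars σ best)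
        (λ _ → R , corona-optimal R⇒ ⇒R (to-corona h) , printed marks-R
          (trans (cong (λ b → ∣ R ∣ ∸ (1 ∸ b)) b≡1) (sym (corona-robustValue R⇒ ⇒R (to-corona h)))))
        (λ b≡0 → ⊥-elim (0≢1+n (trans (sym b≡0) b≡1)))
      cases (inj₂ (b≡0 , ¬h)) = choose-elim (λ τ → Solved (outs τ)) (vars σ best)
        (λ b≢0 → ⊥-elim (b≢0 b≡0))
        (λ _ → S , maximum-optimal R⇒ ⇒R stable saturating (¬h ∘ from-corona) , printed marks-S
          (trans (cong (λ b → ∣ S ∣ ∸ (1 ∸ b)) b≡0)
            (sym (maximum-robustValue R⇒ ⇒R stable saturating (¬h ∘ from-corona)))))

  program-correct : Bipartite G → Solved (outs (run {n} program (start adjacencies)))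
  program-correct bipartite = finish
    where
    infixl 5 _▷_
    _▷_ : State → Cmd 0 → State
    σ ▷ c = run {n} c σ

    σ₀ = start adjacencies
    σ₁ = σ₀ ▷ readGraph
    σ₂ = σ₁ ▷ for paintRound
    σ₃ = σ₂ ▷ for (for auctionRound)
    σ₄ = σ₃ ▷ findLevel
    σ₅ = σ₄ ▷ selectSet
    σ₆ = σ₅ ▷ selectLeaves
    σ₇ = σ₆ ▷ selectPendant
    σ₈ = σ₇ ▷ selectDominated
    σ₉ = σ₈ ▷ testCorona

    run-program : run {n} program σ₀ ≡ σ₉ ▷ output
    run-program =
      trans (run-； {n} readGraph _ σ₀) $ trans (run-； {n} (for paintRound) _ σ₁) $
      trans (run-； {n} (for (for auctionRound)) _ σ₂) $ trans (run-； {n} findLevel _ σ₃) $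
      trans (run-； {n} selectSet _ σ₄) $ trans (run-； {n} selectLeaves _ σ₅) $
      trans (run-； {n} selectPendant _ σ₆) $ trans (run-； {n} selectDominated _ σ₇) $ run-； {n} testCorona output σ₈

    unchanged : ∀ a c σ → T (untouched a c) → arr (σ ▷ c) a ≡ arr σ a
    unchanged a c σ t = run-elim {n} (λ τ → arr τ a ≡ arr σ a) c σ (frame {n} a c {[]} {σ} t)

    silent : ∀ c σ → T (quiet c) → outs (σ ▷ c) ≡ outs σ
    silent c σ t = run-elim {n} (λ τ → outs τ ≡ outs σ) c σ (quiet-outs {n} c {[]} {σ} t)

    stored₁ : Stored σ₁
    stored₁ u v = trans
      (proj₂ (run-elim {n} (Consumed adjacencies (n * n)) readGraph σ₀ (readGraph-correct {n} {ρ = []} {σ₀}))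
        (toℕ u * n + toℕ v) in-range)
      (trans (nth-concatMap _ id row-length u (toℕ<n v)) (nth-map-tabulate _ id v))
      where
      in-range : toℕ u * n + toℕ v < n * n
      in-range = begin-strict
        toℕ u * n + toℕ v   <⟨ +-monoʳ-< (toℕ u * n) (toℕ<n v) ⟩
        toℕ u * n + n       ≡⟨ +-comm (toℕ u * n) n ⟩
        suc (toℕ u) * n     ≤⟨ *-monoˡ-≤ n (toℕ<n u) ⟩
        n * n               ∎
        where open ≤-Reasoning

    extendable : Extendable σ₁
    -- The bipartition enters only here, as the witness that some proper colouring exists; the input
    -- of the program does not contain it.
    extendable = let χ , colouring = bipartite⇒colouring bipartite in
      stored₁ , χ , colouring , λ v → inj₁ (cong (_$ toℕ v) (unchanged colour readGraph σ₀ tt))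

    stored₂ : Stored σ₂
    stored₂ u v = trans (cong (_$ (toℕ u * n + toℕ v)) (unchanged adjacent (for paintRound) σ₁ tt)) (stored₁ u v)

    initially-zero : ∀ a → T (untouched {0} a readGraph) → T (untouched {0} a (for paintRound)) → ∀ i → arr σ₂ a i ≡ 0
    initially-zero a t t′ i = cong (_$ i) (trans (unchanged a (for paintRound) σ₁ t′) (unchanged a readGraph σ₀ t))

    unsold : ∀ {i j} → ¬ Owns σ₂ i j
    unsold {j = j} o = 0≢1+n (trans (sym (initially-zero owner tt tt (toℕ j))) o)

    auction₂ : Auction σ₂
    auction₂ = record
      { stored    = stored₂
      ; colouring = run-elim {n} (λ τ → Colouring (shade τ)) (for paintRound) σ₁ (paint-correct {ρ = []} {σ₁} extendable)
      -- Initially every partner entry denotes vertex 0, which exists because `i` does.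
      ; partner<  = λ i → let j , eq = index-zero i in j , trans (initially-zero partner tt tt (toℕ i)) (sym eq)
      ; partner≡  = ⊥-elim ∘ unsold
      ; owner~    = ⊥-elim ∘ unsold
      ; owner≡1   = ⊥-elim ∘ unsold
      ; sold      = λ {j} j≢0 → ⊥-elim (j≢0 (initially-zero price tt tt (toℕ j)))
      ; cheapest  = λ o _ → ⊥-elim (unsold o)
      }
      where
      index-zero : ∀ {m} → Fin m → ∃[ j ] toℕ {m} j ≡ 0
      index-zero zero    = zero , refl
      index-zero (suc _) = zero , refl

    auction₃ : Auction σ₃ × Closed σ₃
    auction₃ = run-elim {n} (λ τ → Auction τ × Closed τ) (for (for auctionRound)) σ₂ (auction-correct {ρ = []} {σ₂} auction₂)

    levelled : arr σ₄ ≡ arr σ₃ × vars σ₄ level ≤ n × (∀ j → priceOf σ₃ j ≢ vars σ₄ level)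
    levelled = run-elim {n} (λ τ → arr τ ≡ arr σ₃ × vars τ level ≤ n × (∀ j → priceOf σ₃ j ≢ vars τ level))
      findLevel σ₃ (findLevel-correct {ρ = []} σ₃)

    auction₄ : Auction σ₄ × Closed σ₄ × (∀ j → priceOf σ₄ j ≢ vars σ₄ level)
    auction₄ = transport (vars σ₄) (ins σ₄) (outs σ₄) (proj₁ levelled)
      where
      transport : ∀ {A} V is os → A ≡ arr σ₃ → Auction (state V A is os) × Closed (state V A is os) ×
                  (∀ (j : Vertex) → A price (toℕ j) ≢ vars σ₄ level)
      transport V is os refl = record { Auction (proj₁ auction₃) } , proj₂ auction₃ , proj₂ (proj₂ levelled)

    set : Same chosen σ₄ σ₅ × (∀ v → Flag (arr σ₅ chosen (toℕ v)) (∀ w → ¬ Excluded σ₄ v w))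
    set = run-elim {n} (λ τ → Same chosen σ₄ τ × (∀ v → Flag (arr τ chosen (toℕ v)) (∀ w → ¬ Excluded σ₄ v w)))
      selectSet σ₄ (selectSet-correct {ρ = []} σ₄ (Auction.stored (proj₁ auction₄)) (Auction.colouring (proj₁ auction₄)))

    stored₅ : Stored σ₅
    stored₅ = stored-same (proj₁ set) (λ ()) (Auction.stored (proj₁ auction₄))

    leaves : Same leaf σ₅ σ₆ × (∀ v → Flag (arr σ₆ leaf (toℕ v)) (Leaf v))
    leaves = run-elim {n} (λ τ → Same leaf σ₅ τ × (∀ v → Flag (arr τ leaf (toℕ v)) (Leaf v)))
      selectLeaves σ₅ (selectLeaves-correct {ρ = []} σ₅ stored₅)

    stored₆ : Stored σ₆
    stored₆ = stored-same (proj₁ leaves) (λ ()) stored₅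

    colouring₆ : Colouring (shade σ₆)
    colouring₆ = subst (λ c → Colouring (λ v → c (toℕ v)))
      (sym (trans (arr-same (proj₁ leaves) {colour} λ ()) (arr-same (proj₁ set) {colour} λ ())))
      (Auction.colouring (proj₁ auction₄))

    open Coloured colouring₆

    pendants : Same pendant σ₆ σ₇ × (∀ v → Flag (arr σ₇ pendant (toℕ v)) (Pendant v))
    pendants = run-elim {n} (λ τ → Same pendant σ₆ τ × (∀ v → Flag (arr τ pendant (toℕ v)) (Pendant v)))
      selectPendant σ₆ (selectPendant-correct {σ₆} colouring₆ {ρ = []} stored₆ (proj₂ leaves))

    dominateds : Same dominated σ₇ σ₈ × (∀ v → Flag (arr σ₈ dominated (toℕ v)) (∃¹ (λ w → v ~ w × Pendant w)))
    dominateds = run-elim {n}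
      (λ τ → Same dominated σ₇ τ × (∀ v → Flag (arr τ dominated (toℕ v)) (∃¹ (λ w → v ~ w × Pendant w))))
      selectDominated σ₇
      (selectDominated-correct {ρ = []} σ₇ (stored-same (proj₁ pendants) (λ ()) stored₆) (proj₂ pendants))

    chosen₈ : arr σ₈ chosen ≡ arr σ₅ chosen
    chosen₈ = trans (arr-same (proj₁ dominateds) λ ()) (trans (arr-same (proj₁ pendants) λ ()) (arr-same (proj₁ leaves) λ ()))

    pendant₈ : ∀ v → Flag (arr σ₈ pendant (toℕ v)) (Pendant v)
    pendant₈ v = subst (λ p → Flag (p (toℕ v)) (Pendant v)) (sym (arr-same (proj₁ dominateds) λ ())) (proj₂ pendants v)

    outs₈ : outs σ₈ ≡ []
    outs₈ = begin
      outs σ₈   ≡⟨ outs-same (proj₁ dominateds) ⟩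
      outs σ₇   ≡⟨ outs-same (proj₁ pendants) ⟩
      outs σ₆   ≡⟨ outs-same (proj₁ leaves) ⟩
      outs σ₅   ≡⟨ outs-same (proj₁ set) ⟩
      outs σ₄   ≡⟨ silent findLevel σ₃ tt ⟩
      outs σ₃   ≡⟨ silent (for (for auctionRound)) σ₂ tt ⟩
      outs σ₂   ≡⟨ silent (for paintRound) σ₁ tt ⟩
      outs σ₁   ≡⟨ silent readGraph σ₀ tt ⟩
      []        ∎
      where open ≡-Reasoning

    test : ∃[ V ] σ₉ ≡ σ₈ ⟨ V ⟩ × Flag (V best) (∀ v → ¬ Pendant v → ∃¹ (λ w → v ~ w × Pendant w))
    test = run-elim {n} (λ τ → ∃[ V ] τ ≡ σ₈ ⟨ V ⟩ × Flag (V best) (∀ v → ¬ Pendant v → ∃¹ (λ w → v ~ w × Pendant w)))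
      testCorona σ₈ (testCorona-correct {ρ = []} σ₈ pendant₈ (proj₂ dominateds))

    finish : Solved (outs (run {n} program σ₀))
    finish =
      let S = marked {a = chosen} {σ = σ₈}
            (λ v → subst (λ p → Flag (p (toℕ v)) (∀ w → ¬ Excluded σ₄ v w)) (sym chosen₈) (proj₂ set v))
          R = marked {a = pendant} {σ = σ₈} pendant₈
          V , eq , flag = test
          auction , closed , gap = auction₄
          stable = selected-stable auction closed (proj₁ (proj₂ levelled)) gap (Marked.∈⇒ S) (Marked.⇒∈ S)
          saturating = selected-saturating auction closed (proj₁ (proj₂ levelled)) gap (Marked.∈⇒ S) (Marked.⇒∈ S)
      in subst (λ τ → Solved (outs τ)) (sym (trans run-program (cong (_▷ output) eq)))
           (run-elim {n} (λ τ → Solved (outs τ)) output (σ₈ ⟨ V ⟩)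
             (output-correct colouring₆ {ρ = []} {σ₈ ⟨ V ⟩} (Marked.∈⇒ R) (Marked.⇒∈ R) (Marked.marks R)
               stable saturating (Marked.marks S) flag outs₈))

-- Stated for an arbitrary command, since the bounds for the actual one are large numerals.
command⇒solvable : (c : Cmd 0) →
  (∀ G → Bipartite G →
    Correctness.Solved G (outs (run {Graph.order G} c (start (Correctness.adjacencies G))))) →
  PolyTimeSolvableOn UnweightedRobustStableSet Bipartite
command⇒solvable c correct = machine c , suc (factor c) , degree c , λ G bipartite →
  let t , halts , bound = machine-run c (Graph.order G) (Correctness.adjacencies G) (Correctness.order≤length G) (s≤s z≤n)
  in t , _ , halts , bound , correct G bipartite

theorem4 : PolyTimeSolvableOn UnweightedRobustStableSet Bipartite
theorem4 = command⇒solvable program Correctness.program-correct
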